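{- Let $n$ be a positive integer and let $q=p^r \equiv 1 \pmod n$ be an odd prime power. Let $\zeta_n$ be a primitive $n$-th root of unity in $\mathbb{F}_q^{*}$. Let $\lambda\in\mathbb{F}_q$, $m\in\mathbb{Z}^+$ and $a_1,\dots,a_m,b_1,\dots,b_m\in\mathbb{Q}\cap\mathbb{Z}_p$. If $(\{na_i\}, \{nb_i\})$ are defined over $\mathbb{Q}$, then $$\sum_{l=0}^{n-1} {}_{m}G_{m}\left[ \begin{array}{cccc} n a_1, & n a_2, & \dots, & n a_m \\ n b_1, & n b_2, & \dots, & n b_m \end{array} \Big| \; \zeta_n^l \cdot\lambda \right]_q = {}_{nm}G_{nm}\left[ \begin{array}{c} a_i+\frac{l}{n} : 1 \leq i \leq m,\ 0 \leq l \leq n-1 \\ b_i +\frac{l}{n} : 1 \leq i \leq m,\ 0 \leq l \leq n-1 \end{array} \Big| \; \lambda^n \right]_q.$$ Furthermore, if $(\{na_i\}, \{nb_i\})$ are defined over $\mathbb{Q}$ with corresponding exponents $(\{p_i : 1 \leq i \leq t \}, \{q_i : 1 \leq i \leq s \})$, then $(\{a_i+\frac{l}{n}\}, \{b_i+\frac{l}{n}\})$ (with $1\le i\le m$, $0\le l\le n-1$) are defined over $\mathbb{Q}$ with exponents $(\{n p_i : 1 \leq i \leq t \}, \{n q_i : 1 \leq i \leq s\})$.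
   Context: $\mathbb{Z}_p$ is the ring of $p$-adic integers and $\Gamma_p$ is Morita's $p$-adic gamma function: $\Gamma_p(n):=(-1)^n\prod_{0<j<n,\,p\nmid j}j$ for $n\in\mathbb{Z}^+$, extended continuously to $\mathbb{Z}_p$, with $\Gamma_p(0)=1$. $\omega:\mathbb{F}_q^*\to\mathbb{Z}_q^{\times}$ is the Teichmüller character ($\mathbb{Z}_q$ the ring of integers of the unramified extension of $\mathbb{Q}_p$ with residue field $\mathbb{F}_q$; $\omega(x)$ is the $(q-1)$-st root of unity congruent to $x$ mod $p$), $\overline{\omega}$ is its inverse, and all powers (including the trivial one) are extended by the value $0$ at $0\in\mathbb{F}_q$. For $x\in\mathbb{Q}$, $\lfloor x\rfloor$ is the greatest integer less than or equal to $x$ and $\langle x\rangle=x-\lfloor x\rfloor$. Definition of ${}_mG_m$: for $q=p^r$, $p$ an odd prime, $\lambda\in\mathbb{F}_q$, $m\in\mathbb{Z}^+$, $a_i,b_i\in\mathbb{Q}\cap\mathbb{Z}_p$ ($1\le i\le m$), $${}_{m}G_{m}\left[ \begin{array}{ccc} a_1, & \dots, & a_m \\ b_1, & \dots, & b_m \end{array} \Big| \; \lambda \right]_q := \frac{ -1}{q-1} \sum_{j=0}^{q-2} (-1)^{jm}\, \overline{\omega}^j(\lambda) \prod_{i=1}^{m} \prod_{k=0}^{r-1} \frac{\Gamma_p(\langle (a_i -\frac{j}{q-1} )p^k \rangle)}{\Gamma_p(\langle a_i p^k \rangle)} \frac{\Gamma_p(\langle (-b_i +\frac{j}{q-1}) p^k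 \rangle)}{\Gamma_p(\langle -b_i p^k\rangle)} (-p)^{ -\lfloor\langle a_i p^k \rangle -\frac{j p^k}{q-1}\rfloor -\lfloor\langle -b_i p^k\rangle +\frac{j p^k}{q-1}\rfloor}.$$ Parameters defined over $\mathbb{Q}$: parameters $(\{\alpha_i\}_{i=1}^{m},\{\beta_i\}_{i=1}^{m})$ are defined over $\mathbb{Q}$ if there exist positive integers $p_1,\dots,p_t$ and $q_1,\dots,q_s$ (the corresponding exponents), with $t$ and $s$ minimal, such that $$\prod_{i=1}^{m} \frac{x- e^{2 \pi \mathrm{i} \alpha_i}}{x- e^{2 \pi \mathrm{i} \beta_i}} = \frac{\prod_{i=1}^{t} (x^{p_i} - 1)}{\prod_{i=1}^{s} (x^{q_i} - 1)}.$$ -}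

module Defs where

open import Level using (Level; _⊔_) renaming (suc to lsuc)
open import Function.Bundles using (Bijection; _⇔_)
open import Data.Product.Base using (∃; ∃₂; _×_; _,_; proj₁; proj₂)
open import Data.Sum.Base using (inj₁; inj₂)
open import Data.Empty using (⊥-elim)
open import Data.Nat.Base as ℕ using (ℕ; zero; suc; NonZero)
import Data.Nat.Properties as ℕ
import Data.Nat.DivMod as ℕ
import Data.Nat.Divisibility as ℕ
import Data.Nat.Coprimality as ℕ
open import Data.Nat.GCD using (module Bézout)
open import Data.Nat.Primality using (Prime; prime⇒nonZero; prime⇒nonTrivial; prime⇒irreducible)
open import Data.Integer.Base as ℤ using (ℤ; +_; -[1+_])
import Data.Integer.Properties as ℤ
import Data.Integer.Divisibility as ℤ
import Data.Integer.Divisibility.Signed as Signed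
import Data.Integer.DivMod as ℤ
import Data.Integer.Coprimality as ℤ
open import Data.Integer.Tactic.RingSolver using (solve-∀)
open import Data.Rational.Base as ℚ using (ℚ; floor; ↥_; ↧ₙ_)
open import Data.Fin.Base using (Fin; toℕ)
import Data.Fin.Properties as Fin
open import Data.List.Base as List using (List; []; _∷_)
open import Data.List.Relation.Unary.All using (All)
open import Data.Vec.Functional as Vector using (Vector)
open import Algebra.Bundles using (Semiring; CommutativeRing)
open import Algebra.Structures using (IsCommutativeRing)
open import Algebra.Apartness.Bundles using (HeytingField; HeytingCommutativeRing)
open import Algebra.Morphism.Structures using (module RingMorphisms)
import Algebra.Definitions.RawSemiring as RawSemiringDefs
import Algebra.Properties.Semiring.Exp as Exp
import Algebra.Properties.Semiring.Mult as Mult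
import Algebra.Properties.Ring as RingProperties
import Algebra.Solver.Ring.NaturalCoefficients.Default as NaturalCoefficients
open import Relation.Nullary using (¬_; Dec; yes; no)
open import Relation.Nullary.Decidable using (¬?; map′)
open import Relation.Binary.PropositionalEquality as ≡ using (_≡_; _≢_)

private variable
  c ℓ c′ ℓ′ ℓ₂ : Level

ℕ→ℚ : ℕ → ℚ
ℕ→ℚ n = + n ℚ./ 1

-- `fracPart` in Data.Rational is the distance to the truncation, which
-- differs from x - ⌊x⌋ for negative x.
⟨_⟩ : ℚ → ℚ
⟨ x ⟩ = x ℚ.- floor x ℚ./ 1

-- x ∈ ℚ ∩ ℤₚ
pIntegral : ℕ → ℚ → Set
pIntegral p x = ¬ p ℕ.∣ ↧ₙ x

multiples : (n : ℕ) {m : ℕ} → Vector ℚ m → Vector ℚ m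
multiples n a i = ℕ→ℚ n ℚ.* a i

translates : (n : ℕ) .{{_ : NonZero n}} {m : ℕ} → Vector ℚ m → Vector ℚ (n ℕ.* m)
translates n a = Vector.concat (λ (l : Fin n) i → a i ℚ.+ + toℕ l ℚ./ n)

private
  <∧∣⇒≡0 : ∀ {d x} → x ℕ.< d → d ℕ.∣ x → x ≡ 0
  <∧∣⇒≡0 {x = zero}  _   _   = ≡.refl
  <∧∣⇒≡0 {x = suc _} x<d d∣x = ⊥-elim (ℕ.>⇒∤ x<d d∣x)

  remainder-unique : ∀ {d a b} → a ℕ.< d → b ℕ.< d → + d Signed.∣ + a ℤ.- + b → a ≡ b
  remainder-unique {d} {a} {b} a<d b<d d∣a-b =
    ℤ.+-injective (ℤ.i-j≡0⇒i≡j (+ a) (+ b) (ℤ.∣i∣≡0⇒i≡0 (<∧∣⇒≡0 small (Signed.∣⇒∣ᵤ d∣a-b))))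
    where
    small : ℤ.∣ + a ℤ.- + b ∣ ℕ.< d
    small rewrite ℤ.m-n≡m⊖n a b =
      ℕ.≤-<-trans (ℤ.∣m⊝n∣≤m⊔n a b) (ℕ.⊔-lub a<d b<d)

  ∣-trans : ∀ d x y z → d Signed.∣ x ℤ.- y → d Signed.∣ y ℤ.- z → d Signed.∣ x ℤ.- z
  ∣-trans d x y z u v = ≡.subst (d Signed.∣_) (eq x y z) (Signed.∣m∣n⇒∣m+n u v)
    where
    eq : ∀ x y z → (x ℤ.- y) ℤ.+ (y ℤ.- z) ≡ x ℤ.- z
    eq = solve-∀

  ∣-sym : ∀ d x y → d Signed.∣ x ℤ.- y → d Signed.∣ y ℤ.- x
  ∣-sym d x y u = ≡.subst (d Signed.∣_) (eq x y) (Signed.∣m⇒∣-m u)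
    where
    eq : ∀ x y → ℤ.- (x ℤ.- y) ≡ y ℤ.- x
    eq = solve-∀

  ∣%ℕ : ∀ z d .{{_ : NonZero d}} → + d Signed.∣ z ℤ.- + (z ℤ.%ℕ d)
  ∣%ℕ z d = Signed.divides (z ℤ./ℕ d)
    (≡.trans (≡.cong (ℤ._- + (z ℤ.%ℕ d)) (ℤ.a≡a%ℕn+[a/ℕn]*n z d)) (eq (+ (z ℤ.%ℕ d)) _))
    where
    eq : ∀ x y → (x ℤ.+ y) ℤ.- x ≡ y
    eq = solve-∀

  %ℕ-cong : ∀ y z d .{{_ : NonZero d}} → + d Signed.∣ y ℤ.- z → y ℤ.%ℕ d ≡ z ℤ.%ℕ d
  %ℕ-cong y z d u = remainder-unique (ℤ.n%ℕd<d y d) (ℤ.n%ℕd<d z d)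
    (∣-trans (+ d) (+ (y ℤ.%ℕ d)) y (+ (z ℤ.%ℕ d)) (∣-sym (+ d) y (+ (y ℤ.%ℕ d)) (∣%ℕ y d))
      (∣-trans (+ d) y z (+ (z ℤ.%ℕ d)) u (∣%ℕ z d)))

inverseMod : ∀ {m n} → ℕ.Coprime m n → ℤ
inverseMod co with ℕ.coprime-Bézout co
... | Bézout.+- x _ _ = + x
... | Bézout.-+ x _ _ = ℤ.- + x

inverseMod-correct : ∀ {m n} (co : ℕ.Coprime m n) →
                     + n Signed.∣ + m ℤ.* inverseMod co ℤ.- + 1
inverseMod-correct {m} {n} co with ℕ.coprime-Bézout co
... | Bézout.+- x y eq = Signed.divides (+ y) (begin
  + m ℤ.* + x ℤ.- + 1               ≡⟨ ≡.cong (ℤ._- + 1) (ℤ.*-comm (+ m) (+ x)) ⟩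
  + x ℤ.* + m ℤ.- + 1               ≡⟨ ≡.cong (ℤ._- + 1) (ℤ.pos-* x m) ⟨
  + (x ℕ.* m) ℤ.- + 1               ≡⟨ ≡.cong (λ t → + t ℤ.- + 1) eq ⟨
  + 1 ℤ.+ + (y ℕ.* n) ℤ.- + 1       ≡⟨ ≡.cong (λ t → + 1 ℤ.+ t ℤ.- + 1) (ℤ.pos-* y n) ⟩
  + 1 ℤ.+ (+ y ℤ.* + n) ℤ.- + 1     ≡⟨ lem (+ y ℤ.* + n) ⟩
  + y ℤ.* + n                       ∎)
  where
  open ≡.≡-Reasoning
  lem : ∀ t → + 1 ℤ.+ t ℤ.- + 1 ≡ t
  lem = solve-∀
... | Bézout.-+ x y eq = Signed.divides (ℤ.- + y) (begin
  + m ℤ.* (ℤ.- + x) ℤ.- + 1         ≡⟨ lem (+ m) (+ x) ⟩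
  ℤ.- (+ 1 ℤ.+ + x ℤ.* + m)         ≡⟨ ≡.cong (λ t → ℤ.- (+ 1 ℤ.+ t)) (ℤ.pos-* x m) ⟨
  ℤ.- + (1 ℕ.+ x ℕ.* m)             ≡⟨ ≡.cong (λ t → ℤ.- + t) eq ⟩
  ℤ.- + (y ℕ.* n)                   ≡⟨ ≡.cong ℤ.-_ (ℤ.pos-* y n) ⟩
  ℤ.- (+ y ℤ.* + n)                 ≡⟨ ℤ.neg-distribˡ-* (+ y) (+ n) ⟩
  ℤ.- + y ℤ.* + n                   ∎)
  where
  open ≡.≡-Reasoning
  lem : ∀ m x → m ℤ.* (ℤ.- x) ℤ.- + 1 ≡ ℤ.- (+ 1 ℤ.+ x ℤ.* m)
  lem = solve-∀

module PAdic {p : ℕ} (p-prime : Prime p) where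

  p^≢0 : ∀ n → NonZero (p ℕ.^ n)
  p^≢0 n = ℕ.m^n≢0 p n {{prime⇒nonZero p-prime}}

  -- The inverse limit of the ℤ/pⁿ; coherence also forces residue n < pⁿ.
  -- Two p-adic integers are equal when their residues agree.
  record ℤₚ : Set where
    field
      residue  : ℕ → ℕ
      coherent : ∀ n → ℕ._%_ (residue (suc n)) (p ℕ.^ n) {{p^≢0 n}} ≡ residue n

  open ℤₚ public

  infix 4 _≡_[mod-p^_]
  _≡_[mod-p^_] : ℤₚ → ℤₚ → ℕ → Set
  x ≡ y [mod-p^ n ] = residue x n ≡ residue y n

  limit : (s : ℕ → ℤ) → (∀ n → + (p ℕ.^ n) Signed.∣ s (suc n) ℤ.- s n) → ℤₚ
  limit s cauchy = record
    { residue  = res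
    ; coherent = λ n → %ℕ-cong (+ res (suc n)) (s n) (p ℕ.^ n) {{p^≢0 n}}
        (∣-trans (+ (p ℕ.^ n)) (+ res (suc n)) (s (suc n)) (s n)
          (∣-sym (+ (p ℕ.^ n)) (s (suc n)) (+ res (suc n))
            (Signed.∣-trans (Signed.∣ᵤ⇒∣ (ℕ.n∣m*n p)) (∣%ℕ (s (suc n)) (p ℕ.^ suc n) {{p^≢0 (suc n)}})))
          (cauchy n))
    }
    where
    res : ℕ → ℕ
    res n = ℤ._%ℕ_ (s n) (p ℕ.^ n) {{p^≢0 n}}

  fromℤ : ℤ → ℤₚ
  fromℤ z = limit (λ _ → z)
    (λ n → ≡.subst (+ (p ℕ.^ n) Signed.∣_) (≡.sym (ℤ.+-inverseʳ z)) (Signed.divides (+ 0) ≡.refl))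

  coprime-p^ : ∀ {d} → ¬ p ℕ.∣ d → ∀ n → ℕ.Coprime d (p ℕ.^ n)
  coprime-p^ p∤d zero    (_ , e∣1) = ℕ.∣1⇒≡1 e∣1
  coprime-p^ p∤d (suc n) {e} (e∣d , e∣p^) =
    coprime-p^ p∤d n (e∣d , ℕ.coprime-divisor e⊥p e∣p^)
    where
    e⊥p : ℕ.Coprime e p
    e⊥p (f∣e , f∣p) with prime⇒irreducible p-prime f∣p
    ... | inj₁ f≡1    = f≡1
    ... | inj₂ ≡.refl = ⊥-elim (p∤d (ℕ.∣-trans f∣e e∣d))

  fromℚ∩ℤₚ : (x : ℚ) → pIntegral p x → ℤₚ
  fromℚ∩ℤₚ x p∤d = limit (λ n → ↥ x ℤ.* u n) cauchy
    where
    d = ↧ₙ x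

    co : ∀ n → ℕ.Coprime d (p ℕ.^ n)
    co = coprime-p^ p∤d

    u : ℕ → ℤ
    u n = inverseMod (co n)

    eq₁ : ∀ d u v → (d ℤ.* u ℤ.- + 1) ℤ.- (d ℤ.* v ℤ.- + 1) ≡ d ℤ.* (u ℤ.- v)
    eq₁ = solve-∀

    eq₂ : ∀ a u v → a ℤ.* (u ℤ.- v) ≡ a ℤ.* u ℤ.- a ℤ.* v
    eq₂ = solve-∀

    cauchy : ∀ n → + (p ℕ.^ n) Signed.∣ ↥ x ℤ.* u (suc n) ℤ.- ↥ x ℤ.* u n
    cauchy n = ≡.subst (+ (p ℕ.^ n) Signed.∣_) (eq₂ (↥ x) (u (suc n)) (u n))
      (Signed.∣n⇒∣m*n (↥ x)
        (Signed.∣ᵤ⇒∣ (ℤ.coprime-divisor (+ (p ℕ.^ n)) (+ d) (u (suc n) ℤ.- u n)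
          (ℕ.sym (co n))
          (Signed.∣⇒∣ᵤ (≡.subst (+ (p ℕ.^ n) Signed.∣_) (eq₁ (+ d) (u (suc n)) (u n))
            (Signed.∣m∣n⇒∣m-n
              (Signed.∣-trans (Signed.∣ᵤ⇒∣ (ℕ.n∣m*n p)) (inverseMod-correct (co (suc n))))
              (inverseMod-correct (co n))))))))

  -- Rationals outside ℤₚ are sent to 0; this value never occurs when the
  -- parameters of the hypergeometric function are p-integral.
  fromℚ : ℚ → ℤₚ
  fromℚ x with p ℕ.∣? ↧ₙ x
  ... | yes _  = fromℤ (+ 0)
  ... | no p∤d = fromℚ∩ℤₚ x p∤d

  -- (-1)ⁿ ∏ j over 0 < j < n with p ∤ j (j = 0 is excluded as p ∣ 0).
  morita : ℕ → ℤ
  morita n = ℤ.-1ℤ ℤ.^ n ℤ.* + List.foldr ℕ._*_ 1 (List.filter (λ j → ¬? (p ℕ.∣? j)) (List.upTo n))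

  -- ℕ is dense in ℤₚ, so these conditions determine Γ.
  record MoritaGamma : Set where
    field
      Γ          : ℤₚ → ℤₚ
      continuous : ∀ x k → ∃ λ N → ∀ y → x ≡ y [mod-p^ N ] → Γ x ≡ Γ y [mod-p^ k ]
      Γ-positive : ∀ n .{{_ : NonZero n}} k → Γ (fromℤ (+ n)) ≡ fromℤ (morita n) [mod-p^ k ]
      Γ-zero     : ∀ k → Γ (fromℤ (+ 0)) ≡ fromℤ (+ 1) [mod-p^ k ]

open PAdic public using (ℤₚ; MoritaGamma)

record FiniteField (q : ℕ) c ℓ : Set (lsuc (c ⊔ ℓ)) where
  field
    commutativeRing : CommutativeRing c ℓ
  open CommutativeRing commutativeRing public
  field
    1≉0         : ¬ 1# ≈ 0#
    inverse     : ∀ x → ¬ x ≈ 0# → ∃ λ y → x * y ≈ 1#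
    enumeration : Bijection setoid (≡.setoid (Fin q))

  open RawSemiringDefs (Semiring.rawSemiring semiring) public using (_^_)

  infix 4 _≟_
  _≟_ : ∀ x y → Dec (x ≈ y)
  x ≟ y = map′ (Bijection.injective enumeration) (Bijection.cong enumeration)
               (Bijection.to enumeration x Fin.≟ Bijection.to enumeration y)

  IsPrimitiveRoot : ℕ → Carrier → Set ℓ
  IsPrimitiveRoot n ζ = ζ ^ n ≈ 1# × (∀ k → 0 ℕ.< k → k ℕ.< n → ¬ ζ ^ k ≈ 1#)

IsRegular : (R : CommutativeRing c ℓ) → CommutativeRing.Carrier R → Set (c ⊔ ℓ)
IsRegular R s = ∀ x → s * x ≈ 0# → x ≈ 0#
  where open CommutativeRing R

module Localisation (R : CommutativeRing c ℓ) (s : CommutativeRing.Carrier R)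
  (regular : IsRegular R s) where

  open CommutativeRing R hiding (isCommutativeRing)
  open Exp semiring using (_^_; ^-homo-*)
  open RingProperties ring using (x≈y⇒x∙y⁻¹≈ε; x∙y⁻¹≈ε⇒x≈y; -‿distribʳ-*)
  open NaturalCoefficients commutativeSemiring using (solve; _:=_; _:+_; _:*_)
  open import Relation.Binary.Reasoning.Setoid setoid

  infix 5 _/s^_
  record Fraction : Set c where
    constructor _/s^_
    field
      numerator : Carrier
      exponent  : ℕ
  open Fraction

  infix 4 _≃_
  record _≃_ (x y : Fraction) : Set ℓ where
    constructor cross
    field
      uncross : s ^ exponent y * numerator x ≈ s ^ exponent x * numerator y

  _⊞_ _⊠_ : Fraction → Fraction → Fraction
  (a /s^ k) ⊞ (b /s^ l) = (s ^ l * a + s ^ k * b) /s^ (k ℕ.+ l)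
  (a /s^ k) ⊠ (b /s^ l) = (a * b) /s^ (k ℕ.+ l)

  ⊟_ : Fraction → Fraction
  ⊟ (a /s^ k) = (- a) /s^ k

  embed : Carrier → Fraction
  embed a = a /s^ 0

  s⁻¹ : Fraction
  s⁻¹ = 1# /s^ 1

  private
    cancel-s : ∀ {x y} → s * x ≈ s * y → x ≈ y
    cancel-s {x} {y} eq = x∙y⁻¹≈ε⇒x≈y x y (regular (x - y) (begin
      s * (x - y)         ≈⟨ trans (distribˡ s x (- y)) (+-congˡ (sym (-‿distribʳ-* s y))) ⟩
      s * x - s * y       ≈⟨ x≈y⇒x∙y⁻¹≈ε eq ⟩
      0#                  ∎))

    cancel : ∀ k {x y} → s ^ k * x ≈ s ^ k * y → x ≈ y
    cancel zero    {x} {y} eq = trans (sym (*-identityˡ x)) (trans eq (*-identityˡ y))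
    cancel (suc k) eq = cancel k (cancel-s (trans (sym (*-assoc _ _ _)) (trans eq (*-assoc _ _ _))))

    ≃-trans : ∀ {x y z} → x ≃ y → y ≃ z → x ≃ z
    ≃-trans {a /s^ k} {b /s^ l} {d /s^ m} (cross u) (cross v) = cross (cancel l (begin
      s ^ l * (s ^ m * a)   ≈⟨ solve 3 (λ x y z → (x :* (y :* z)) := (y :* (x :* z))) refl (s ^ l) (s ^ m) a ⟩
      s ^ m * (s ^ l * a)   ≈⟨ *-congˡ u ⟩
      s ^ m * (s ^ k * b)   ≈⟨ solve 3 (λ x y z → (x :* (y :* z)) := (y :* (x :* z))) refl (s ^ m) (s ^ k) b ⟩
      s ^ k * (s ^ m * b)   ≈⟨ *-congˡ v ⟩
      s ^ k * (s ^ l * d)   ≈⟨ solve 3 (λ x y z → (x :* (y :* z)) := (y :* (x :* z))) refl (s ^ k) (s ^ l) d ⟩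
      s ^ l * (s ^ k * d)   ∎))

    hom : ∀ k l → s ^ (k ℕ.+ l) ≈ s ^ k * s ^ l
    hom = ^-homo-* s

    ⊞-cong : ∀ {x x′ y y′} → x ≃ x′ → y ≃ y′ → (x ⊞ y) ≃ (x′ ⊞ y′)
    ⊞-cong {a /s^ k} {a′ /s^ k′} {b /s^ l} {b′ /s^ l′} (cross u) (cross v) = cross (begin
      s ^ (k′ ℕ.+ l′) * (s ^ l * a + s ^ k * b)
        ≈⟨ *-congʳ (hom k′ l′) ⟩
      s ^ k′ * s ^ l′ * (s ^ l * a + s ^ k * b)
        ≈⟨ solve 6 (λ K L K′ L′ a b →
             (K′ :* L′ :* (L :* a :+ K :* b)) := (L′ :* L :* (K′ :* a) :+ K′ :* K :* (L′ :* b)))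
             refl (s ^ k) (s ^ l) (s ^ k′) (s ^ l′) a b ⟩
      s ^ l′ * s ^ l * (s ^ k′ * a) + s ^ k′ * s ^ k * (s ^ l′ * b)
        ≈⟨ +-cong (*-congˡ u) (*-congˡ v) ⟩
      s ^ l′ * s ^ l * (s ^ k * a′) + s ^ k′ * s ^ k * (s ^ l * b′)
        ≈⟨ solve 6 (λ K L K′ L′ a b →
             (L′ :* L :* (K :* a) :+ K′ :* K :* (L :* b)) := (K :* L :* (L′ :* a :+ K′ :* b)))
             refl (s ^ k) (s ^ l) (s ^ k′) (s ^ l′) a′ b′ ⟩
      s ^ k * s ^ l * (s ^ l′ * a′ + s ^ k′ * b′)
        ≈⟨ *-congʳ (hom k l) ⟨
      s ^ (k ℕ.+ l) * (s ^ l′ * a′ + s ^ k′ * b′) ∎)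

    ⊠-cong : ∀ {x x′ y y′} → x ≃ x′ → y ≃ y′ → (x ⊠ y) ≃ (x′ ⊠ y′)
    ⊠-cong {a /s^ k} {a′ /s^ k′} {b /s^ l} {b′ /s^ l′} (cross u) (cross v) = cross (begin
      s ^ (k′ ℕ.+ l′) * (a * b)       ≈⟨ *-congʳ (hom k′ l′) ⟩
      s ^ k′ * s ^ l′ * (a * b)       ≈⟨ swap (s ^ k′) (s ^ l′) a b ⟩
      (s ^ k′ * a) * (s ^ l′ * b)     ≈⟨ *-cong u v ⟩
      (s ^ k * a′) * (s ^ l * b′)     ≈⟨ swap (s ^ k) (s ^ l) a′ b′ ⟨
      s ^ k * s ^ l * (a′ * b′)       ≈⟨ *-congʳ (hom k l) ⟨
      s ^ (k ℕ.+ l) * (a′ * b′)       ∎)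
      where
      swap : ∀ x y z w → x * y * (z * w) ≈ (x * z) * (y * w)
      swap = solve 4 (λ x y z w → (x :* y :* (z :* w)) := ((x :* z) :* (y :* w))) refl

    ⊟-cong : ∀ {x y} → x ≃ y → (⊟ x) ≃ (⊟ y)
    ⊟-cong {a /s^ k} {b /s^ l} (cross u) = cross (begin
      s ^ l * - a     ≈⟨ -‿distribʳ-* (s ^ l) a ⟨
      - (s ^ l * a)   ≈⟨ -‿cong u ⟩
      - (s ^ k * b)   ≈⟨ -‿distribʳ-* (s ^ k) b ⟩
      s ^ k * - b     ∎)

    same : ∀ {a b k l} → k ≡ l → a ≈ b → (a /s^ k) ≃ (b /s^ l)
    same ≡.refl a≈b = cross (*-congˡ a≈b)

    ⊞-assoc : ∀ x y z → ((x ⊞ y) ⊞ z) ≃ (x ⊞ (y ⊞ z))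
    ⊞-assoc (a /s^ k) (b /s^ l) (d /s^ m) = same (ℕ.+-assoc k l m) (begin
      s ^ m * (s ^ l * a + s ^ k * b) + s ^ (k ℕ.+ l) * d
        ≈⟨ +-congˡ (*-congʳ (hom k l)) ⟩
      s ^ m * (s ^ l * a + s ^ k * b) + s ^ k * s ^ l * d
        ≈⟨ solve 6 (λ K L M a b d →
             (M :* (L :* a :+ K :* b) :+ K :* L :* d) := (L :* M :* a :+ K :* (M :* b :+ L :* d)))
             refl (s ^ k) (s ^ l) (s ^ m) a b d ⟩
      s ^ l * s ^ m * a + s ^ k * (s ^ m * b + s ^ l * d)
        ≈⟨ +-congʳ (*-congʳ (hom l m)) ⟨
      s ^ (l ℕ.+ m) * a + s ^ k * (s ^ m * b + s ^ l * d) ∎)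

    ⊞-comm : ∀ x y → (x ⊞ y) ≃ (y ⊞ x)
    ⊞-comm (a /s^ k) (b /s^ l) = same (ℕ.+-comm k l) (+-comm _ _)

    ⊞-identityˡ : ∀ x → (embed 0# ⊞ x) ≃ x
    ⊞-identityˡ (a /s^ k) = same ≡.refl
      (trans (+-cong (zeroʳ _) (*-identityˡ a)) (+-identityˡ a))

    ⊞-identityʳ : ∀ x → (x ⊞ embed 0#) ≃ x
    ⊞-identityʳ x = ≃-trans (⊞-comm x (embed 0#)) (⊞-identityˡ x)

    ⊟-inverseˡ : ∀ x → ((⊟ x) ⊞ x) ≃ embed 0#
    ⊟-inverseˡ (a /s^ k) = cross (begin
      1# * (s ^ k * - a + s ^ k * a)   ≈⟨ *-congˡ (distribˡ _ _ _) ⟨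
      1# * (s ^ k * (- a + a))         ≈⟨ *-congˡ (*-congˡ (-‿inverseˡ a)) ⟩
      1# * (s ^ k * 0#)                ≈⟨ *-congˡ (zeroʳ _) ⟩
      1# * 0#                          ≈⟨ zeroʳ _ ⟩
      0#                               ≈⟨ zeroʳ _ ⟨
      s ^ (k ℕ.+ k) * 0#               ∎)

    ⊟-inverseʳ : ∀ x → (x ⊞ (⊟ x)) ≃ embed 0#
    ⊟-inverseʳ x = ≃-trans (⊞-comm x (⊟ x)) (⊟-inverseˡ x)

    ⊠-assoc : ∀ x y z → ((x ⊠ y) ⊠ z) ≃ (x ⊠ (y ⊠ z))
    ⊠-assoc (a /s^ k) (b /s^ l) (d /s^ m) = same (ℕ.+-assoc k l m) (*-assoc a b d)

    ⊠-comm : ∀ x y → (x ⊠ y) ≃ (y ⊠ x)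
    ⊠-comm (a /s^ k) (b /s^ l) = same (ℕ.+-comm k l) (*-comm a b)

    ⊠-identityˡ : ∀ x → (embed 1# ⊠ x) ≃ x
    ⊠-identityˡ (a /s^ k) = same ≡.refl (*-identityˡ a)

    ⊠-identityʳ : ∀ x → (x ⊠ embed 1#) ≃ x
    ⊠-identityʳ x = ≃-trans (⊠-comm x (embed 1#)) (⊠-identityˡ x)

    distribˡ′ : ∀ x y z → (x ⊠ (y ⊞ z)) ≃ ((x ⊠ y) ⊞ (x ⊠ z))
    distribˡ′ (a /s^ k) (b /s^ l) (d /s^ m) = cross (begin
      s ^ ((k ℕ.+ l) ℕ.+ (k ℕ.+ m)) * (a * (s ^ m * b + s ^ l * d))
        ≈⟨ *-congʳ (trans (hom (k ℕ.+ l) (k ℕ.+ m)) (*-cong (hom k l) (hom k m))) ⟩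
      (s ^ k * s ^ l) * (s ^ k * s ^ m) * (a * (s ^ m * b + s ^ l * d))
        ≈⟨ solve 6 (λ K L M a b d →
             ((K :* L) :* (K :* M) :* (a :* (M :* b :+ L :* d)))
             := ((K :* (L :* M)) :* ((K :* M) :* (a :* b) :+ (K :* L) :* (a :* d))))
             refl (s ^ k) (s ^ l) (s ^ m) a b d ⟩
      (s ^ k * (s ^ l * s ^ m)) * ((s ^ k * s ^ m) * (a * b) + (s ^ k * s ^ l) * (a * d))
        ≈⟨ *-cong (trans (hom k (l ℕ.+ m)) (*-congˡ (hom l m)))
                  (+-cong (*-congʳ (hom k m)) (*-congʳ (hom k l))) ⟨
      s ^ (k ℕ.+ (l ℕ.+ m)) * (s ^ (k ℕ.+ m) * (a * b) + s ^ (k ℕ.+ l) * (a * d)) ∎)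

    distribʳ′ : ∀ x y z → ((y ⊞ z) ⊠ x) ≃ ((y ⊠ x) ⊞ (z ⊠ x))
    distribʳ′ x y z = ≃-trans (⊠-comm (y ⊞ z) x) (≃-trans (distribˡ′ x y z)
      (⊞-cong (⊠-comm x y) (⊠-comm x z)))

  isCommutativeRing : IsCommutativeRing _≃_ _⊞_ _⊠_ ⊟_ (embed 0#) (embed 1#)
  isCommutativeRing = record
    { isRing = record
      { +-isAbelianGroup = record
        { isGroup = record
          { isMonoid = record
            { isSemigroup = record
              { isMagma = record
                { isEquivalence = record
                  { refl  = cross refl
                  ; sym   = λ (cross u) → cross (sym u)
                  ; trans = ≃-trans
                  }
                ; ∙-cong = ⊞-cong
                }
              ; assoc = ⊞-assoc
              }
            ; identity = ⊞-identityˡ , ⊞-identityʳ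
            }
          ; inverse = ⊟-inverseˡ , ⊟-inverseʳ
          ; ⁻¹-cong = ⊟-cong
          }
        ; comm = ⊞-comm
        }
      ; *-cong     = ⊠-cong
      ; *-assoc    = ⊠-assoc
      ; *-identity = ⊠-identityˡ , ⊠-identityʳ
      ; distrib    = distribˡ′ , distribʳ′
      }
    ; *-comm = ⊠-comm
    }

  commutativeRing : CommutativeRing c ℓ
  commutativeRing = record { isCommutativeRing = isCommutativeRing }

-- A complete discrete valuation ring of characteristic 0 with uniformiser p
-- and residue field F.  For F finite this describes, up to unique
-- isomorphism over F, the ring of integers ℤ_q of the unramified extension
-- of ℚₚ with residue field F.
record UnramifiedIntegers (p : ℕ) {q : ℕ} (F : FiniteField q c ℓ) c′ ℓ′
       : Set (c ⊔ ℓ ⊔ lsuc (c′ ⊔ ℓ′)) where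
  private module F = FiniteField F
  field
    commutativeRing : CommutativeRing c′ ℓ′
  open CommutativeRing commutativeRing public
  open RawSemiringDefs (Semiring.rawSemiring semiring) public using (_^_; _∣_) renaming (_×_ to _·_)

  fromℕ : ℕ → Carrier
  fromℕ n = n · 1#

  field
    residue        : Carrier → F.Carrier
    residue-isHom  : RingMorphisms.IsRingHomomorphism rawRing (CommutativeRing.rawRing F.commutativeRing) residue
    residue-surj   : ∀ y → ∃ λ x → residue x F.≈ y
    residue-kernel : ∀ x → residue x F.≈ F.0# ⇔ fromℕ p ∣ x
    unit           : ∀ x → ¬ residue x F.≈ F.0# → ∃ λ y → x * y ≈ 1#
    p-regular      : IsRegular commutativeRing (fromℕ p)
    separated      : ∀ x → (∀ n → fromℕ p ^ n ∣ x) → x ≈ 0#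
    complete       : ∀ (s : ℕ → Carrier) → (∀ n → fromℕ p ^ n ∣ s (suc n) - s n) →
                     ∃ λ x → ∀ n → fromℕ p ^ n ∣ x - s n

  -- The inverse of a unit, extended by 0 to the maximal ideal.
  unitInverse : Carrier → Carrier
  unitInverse x with residue x F.≟ F.0#
  ... | yes _  = 0#
  ... | no x≉0 = proj₁ (unit x x≉0)

  module Fractions = Localisation commutativeRing (fromℕ p) p-regular

  -- ℚ_q
  fractionField : CommutativeRing c′ ℓ′
  fractionField = Fractions.commutativeRing

  open RawSemiringDefs (Semiring.rawSemiring (CommutativeRing.semiring fractionField)) using () renaming (_^_ to _^ₖ_)

  -- Powers of -p with integer exponent; the inverse of -p is -(1/p).
  [-p]^ : ℤ → CommutativeRing.Carrier fractionField
  [-p]^ (+ k)    = Fractions.embed (- fromℕ p) ^ₖ k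
  [-p]^ -[1+ k ] = (Fractions.⊟ Fractions.s⁻¹) ^ₖ suc k

  private
    fromℕ-^ : ∀ n → fromℕ (p ℕ.^ n) ≈ fromℕ p ^ n
    fromℕ-^ zero    = +-identityʳ 1#
    fromℕ-^ (suc n) = trans (Mult.×1-homo-* semiring p (p ℕ.^ n)) (*-congˡ (fromℕ-^ n))

  module _ (p-prime : Prime p) where
    open PAdic p-prime using (coherent; p^≢0) renaming (residue to approx)

    private
      cauchy : (x : ℤₚ p-prime) → ∀ n →
               fromℕ p ^ n ∣ fromℕ (approx x (suc n)) - fromℕ (approx x n)
      cauchy x n = record { quotient = fromℕ t ; equality = begin
        fromℕ t * fromℕ p ^ n
          ≈⟨ *-congˡ (fromℕ-^ n) ⟨
        fromℕ t * fromℕ (p ℕ.^ n)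
          ≈⟨ Mult.×1-homo-* semiring t (p ℕ.^ n) ⟨
        fromℕ (t ℕ.* p ℕ.^ n)
          ≈⟨ RingProperties.xyx⁻¹≈y ring (fromℕ (approx x n)) _ ⟨
        (fromℕ (approx x n) + fromℕ (t ℕ.* p ℕ.^ n)) - fromℕ (approx x n)
          ≈⟨ +-congʳ (Mult.×-homo-+ semiring 1# (approx x n) _) ⟨
        fromℕ (approx x n ℕ.+ t ℕ.* p ℕ.^ n) - fromℕ (approx x n)
          ≡⟨ ≡.cong (λ z → fromℕ z - fromℕ (approx x n)) division ⟨
        fromℕ (approx x (suc n)) - fromℕ (approx x n) ∎ }
        where
        open import Relation.Binary.Reasoning.Setoid setoid
        t = ℕ._/_ (approx x (suc n)) (p ℕ.^ n) {{p^≢0 n}}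
        division : approx x (suc n) ≡ approx x n ℕ.+ t ℕ.* p ℕ.^ n
        division = ≡.trans (ℕ.m≡m%n+[m/n]*n (approx x (suc n)) (p ℕ.^ n) {{p^≢0 n}})
                           (≡.cong (ℕ._+ t ℕ.* p ℕ.^ n) (coherent x n))

    fromℤₚ : ℤₚ p-prime → Carrier
    fromℤₚ x = proj₁ (complete (λ n → fromℕ (approx x n)) (cauchy x))

-- The two conditions determine ω(x).
record TeichmüllerCharacter {p q : ℕ} {F : FiniteField q c ℓ}
       (Z : UnramifiedIntegers p F c′ ℓ′) : Set (c ⊔ ℓ ⊔ c′ ⊔ ℓ′) where
  private
    module F = FiniteField F
    module Z = UnramifiedIntegers Z
  field
    ω              : (x : F.Carrier) → ¬ x F.≈ F.0# → Z.Carrier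
    ω-rootOfUnity  : ∀ x x≉0 → ω x x≉0 Z.^ (q ℕ.∸ 1) Z.≈ Z.1#
    ω-residue      : ∀ x x≉0 → Z.residue (ω x x≉0) F.≈ x

  ω̄^ : ℕ → F.Carrier → Z.Carrier
  ω̄^ j x with x F.≟ F.0#
  ... | yes _  = Z.0#
  ... | no x≉0 = Z.unitInverse (ω x x≉0) Z.^ j

module Hypergeometric
  {p : ℕ} (p-prime : Prime p) {r : ℕ} .{{r≢0 : NonZero r}}
  {F : FiniteField (p ℕ.^ r) c ℓ} (Z : UnramifiedIntegers p F c′ ℓ′)
  (ω : TeichmüllerCharacter Z) (Γₚ : MoritaGamma p-prime)
  where

  open PAdic p-prime using (fromℚ)
  open MoritaGamma Γₚ using (Γ)
  open TeichmüllerCharacter ω using (ω̄^)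
  private
    module F = FiniteField F
    module Z = UnramifiedIntegers Z
  open Z.Fractions using (embed)
  open CommutativeRing Z.fractionField
  open RawSemiringDefs (Semiring.rawSemiring semiring) using (_^_; sum; product)

  private
    q : ℕ
    q = p ℕ.^ r

    instance
      q-1≢0 : NonZero (q ℕ.∸ 1)
      q-1≢0 = ℕ.>-nonZero (ℕ.m<n⇒0<n∸m (ℕ.<-≤-trans 1<p
        (ℕ.≤-trans (ℕ.≤-reflexive (≡.sym (ℕ.^-identityʳ p)))
                   (ℕ.^-monoʳ-≤ p {{prime⇒nonZero p-prime}} (ℕ.>-nonZero⁻¹ r)))))
        where
        1<p : 1 ℕ.< p
        1<p = ℕ.nonTrivial⇒n>1 p {{prime⇒nonTrivial p-prime}}

  -- Γₚ(x)/Γₚ(y); values of Γₚ are units.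
  Γ[_]/Γ[_] : ℚ → ℚ → Carrier
  Γ[ x ]/Γ[ y ] = embed (Z.fromℤₚ p-prime (Γ (fromℚ x)) Z.* Z.unitInverse (Z.fromℤₚ p-prime (Γ (fromℚ y))))

  module _ (a b : ℚ) (j k : ℕ) where
    private
      pᵏ j/[q-1] : ℚ
      pᵏ      = ℕ→ℚ (p ℕ.^ k)
      j/[q-1] = + j ℚ./ (q ℕ.∸ 1)

    factor : Carrier
    factor =
        Γ[ ⟨ (a ℚ.- j/[q-1]) ℚ.* pᵏ ⟩ ]/Γ[ ⟨ a ℚ.* pᵏ ⟩ ]
      * Γ[ ⟨ (ℚ.- b ℚ.+ j/[q-1]) ℚ.* pᵏ ⟩ ]/Γ[ ⟨ ℚ.- b ℚ.* pᵏ ⟩ ]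
      * Z.[-p]^ (ℤ.- floor (⟨ a ℚ.* pᵏ ⟩ ℚ.- j/[q-1] ℚ.* pᵏ)
                 ℤ.- floor (⟨ ℚ.- b ℚ.* pᵏ ⟩ ℚ.+ j/[q-1] ℚ.* pᵏ))

  G : (m : ℕ) → Vector ℚ m → Vector ℚ m → F.Carrier → Carrier
  G m a b x = - embed (Z.unitInverse (Z.fromℕ (q ℕ.∸ 1))) *
    sum λ (j : Fin (q ℕ.∸ 1)) →
      (- 1#) ^ (toℕ j ℕ.* m) * embed (ω̄^ (toℕ j) x) *
      product λ (i : Fin m) → product λ (k : Fin r) → factor (a i) (b i) (toℕ j) (toℕ k)

module Polynomial (R : CommutativeRing c ℓ) where
  open CommutativeRing R using (Carrier; _≈_; 0#; 1#) renaming (_+_ to _+ᴿ_; _*_ to _*ᴿ_; -_ to -ᴿ_)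

  -- coefficients, constant term first
  Poly : Set c
  Poly = List Carrier

  coeff : Poly → ℕ → Carrier
  coeff []      _       = 0#
  coeff (a ∷ f) zero    = a
  coeff (a ∷ f) (suc k) = coeff f k

  infix 4 _≈ᴾ_
  _≈ᴾ_ : Poly → Poly → Set ℓ
  f ≈ᴾ g = ∀ k → coeff f k ≈ coeff g k

  infixl 6 _+_
  _+_ : Poly → Poly → Poly
  []      + g       = g
  (a ∷ f) + []      = a ∷ f
  (a ∷ f) + (b ∷ g) = a +ᴿ b ∷ f + g

  infixl 7 _*_
  _*_ : Poly → Poly → Poly
  []      * g = []
  (a ∷ f) * g = List.map (a *ᴿ_) g + (0# ∷ f * g)

  constant : Carrier → Poly
  constant a = a ∷ []

  X^ : ℕ → Poly
  X^ zero    = constant 1#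
  X^ (suc n) = 0# ∷ X^ n

  ∏ : List Poly → Poly
  ∏ = List.foldr _*_ (constant 1#)

  X^ⁿ-1 : ℕ → Poly
  X^ⁿ-1 n = X^ n + constant (-ᴿ 1#)

  X-_ : Carrier → Poly
  X- a = X^ 1 + constant (-ᴿ a)

  -- Numerator and denominator.  Denominators are monic in every use below,
  -- so cross-multiplication is equality in the field of rational functions.
  RationalFunction : Set c
  RationalFunction = Poly × Poly

  infix 4 _≈ᶠ_
  _≈ᶠ_ : RationalFunction → RationalFunction → Set ℓ
  (f , g) ≈ᶠ (h , k) = f * k ≈ᴾ h * g

-- A (Heyting) field together with the restriction to ℚ of α ↦ e^{2πiα}: a homomorphism
-- ℚ → K^× with kernel ℤ.  K = ℂ is the intended model.  In every model the
-- exp (k / n), 0 ≤ k < n, are the n distinct n-th roots of unity (so K has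
-- characteristic 0), and any two models have isomorphic subfields generated
-- by the values of exp, compatibly with exp.
record ComplexExponential c ℓ ℓ₂ : Set (lsuc (c ⊔ ℓ ⊔ ℓ₂)) where
  field
    heytingField : HeytingField c ℓ ℓ₂
  open HeytingField heytingField public
  field
    exp      : ℚ → Carrier
    exp-+    : ∀ α β → exp (α ℚ.+ β) ≈ exp α * exp β
    exp-ℤ    : ∀ (z : ℤ) → exp (z ℚ./ 1) ≈ 1#
    exp-∉ℤ   : ∀ α → (∀ (z : ℤ) → α ≢ z ℚ./ 1) → exp α # 1#

module DefinedOverℚ (E : ComplexExponential c ℓ ℓ₂) where
  open ComplexExponential E using (exp; heytingCommutativeRing)
  open Polynomial (HeytingCommutativeRing.commutativeRing heytingCommutativeRing)

  parameterQuotient : {m : ℕ} → Vector ℚ m → Vector ℚ m → RationalFunction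
  parameterQuotient α β = ∏ (Vector.toList λ i → X- exp (α i)) , ∏ (Vector.toList λ i → X- exp (β i))

  exponentQuotient : List ℕ → List ℕ → RationalFunction
  exponentQuotient ps qs = ∏ (List.map X^ⁿ-1 ps) , ∏ (List.map X^ⁿ-1 qs)

  IsRepresentation : {m : ℕ} → Vector ℚ m → Vector ℚ m → List ℕ → List ℕ → Set ℓ
  IsRepresentation α β ps qs =
    All NonZero ps × All NonZero qs × parameterQuotient α β ≈ᶠ exponentQuotient ps qs

  HasExponents : {m : ℕ} → Vector ℚ m → Vector ℚ m → List ℕ → List ℕ → Set ℓ
  HasExponents α β ps qs =
    IsRepresentation α β ps qs ×
    (∀ ps′ qs′ → IsRepresentation α β ps′ qs′ →
      List.length ps ℕ.≤ List.length ps′ × List.length qs ℕ.≤ List.length qs′)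

  AreDefinedOverℚ : {m : ℕ} → Vector ℚ m → Vector ℚ m → Set ℓ
  AreDefinedOverℚ α β = ∃₂ (HasExponents α β)

{-# OPTIONS --safe #-}
-- Orthogonality of characters leaves on the left hand side the summands with
-- n ∣ j, each n times, and on the right hand side the j-th summand is periodic
-- in j with period (q - 1) / n.  So the identity reduces to an equality between
-- the product of the j-th factors for the translated parameters and that of
-- the (n j)-th factors for n aᵢ, n bᵢ.
--
-- Over a common denominator L, the fractional parts of (aᵢ + l/n) pᵏ, l < n,
-- are (⟨n aᵢ pᵏ⟩ + h)/n, h < n, and the Gauss formula says that
--   ∏ₕ Γₚ((X + h)/n) · n^c(N) ≡ Γₚ(X) ∏ₕ Γₚ(h/n)
-- for integers N close to X, where c(N) counts the j < N prime to p.  If N is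
-- close to X then p N - g is close to p X - g and c(p N - g) = (p - 1) N - g.
-- Being defined over ℚ makes the multiset of the parameters, numerators against
-- denominators, invariant under multiplication by p modulo ℤ.  Together with
-- p^r ≡ 1 (mod q - 1) this makes the total exponent of n divisible by
-- (p - 1) p^M, and the powers of n cancel by Euler's theorem.  The same
-- description of the fractional parts matches the powers of -p, as
-- L ⌊(ρ(y) + s)/L⌋ = ρ(y) + s - ρ(y + s) for the residue ρ modulo L.
--
-- Polynomial identities are checked at the points exp(1/s) for all large s.
-- The exponents of a quotient of products of X^d - 1 are unique up to common
-- factors, as is seen from the largest exponent M and the root exp(1/M).  Hence
-- a representation of the translates remains one of n aᵢ, n bᵢ after discarding
-- the exponents not divisible by n and dividing the others by n.
module Submission where

open import Defs
open import Level using (Level; _⊔_)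
open import Function.Base using (_∘_; id)
open import Function.Bundles using (Equivalence)
open import Data.Nat.Base as ℕ using (ℕ; zero; suc; NonZero)
import Data.Nat.Properties as ℕ
import Data.Nat.DivMod as ℕ
open import Data.Nat.Divisibility as ℕ using (_∣_)
import Data.Nat.Coprimality as ℕ
import Data.Nat.Primality as ℕ
open import Data.Nat.Primality using (Prime)
open import Data.Integer.Base as ℤ using (ℤ; +_; -[1+_])
import Data.Integer.Properties as ℤ
import Data.Integer.DivMod as ℤ
import Data.Integer.GCD as ℤ
import Data.Integer.Divisibility.Signed as Signed
open import Data.Integer.Tactic.RingSolver using (solve-∀)
open import Data.Rational.Base as ℚ using (ℚ; floor; ↥_; ↧ₙ_)
import Data.Rational.Properties as ℚ
import Data.Rational.Unnormalised.Base as ℚᵘ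
import Data.Rational.Unnormalised.Properties as ℚᵘ
open import Data.Fin.Base as Fin using (Fin; toℕ)
import Data.Fin.Properties as Fin
import Data.Fin.Permutation as Perm
open import Data.List.Base as List using (List; []; _∷_)
import Data.List.Properties as List
open import Data.List.Relation.Unary.All as All using (All; []; _∷_)
import Data.List.Relation.Unary.All.Properties as All
open import Data.List.Relation.Unary.Any using (here; there)
open import Data.List.Membership.Propositional using (_∈_)
import Data.List.Membership.Propositional.Properties as Membership
open import Data.Nat.ListAction using () renaming (product to ℕ-product)
import Data.Nat.ListAction.Properties as ListAction
import Data.Nat.Induction as ℕ
open import Data.List.Relation.Binary.Permutation.Propositional as ↭ using (_↭_)
import Data.List.Relation.Binary.Permutation.Propositional.Properties as ↭
open import Data.Vec.Functional as Vector using (Vector)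
open import Data.Product.Base using (∃; ∃₂; _×_; _,_; proj₁; proj₂)
open import Data.Sum.Base using (_⊎_; inj₁; inj₂; [_,_]′)
open import Data.Empty using (⊥-elim)
open import Algebra.Bundles using (CommutativeMonoid; Semiring; CommutativeRing)
import Algebra.Definitions.RawSemiring as RawSemiringDefs
open import Algebra.Morphism.Structures using (module RingMorphisms)
open import Algebra.Apartness.Bundles using (HeytingCommutativeRing)
import Algebra.Apartness.Properties.HeytingCommutativeRing as HeytingProperties
import Algebra.Properties.CommutativeMonoid.Sum as Sum
import Algebra.Properties.Semiring.Exp as Exp
import Algebra.Properties.CommutativeSemiring.Exp as CommutativeExp
import Algebra.Properties.Semiring.Mult as Mult
import Algebra.Properties.Monoid.Mult as MonoidMult
import Algebra.Properties.Ring as RingProperties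
import Algebra.Solver.CommutativeMonoid as CommutativeMonoidSolver
import Algebra.Solver.Ring.NaturalCoefficients.Default as NaturalCoefficients
import Relation.Binary.Reasoning.Setoid as SetoidReasoning
open import Relation.Nullary using (¬_; Dec; yes; no)
open import Relation.Nullary.Decidable using (¬?)
open import Relation.Binary.PropositionalEquality as ≡ using (_≡_; _≢_)

-- The factor n^c(N) in the Gauss formula means that a single factor for the translates need not
-- equal its counterpart; only the product over all parameters and all k < r does. As n need not be
-- 1 modulo p, it cannot be raised to a p-adic exponent. The formula is therefore kept at the level
-- of natural numbers N modulo p^(M+1), where only c(N) modulo (p - 1) p^M matters. The count c(N)
-- depends on the last p-adic digit of N, hence the passage from X to p X - g: it makes the count
-- affine in residues modulo L, and its total is computed from the same residue sums as the powers
-- of -p. Every factor is divided by its value at j = 0, which removes constants such as the product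
-- of the Γₚ(h/n).
--
-- The invariance under p has an obstacle of its own: multiplication by p permutes the d-th roots of
-- unity only for p prime to d, and p may divide an exponent. So p is replaced by some u ≡ p modulo
-- L that is prime to all exponents.
--
-- Equality in the field of the exponential is not decidable. Distinct roots are those with
-- invertible difference, and factors are cancelled only at points where they are invertible.

private variable
  c ℓ c′ ℓ′ ℓ₂ : Level

-- Congruences and finite sums

inverse : ∀ u n .{{_ : NonZero n}} → ℕ.Coprime u n → ∃ λ v → + n Signed.∣ + u ℤ.* + v ℤ.- + 1
inverse u n co = inverseMod co ℤ.%ℕ n , ≡.subst (+ n Signed.∣_) (eq (+ u) (inverseMod co) (inverseMod co ℤ./ℕ n) (+ n) _ (ℤ.a≡a%ℕn+[a/ℕn]*n (inverseMod co) n))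
    (Signed.∣m∣n⇒∣m-n (inverseMod-correct co) (Signed.∣n⇒∣m*n (+ u ℤ.* (inverseMod co ℤ./ℕ n)) Signed.∣-refl))
  where
  lem : ∀ u i t n r → (u ℤ.* (r ℤ.+ t ℤ.* n) ℤ.- + 1) ℤ.- u ℤ.* t ℤ.* n ≡ u ℤ.* r ℤ.- + 1
  lem = solve-∀
  eq : ∀ u i t n r → i ≡ r ℤ.+ t ℤ.* n → (u ℤ.* i ℤ.- + 1) ℤ.- u ℤ.* t ℤ.* n ≡ u ℤ.* r ℤ.- + 1
  eq u i t n r ≡.refl = lem u i t n r

+∣-⇒%≡ : ∀ {a b} n .{{_ : NonZero n}} → + n Signed.∣ + a ℤ.- + b → a ℕ.% n ≡ b ℕ.% n
+∣-⇒%≡ {a} {b} n n∣ = [ (λ b≤a → ≤-case b≤a n∣) , (λ a≤b → ≡.sym (≤-case a≤b (≡.subst (+ n Signed.∣_) (neg (+ a) (+ b)) (Signed.∣m⇒∣-m n∣)))) ]′ (ℕ.≤-total b a)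
  where
  neg : ∀ a b → ℤ.- (a ℤ.- b) ≡ b ℤ.- a
  neg = solve-∀
  ≤-case : ∀ {a b} → b ℕ.≤ a → + n Signed.∣ + a ℤ.- + b → a ℕ.% n ≡ b ℕ.% n
  ≤-case {a} {b} b≤a d with Signed.∣⇒∣ᵤ (≡.subst (+ n Signed.∣_) (≡.trans (ℤ.m-n≡m⊖n a b) (ℤ.⊖-≥ b≤a)) d)
  ... | ℕ.divides q eq = ≡.trans (≡.cong (ℕ._% n) (≡.trans (≡.sym (ℕ.m+[n∸m]≡n b≤a)) (≡.cong (b ℕ.+_) eq))) (ℕ.[m+kn]%n≡m%n b q n)

infix 4 _≋_[_]
-- A record and not a synonym: unification could not recover `x` and `y` from the divisibility of
-- their difference.
record _≋_[_] (x y : ℤ) (d : ℕ) : Set where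
  constructor congruent
  field divides : + d Signed.∣ x ℤ.- y
open _≋_[_] public

module _ {d : ℕ} where

  ≋-refl : ∀ {x} → x ≋ x [ d ]
  ≋-refl {x} = congruent (≡.subst (+ d Signed.∣_) (≡.sym (ℤ.+-inverseʳ x)) (Signed.divides (+ 0) ≡.refl))

  ≋-reflexive : ∀ {x y} → x ≡ y → x ≋ y [ d ]
  ≋-reflexive ≡.refl = ≋-refl

  ≋-sym : ∀ {x y} → x ≋ y [ d ] → y ≋ x [ d ]
  ≋-sym {x} {y} (congruent u) = congruent (≡.subst (+ d Signed.∣_) (eq x y) (Signed.∣m⇒∣-m u))
    where
    eq : ∀ x y → ℤ.- (x ℤ.- y) ≡ y ℤ.- x
    eq = solve-∀

  ≋-trans : ∀ {x y z} → x ≋ y [ d ] → y ≋ z [ d ] → x ≋ z [ d ]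
  ≋-trans {x} {y} {z} (congruent u) (congruent v) = congruent (≡.subst (+ d Signed.∣_) (eq x y z) (Signed.∣m∣n⇒∣m+n u v))
    where
    eq : ∀ x y z → (x ℤ.- y) ℤ.+ (y ℤ.- z) ≡ x ℤ.- z
    eq = solve-∀

  ≋-+ : ∀ {x x′ y y′} → x ≋ x′ [ d ] → y ≋ y′ [ d ] → x ℤ.+ y ≋ x′ ℤ.+ y′ [ d ]
  ≋-+ {x} {x′} {y} {y′} (congruent u) (congruent v) = congruent (≡.subst (+ d Signed.∣_) (eq x x′ y y′) (Signed.∣m∣n⇒∣m+n u v))
    where
    eq : ∀ x x′ y y′ → (x ℤ.- x′) ℤ.+ (y ℤ.- y′) ≡ (x ℤ.+ y) ℤ.- (x′ ℤ.+ y′)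
    eq = solve-∀

  ≋-* : ∀ {x x′ y y′} → x ≋ x′ [ d ] → y ≋ y′ [ d ] → x ℤ.* y ≋ x′ ℤ.* y′ [ d ]
  ≋-* {x} {x′} {y} {y′} (congruent u) (congruent v) = congruent
    (≡.subst (+ d Signed.∣_) (eq x x′ y y′) (Signed.∣m∣n⇒∣m+n (Signed.∣m⇒∣m*n y u) (Signed.∣n⇒∣m*n x′ v)))
    where
    eq : ∀ x x′ y y′ → (x ℤ.- x′) ℤ.* y ℤ.+ x′ ℤ.* (y ℤ.- y′) ≡ x ℤ.* y ℤ.- x′ ℤ.* y′
    eq = solve-∀

  ≋-*ˡ : ∀ x {y y′} → y ≋ y′ [ d ] → x ℤ.* y ≋ x ℤ.* y′ [ d ]
  ≋-*ˡ x = ≋-* {x} ≋-refl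

  ≋-*ʳ : ∀ {x x′} y → x ≋ x′ [ d ] → x ℤ.* y ≋ x′ ℤ.* y [ d ]
  ≋-*ʳ y u = ≋-* {y = y} u ≋-refl

  ≋-neg : ∀ {x y} → x ≋ y [ d ] → ℤ.- x ≋ ℤ.- y [ d ]
  ≋-neg {x} {y} (congruent u) = congruent (≡.subst (+ d Signed.∣_) (eq x y) (Signed.∣m⇒∣-m u))
    where
    eq : ∀ x y → ℤ.- (x ℤ.- y) ≡ ℤ.- x ℤ.- ℤ.- y
    eq = solve-∀

  ≋-^ : ∀ {x y} k → x ≋ y [ d ] → x ℤ.^ k ≋ y ℤ.^ k [ d ]
  ≋-^ zero    u = ≋-refl
  ≋-^ (suc k) u = ≋-* u (≋-^ k u)

  d*k≋0 : ∀ k → + d ℤ.* k ≋ + 0 [ d ]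
  d*k≋0 k = congruent (≡.subst (+ d Signed.∣_) (≡.sym (ℤ.+-identityʳ _)) (Signed.∣m⇒∣m*n k Signed.∣-refl))

  ≋-+d* : ∀ x k → x ℤ.+ + d ℤ.* k ≋ x [ d ]
  ≋-+d* x k = ≋-trans (≋-+ {x} ≋-refl (d*k≋0 k)) (≋-reflexive (ℤ.+-identityʳ x))

  ≋-cancelˡ : ∀ {u v x y} → u ℤ.* v ≋ + 1 [ d ] → v ℤ.* x ≋ v ℤ.* y [ d ] → x ≋ y [ d ]
  ≋-cancelˡ {u} {v} {x} {y} inv eq = ≋-trans (≋-sym (undo x)) (≋-trans (≋-*ˡ u eq) (undo y))
    where
    undo : ∀ x → u ℤ.* (v ℤ.* x) ≋ x [ d ]
    undo x = ≋-trans (≋-reflexive (≡.sym (ℤ.*-assoc u v x)))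
      (≋-trans (≋-*ʳ x inv) (≋-reflexive (ℤ.*-identityˡ x)))

≋-weaken : ∀ {d e x y} → e ∣ d → x ≋ y [ d ] → x ≋ y [ e ]
≋-weaken e∣d (congruent u) = congruent (Signed.∣-trans (Signed.∣ᵤ⇒∣ e∣d) u)

≋-dec : ∀ N .{{_ : NonZero N}} x y → Dec (x ≋ y [ N ])
≋-dec N x y with (+ N) Signed.∣? (x ℤ.- y)
... | yes u = yes (congruent u)
... | no ¬u = no (¬u ∘ divides)

%ℕ-≋ : ∀ z d .{{_ : NonZero d}} → + (z ℤ.%ℕ d) ≋ z [ d ]
%ℕ-≋ z d = ≋-sym (≋-trans (≋-reflexive (≡.trans (ℤ.a≡a%ℕn+[a/ℕn]*n z d)
  (≡.cong (ℤ._+_ (+ (z ℤ.%ℕ d))) (ℤ.*-comm _ (+ d))))) (≋-+d* _ (z ℤ./ℕ d)))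

≋⇒%ℕ≡ : ∀ {x y} d .{{_ : NonZero d}} → x ≋ y [ d ] → x ℤ.%ℕ d ≡ y ℤ.%ℕ d
≋⇒%ℕ≡ {x} {y} d u = ≡.trans (≡.sym (ℕ.m<n⇒m%n≡m (ℤ.n%ℕd<d x d)))
  (≡.trans (+∣-⇒%≡ d (divides (≋-trans (%ℕ-≋ x d) (≋-trans u (≋-sym (%ℕ-≋ y d))))))
    (ℕ.m<n⇒m%n≡m (ℤ.n%ℕd<d y d)))

module _ (n : ℕ) .{{_ : NonZero n}} where

  scale : ℕ → Fin n → Fin n
  scale u i = Fin.fromℕ< (ℕ.m%n<n (u ℕ.* toℕ i) n)

  toℕ-scale : ∀ u i → + toℕ (scale u i) ≋ + u ℤ.* + toℕ i [ n ]
  toℕ-scale u i = ≋-trans (≋-reflexive (≡.cong +_ (Fin.toℕ-fromℕ< (ℕ.m%n<n (u ℕ.* toℕ i) n))))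
    (≋-trans (%ℕ-≋ (+ (u ℕ.* toℕ i)) n) (≋-reflexive (ℤ.pos-* u (toℕ i))))

  scale-scale : ∀ u v → + u ℤ.* + v ≋ + 1 [ n ] → ∀ i → scale u (scale v i) ≡ i
  scale-scale u v inv i = Fin.toℕ-injective (≡.trans (≡.sym (ℕ.m<n⇒m%n≡m (Fin.toℕ<n (scale u (scale v i)))))
    (≡.trans (+∣-⇒%≡ n (divides (≋-trans (toℕ-scale u (scale v i)) (≋-trans (≋-*ˡ (+ u) (toℕ-scale v i))
      (≋-trans (≋-reflexive (≡.sym (ℤ.*-assoc (+ u) (+ v) (+ toℕ i))))
        (≋-trans (≋-*ʳ (+ toℕ i) inv) (≋-reflexive (ℤ.*-identityˡ _))))))))
      (ℕ.m<n⇒m%n≡m (Fin.toℕ<n i))))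

  scalePermutation : ∀ u → ℕ.Coprime u n → Perm.Permutation n n
  scalePermutation u co = Perm.permutation (scale u) (scale v)
    (scale-scale u v inv) (scale-scale v u (≋-trans (≋-reflexive (ℤ.*-comm (+ v) (+ u))) inv))
    where
    v = proj₁ (inverse u n co)
    inv : + u ℤ.* + v ≋ + 1 [ n ]
    inv = congruent (proj₂ (inverse u n co))

-- Kept over an arbitrary commutative monoid, as the same facts on permuting and shifting residues
-- serve sums in `ℤ`, sums and products in rings, and products of integers modulo a prime power.
module FiniteSums (M : CommutativeMonoid c ℓ) where
  open CommutativeMonoid M
  open Sum M using (sum; sum-init-last; sum-permute; sum-cong-≋; sum-replicate; sum-replicate-zero; ∑-distrib-+; ∑-comm) public
  open MonoidMult monoid using () renaming (_×_ to _·_)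
  open SetoidReasoning setoid

  ∑< : ∀ n → (ℕ → Carrier) → Carrier
  ∑< n f = sum {n} (f ∘ toℕ)

  ∑<-cong : ∀ n {f g : ℕ → Carrier} → (∀ i → i ℕ.< n → f i ≈ g i) → ∑< n f ≈ ∑< n g
  ∑<-cong n eq = sum-cong-≋ (λ i → eq (toℕ i) (Fin.toℕ<n i))

  ∑<-ε : ∀ n {f : ℕ → Carrier} → (∀ i → i ℕ.< n → f i ≈ ε) → ∑< n f ≈ ε
  ∑<-ε n eq = trans (∑<-cong n eq) (sum-replicate-zero n)

  ∑<-last : ∀ n f → ∑< (suc n) f ≈ ∑< n f ∙ f n
  ∑<-last zero    f = comm (f 0) ε
  ∑<-last (suc n) f = trans (∙-congˡ (∑<-last n (f ∘ suc))) (sym (assoc _ _ _))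

  ∑<-rotate : ∀ n f → f n ≈ f 0 → ∑< n (f ∘ suc) ≈ ∑< n f
  ∑<-rotate zero    f eq = refl
  ∑<-rotate (suc n) f eq = begin
    ∑< (suc n) (f ∘ suc)          ≈⟨ ∑<-last n (f ∘ suc) ⟩
    ∑< n (f ∘ suc) ∙ f (suc n)    ≈⟨ comm _ _ ⟩
    f (suc n) ∙ ∑< n (f ∘ suc)    ≈⟨ ∙-congʳ eq ⟩
    f 0 ∙ ∑< n (f ∘ suc)          ∎

  Periodic : ℕ → (ℕ → Carrier) → Set ℓ
  Periodic n f = ∀ x → f (n ℕ.+ x) ≈ f x

  ∑<-shift : ∀ n s {f} → Periodic n f → ∑< n (λ x → f (s ℕ.+ x)) ≈ ∑< n f
  ∑<-shift n zero    per = refl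
  ∑<-shift n (suc s) {f} per = begin
    ∑< n (λ x → f (suc s ℕ.+ x))   ≡⟨⟩
    ∑< n ((λ x → f (suc x)) ∘ (s ℕ.+_)) ≈⟨ ∑<-shift n s {f ∘ suc} (λ x → trans (reflexive (≡.cong f (≡.sym (ℕ.+-suc n x)))) (per (suc x))) ⟩
    ∑< n (f ∘ suc)                  ≈⟨ ∑<-rotate n f (trans (reflexive (≡.cong f (≡.sym (ℕ.+-identityʳ n)))) (per 0)) ⟩
    ∑< n f                          ∎

  periodic-* : ∀ n {f} → Periodic n f → ∀ k x → f (k ℕ.* n ℕ.+ x) ≈ f x
  periodic-* n per zero    x = refl
  periodic-* n {f} per (suc k) x =
    trans (reflexive (≡.cong f (ℕ.+-assoc n (k ℕ.* n) x))) (trans (per _) (periodic-* n per k x))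

  periodic-% : ∀ n .{{_ : NonZero n}} {f} → Periodic n f → ∀ x → f x ≈ f (x ℕ.% n)
  periodic-% n {f} per x = trans
    (reflexive (≡.cong f (≡.trans (ℕ.m≡m%n+[m/n]*n x n) (ℕ.+-comm (x ℕ.% n) _))))
    (periodic-* n per (x ℕ./ n) (x ℕ.% n))

  -- A periodic summand sees only the residue, and a factor prime to `n` permutes the residues.
  -- Euler's theorem, the stability of the d-th roots of unity and the rearrangement of translates
  -- all rest on this.
  ∑<-*-permute : ∀ n u {f} → ℕ.Coprime u n → Periodic n f → ∑< n (λ x → f (u ℕ.* x)) ≈ ∑< n f
  ∑<-*-permute zero        u co per = refl
  ∑<-*-permute n@(suc _) u {f} co per = begin
    ∑< n (λ x → f (u ℕ.* x))
      ≈⟨ ∑<-cong n {λ x → f (u ℕ.* x)} {λ x → f ((u ℕ.* x) ℕ.% n)} (λ x _ → periodic-% n per (u ℕ.* x)) ⟩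
    sum {n} (λ i → f ((u ℕ.* toℕ i) ℕ.% n))
      ≈⟨ sum-cong-≋ {n} (λ i → reflexive (≡.cong f (≡.sym (Fin.toℕ-fromℕ< (ℕ.m%n<n (u ℕ.* toℕ i) n))))) ⟩
    sum {n} (λ i → f (toℕ (scale n u i)))
      ≈⟨ sum-permute {n} {n} (f ∘ toℕ) (scalePermutation n u co) ⟨
    ∑< n f ∎

  ∑<-+ : ∀ m n f → ∑< (m ℕ.+ n) f ≈ ∑< m f ∙ ∑< n (λ x → f (m ℕ.+ x))
  ∑<-+ zero    n f = sym (identityˡ _)
  ∑<-+ (suc m) n f = trans (∙-congˡ (∑<-+ m n (f ∘ suc))) (sym (assoc _ _ _))

  ∑<-* : ∀ m n f → ∑< (m ℕ.* n) f ≈ ∑< m (λ i → ∑< n (λ j → f (i ℕ.* n ℕ.+ j)))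
  ∑<-* zero    n f = refl
  ∑<-* (suc m) n f = trans (∑<-+ n (m ℕ.* n) f) (∙-congˡ (trans (∑<-* m n (λ x → f (n ℕ.+ x)))
    (∑<-cong m (λ i _ → ∑<-cong n (λ j _ → reflexive (≡.cong f (≡.sym (ℕ.+-assoc n (i ℕ.* n) j))))))))

  ∑<-const : ∀ n x → ∑< n (λ _ → x) ≈ n · x
  ∑<-const n x = sum-replicate n

  sum-↑ : ∀ m {n} (f : Fin (m ℕ.+ n) → Carrier) →
          sum f ≈ sum (λ i → f (i Fin.↑ˡ n)) ∙ sum (λ i → f (m Fin.↑ʳ i))
  sum-↑ zero    f = sym (identityˡ _)
  sum-↑ (suc m) f = trans (∙-congˡ (sum-↑ m (f ∘ Fin.suc))) (sym (assoc _ _ _))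

  sum-concat : ∀ {a} {A : Set a} n {m} (xs : Fin n → Fin m → A) (f : A → Carrier) →
               sum {n ℕ.* m} (λ i → f (Vector.concat xs i)) ≈ sum {n} (λ l → sum {m} (λ i → f (xs l i)))
  sum-concat zero    xs f = refl
  sum-concat (suc n) {m} xs f = trans (sum-↑ m {n ℕ.* m} _)
    (∙-cong (sum-cong-≋ {m} (λ i → reflexive (≡.cong f (left i))))
            (trans (sum-cong-≋ {n ℕ.* m} (λ i → reflexive (≡.cong f (right i)))) (sum-concat n (xs ∘ Fin.suc) f)))
    where
    left : ∀ i → Vector.concat xs (i Fin.↑ˡ (n ℕ.* m)) ≡ xs Fin.zero i
    left i rewrite Fin.splitAt-↑ˡ m i (n ℕ.* m) = ≡.refl
    right : ∀ i → Vector.concat xs (m Fin.↑ʳ i) ≡ Vector.concat (xs ∘ Fin.suc) i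
    right i rewrite Fin.splitAt-↑ʳ m (n ℕ.* m) i = ≡.refl

-- The Gauss multiplication formula for Morita's products

≋-*-commutativeMonoid : ℕ → CommutativeMonoid _ _
≋-*-commutativeMonoid d = record
  { Carrier = ℤ
  ; _≈_ = λ x y → x ≋ y [ d ]
  ; _∙_ = ℤ._*_
  ; ε = + 1
  ; isCommutativeMonoid = record
    { isMonoid = record
      { isSemigroup = record
        { isMagma = record
          { isEquivalence = record { refl = ≋-refl ; sym = ≋-sym ; trans = ≋-trans }
          ; ∙-cong = ≋-*
          }
        ; assoc = λ x y z → ≋-reflexive (ℤ.*-assoc x y z)
        }
      ; identity = (λ x → ≋-reflexive (ℤ.*-identityˡ x)) , (λ x → ≋-reflexive (ℤ.*-identityʳ x))
      }
    ; comm = λ x y → ≋-reflexive (ℤ.*-comm x y)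
    }
  }

Unit : ℕ → ℤ → Set
Unit d x = ∃ λ u → u ℤ.* x ≋ + 1 [ d ]

unit-1 : ∀ {d} → Unit d (+ 1)
unit-1 = + 1 , ≋-refl

unit-neg : ∀ {d x} → Unit d x → Unit d (ℤ.- x)
unit-neg {d} {x} (u , eq) = ℤ.- u , ≋-trans (≋-reflexive (lem u x)) eq
  where
  lem : ∀ u x → ℤ.- u ℤ.* ℤ.- x ≡ u ℤ.* x
  lem = solve-∀

unit-* : ∀ {d x y} → Unit d x → Unit d y → Unit d (x ℤ.* y)
unit-* {d} {x} {y} (u , eq) (v , eq′) = u ℤ.* v , ≋-trans (≋-reflexive (lem u v x y)) (≋-* eq eq′)
  where
  lem : ∀ u v x y → u ℤ.* v ℤ.* (x ℤ.* y) ≡ (u ℤ.* x) ℤ.* (v ℤ.* y)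
  lem = solve-∀

unit-^ : ∀ {d x} k → Unit d x → Unit d (x ℤ.^ k)
unit-^ zero    u = unit-1
unit-^ (suc k) u = unit-* u (unit-^ k u)

unit-coprime : ∀ {x d} .{{_ : NonZero d}} → ℕ.Coprime x d → Unit d (+ x)
unit-coprime {x} {d} co with inverse x d co
... | v , eq = + v , ≋-trans (≋-reflexive (ℤ.*-comm (+ v) (+ x))) (congruent eq)

≋-cancel : ∀ {d u x y} → Unit d u → u ℤ.* x ≋ u ℤ.* y [ d ] → x ≋ y [ d ]
≋-cancel {u = u} (v , inv) = ≋-cancelˡ {u = v} {v = u} inv

∣⇒≋0 : ∀ {d x} → d ∣ x → + x ≋ + 0 [ d ]
∣⇒≋0 {x = x} d∣x = congruent (≡.subst (Signed._∣_ _) (≡.sym (ℤ.+-identityʳ (+ x))) (Signed.∣ᵤ⇒∣ d∣x))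

≋0⇒∣ : ∀ {d x} → + x ≋ + 0 [ d ] → d ∣ x
≋0⇒∣ {x = x} (congruent u) = Signed.∣⇒∣ᵤ (≡.subst (Signed._∣_ _) (ℤ.+-identityʳ (+ x)) u)

module MoritaProduct {p : ℕ} (p-prime : Prime p) where

  open PAdic p-prime using (morita; p^≢0; coprime-p^)

  instance
    p≢0 : NonZero p
    p≢0 = ℕ.prime⇒nonZero p-prime

  unitCount : ℕ → ℕ
  unitCount zero    = 0
  unitCount (suc N) with p ℕ.∣? N
  ... | yes _ = unitCount N
  ... | no  _ = suc (unitCount N)

  -- The quotient Γₚ(N + 1) / Γₚ(N) from the functional equation.
  moritaStep : ℕ → ℤ
  moritaStep N with p ℕ.∣? N
  ... | yes _ = ℤ.-1ℤ
  ... | no  _ = ℤ.- + N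

  private
    ∏ : List ℕ → ℕ
    ∏ = List.foldr ℕ._*_ 1

    P? = λ j → ¬? (p ℕ.∣? j)

    ∏-∷ʳ : ∀ xs x → ∏ (xs List.++ List.[ x ]) ≡ ∏ xs ℕ.* x
    ∏-∷ʳ []       x = ℕ.*-comm x 1
    ∏-∷ʳ (y ∷ xs) x = ≡.trans (≡.cong (y ℕ.*_) (∏-∷ʳ xs x)) (≡.sym (ℕ.*-assoc y (∏ xs) x))

    filter-∷ʳ : ∀ N → List.filter P? (List.upTo (suc N)) ≡ List.filter P? (List.upTo N) List.++ List.filter P? List.[ N ]
    filter-∷ʳ N = ≡.trans (≡.cong (List.filter P?) (≡.sym (List.upTo-∷ʳ N))) (List.filter-++ P? (List.upTo N) List.[ N ])

    lem₁ : ∀ s x → ℤ.-1ℤ ℤ.* s ℤ.* x ≡ ℤ.-1ℤ ℤ.* (s ℤ.* x)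
    lem₁ = solve-∀

    lem₂ : ∀ s x y → ℤ.-1ℤ ℤ.* s ℤ.* (x ℤ.* y) ≡ ℤ.- y ℤ.* (s ℤ.* x)
    lem₂ = solve-∀

  morita-suc : ∀ N → morita (suc N) ≡ moritaStep N ℤ.* morita N
  morita-suc N with p ℕ.∣? N | filter-∷ʳ N | List.filter-reject P? {N} {[]} | List.filter-accept P? {N} {[]}
  ... | yes d | eq | rej | _ = ≡.trans
    (≡.cong (λ l → ℤ.-1ℤ ℤ.* ℤ.-1ℤ ℤ.^ N ℤ.* + ∏ l) (≡.trans eq (≡.trans (≡.cong (List.filter P? (List.upTo N) List.++_) (rej (λ ¬d → ¬d d))) (List.++-identityʳ _))))
    (lem₁ (ℤ.-1ℤ ℤ.^ N) _)
  ... | no ¬d | eq | _ | acc = ≡.trans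
    (≡.cong (λ l → ℤ.-1ℤ ℤ.* ℤ.-1ℤ ℤ.^ N ℤ.* + l) (≡.trans (≡.cong ∏ (≡.trans eq (≡.cong (List.filter P? (List.upTo N) List.++_) (acc ¬d)))) (∏-∷ʳ (List.filter P? (List.upTo N)) N)))
    (≡.trans (≡.cong (ℤ.-1ℤ ℤ.* ℤ.-1ℤ ℤ.^ N ℤ.*_) (ℤ.pos-* (∏ (List.filter P? (List.upTo N))) N)) (lem₂ (ℤ.-1ℤ ℤ.^ N) _ (+ N)))

  unit-∤ : ∀ K {x} → ¬ p ∣ x → Unit (p ℕ.^ K) (+ x)
  unit-∤ K p∤x = unit-coprime {{p^≢0 K}} (coprime-p^ p∤x K)

  unit-moritaStep : ∀ K N → Unit (p ℕ.^ K) (moritaStep N)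
  unit-moritaStep K N with p ℕ.∣? N
  ... | yes _   = unit-neg unit-1
  ... | no  p∤N = unit-neg (unit-∤ K p∤N)

  unit-morita : ∀ K N → Unit (p ℕ.^ K) (morita N)
  unit-morita K zero    = unit-1
  unit-morita K (suc N) = ≡.subst (Unit (p ℕ.^ K)) (≡.sym (morita-suc N)) (unit-* (unit-moritaStep K N) (unit-morita K N))

  unitCount-suc-∣ : ∀ {N} → p ∣ N → unitCount (suc N) ≡ unitCount N
  unitCount-suc-∣ {N} d with p ℕ.∣? N
  ... | yes _ = ≡.refl
  ... | no ¬d = ⊥-elim (¬d d)

  unitCount-suc-∤ : ∀ {N} → ¬ p ∣ N → unitCount (suc N) ≡ suc (unitCount N)
  unitCount-suc-∤ {N} ¬d with p ℕ.∣? N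
  ... | yes d = ⊥-elim (¬d d)
  ... | no _  = ≡.refl

  -- Proved together with `unitCount-block`: a block of `p` consecutive numbers from `p N` on has
  -- only its first member divisible by `p`, and a full block leads to the next multiple of `p`.
  unitCount-p* : ∀ N → unitCount (p ℕ.* N) ≡ (p ℕ.∸ 1) ℕ.* N
  unitCount-block : ∀ N e → e ℕ.< p → unitCount (p ℕ.* N ℕ.+ suc e) ≡ (p ℕ.∸ 1) ℕ.* N ℕ.+ e

  unitCount-p* zero    = ≡.trans (≡.cong unitCount (ℕ.*-zeroʳ p)) (≡.sym (ℕ.*-zeroʳ (p ℕ.∸ 1)))
  unitCount-p* (suc N) = ≡.trans (≡.cong unitCount lem) (≡.trans (unitCount-block N (p ℕ.∸ 1) (ℕ.≤-reflexive (ℕ.suc-pred p)))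
    (≡.trans (ℕ.+-comm _ (p ℕ.∸ 1)) (≡.sym (ℕ.*-suc (p ℕ.∸ 1) N))))
    where
    lem : p ℕ.* suc N ≡ p ℕ.* N ℕ.+ suc (p ℕ.∸ 1)
    lem = ≡.trans (ℕ.*-suc p N) (≡.trans (ℕ.+-comm p _) (≡.cong (p ℕ.* N ℕ.+_) (≡.sym (ℕ.suc-pred p))))

  unitCount-block N zero _ = ≡.trans (≡.cong unitCount (ℕ.+-comm (p ℕ.* N) 1))
    (≡.trans (unitCount-suc-∣ (ℕ.m∣m*n N)) (≡.trans (unitCount-p* N) (≡.sym (ℕ.+-identityʳ _))))
  unitCount-block N (suc e) e<p = ≡.trans (≡.cong unitCount (ℕ.+-suc (p ℕ.* N) (suc e)))
    (≡.trans (unitCount-suc-∤ (λ d → ℕ.>⇒∤ e<p (ℕ.∣m+n∣m⇒∣n d (ℕ.m∣m*n N))))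
      (≡.trans (≡.cong suc (unitCount-block N e (ℕ.<-trans (ℕ.n<1+n e) e<p))) (≡.sym (ℕ.+-suc _ e))))

  module _ (M n : ℕ) .{{_ : NonZero n}} (p∤n : ¬ p ∣ n) where

    private
      -- With a successor as exponent, `p` divides `P`, and the number of units below `P` is
      -- `(p - 1) p^M`.
      P = p ℕ.^ suc M

      instance
        P≢0 : NonZero P
        P≢0 = p^≢0 (suc M)

      p∣P : p ∣ P
      p∣P = ℕ.m∣m*n (p ℕ.^ M)

      CM = ≋-*-commutativeMonoid P

    open FiniteSums CM using () renaming (∑< to ∏<; ∑<-last to ∏<-last; ∑<-cong to ∏<-cong; ∑<-*-permute to ∏<-*-permute; ∑-distrib-+ to ∏-distrib-*)
    open SetoidReasoning (CommutativeMonoid.setoid CM)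

    unit-∏< : ∀ k f → (∀ i → Unit P (f i)) → Unit P (∏< k f)
    unit-∏< zero    f u = unit-1
    unit-∏< (suc k) f u = unit-* (u 0) (unit-∏< k (f ∘ suc) (u ∘ suc))

    private
      ∣-cong : ∀ {x y} → + x ≋ + y [ P ] → p ∣ y → p ∣ x
      ∣-cong eq p∣y = ≋0⇒∣ (≋-trans (≋-weaken p∣P eq) (∣⇒≋0 p∣y))

      ∣-n* : ∀ {x} → p ∣ n ℕ.* x → p ∣ x
      ∣-n* {x} d = [ (λ p∣n → ⊥-elim (p∤n p∣n)) , id ]′ (ℕ.euclidsLemma n x p-prime d)

    nFactor : ℕ → ℤ
    nFactor x with p ℕ.∣? x
    ... | yes _ = + 1
    ... | no  _ = + n

    ∏-nFactor : ∀ N → ∏< N nFactor ≋ (+ n) ℤ.^ unitCount N [ P ]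
    ∏-nFactor zero = ≋-refl
    ∏-nFactor (suc N) = ≋-trans (∏<-last N nFactor) (≋-trans (≋-*ʳ (nFactor N) (∏-nFactor N)) (last N))
      where
      last : ∀ N → (+ n) ℤ.^ unitCount N ℤ.* nFactor N ≋ (+ n) ℤ.^ unitCount (suc N) [ P ]
      last N with p ℕ.∣? N
      ... | yes _ = ≋-reflexive (ℤ.*-identityʳ _)
      ... | no  _ = ≋-reflexive (ℤ.*-comm _ (+ n))

    -- Multiplication by `n` permutes the residues modulo `P`. Those divisible by `p` are replaced
    -- by 1, so the product over all residues is a unit and can be cancelled; `n` then remains once
    -- for each unit below `P`.
    euler : (+ n) ℤ.^ ((p ℕ.∸ 1) ℕ.* p ℕ.^ M) ≋ + 1 [ P ]
    euler = ≋-cancel (unit-∏< P f unit-f) (begin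
      ∏< P f ℤ.* (+ n) ℤ.^ ((p ℕ.∸ 1) ℕ.* p ℕ.^ M)  ≡⟨ ≡.cong (λ t → ∏< P f ℤ.* (+ n) ℤ.^ t) (unitCount-p* (p ℕ.^ M)) ⟨
      ∏< P f ℤ.* (+ n) ℤ.^ unitCount P              ≈⟨ ≋-*ˡ (∏< P f) (∏-nFactor P) ⟨
      ∏< P f ℤ.* ∏< P nFactor                     ≈⟨ ∏-distrib-* {P} (f ∘ toℕ) (nFactor ∘ toℕ) ⟨
      ∏< P (λ x → f x ℤ.* nFactor x)              ≈⟨ ∏<-cong P {λ x → f x ℤ.* nFactor x} {λ x → f (n ℕ.* x)} (λ x _ → f-n* x) ⟩
      ∏< P (λ x → f (n ℕ.* x))                    ≈⟨ ∏<-*-permute P n (coprime-p^ p∤n (suc M)) f-periodic ⟩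
      ∏< P f                                      ≡⟨ ℤ.*-identityʳ _ ⟨
      ∏< P f ℤ.* + 1                              ∎)
      where
      f : ℕ → ℤ
      f x with p ℕ.∣? x
      ... | yes _ = + 1
      ... | no  _ = + x

      unit-f : ∀ x → Unit P (f x)
      unit-f x with p ℕ.∣? x
      ... | yes _ = unit-1
      ... | no p∤x = unit-∤ (suc M) p∤x

      f-periodic : ∀ x → f (P ℕ.+ x) ≋ f x [ P ]
      f-periodic x with p ℕ.∣? (P ℕ.+ x) | p ℕ.∣? x
      ... | yes _ | yes _  = ≋-refl
      ... | yes d | no ¬d  = ⊥-elim (¬d (ℕ.∣m+n∣m⇒∣n d p∣P))
      ... | no ¬d | yes d  = ⊥-elim (¬d (ℕ.∣m∣n⇒∣m+n p∣P d))
      ... | no _  | no _   = ≋-trans (≋-reflexive (ℤ.+-comm (+ P) (+ x)))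
        (≋-trans (≋-+ {x = + x} ≋-refl (∣⇒≋0 ℕ.∣-refl)) (≋-reflexive (ℤ.+-identityʳ _)))

      f-n* : ∀ x → f x ℤ.* nFactor x ≋ f (n ℕ.* x) [ P ]
      f-n* x with p ℕ.∣? x | p ℕ.∣? (n ℕ.* x)
      ... | yes _ | yes _ = ≋-refl
      ... | yes d | no ¬d = ⊥-elim (¬d (ℕ.∣n⇒∣m*n n d))
      ... | no ¬d | yes d = ⊥-elim (¬d (∣-n* d))
      ... | no _  | no _  = ≋-reflexive (≡.trans (ℤ.*-comm (+ x) (+ n)) (≡.sym (ℤ.pos-* n x)))

    module _ (n′ : ℕ) (inv : + n ℤ.* + n′ ≋ + 1 [ P ]) where

      -- N / n modulo P, chosen so that adding n to N adds exactly 1.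
      divide : ℕ → ℕ
      divide N = N ℕ.% n ℕ.* n′ ℕ.+ N ℕ./ n

      divide-+ : ∀ N → divide (N ℕ.+ n) ≡ suc (divide N)
      divide-+ N = ≡.trans (≡.cong₂ (λ x y → x ℕ.* n′ ℕ.+ y) (ℕ.[m+n]%n≡m%n N n)
        (≡.trans (ℕ.+-distrib-/-∣ʳ N ℕ.∣-refl) (≡.trans (≡.cong (N ℕ./ n ℕ.+_) (ℕ.n/n≡1 n)) (ℕ.+-comm _ 1))))
        (ℕ.+-suc _ _)

      n*divide : ∀ N → + n ℤ.* + divide N ≋ + N [ P ]
      n*divide N = begin
        + n ℤ.* + divide N
          ≡⟨ ≡.cong (λ t → + n ℤ.* (t ℤ.+ + (N ℕ./ n))) (ℤ.pos-* (N ℕ.% n) n′) ⟩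
        + n ℤ.* (+ (N ℕ.% n) ℤ.* + n′ ℤ.+ + (N ℕ./ n))
          ≡⟨ lem (+ n) (+ (N ℕ.% n)) (+ n′) (+ (N ℕ./ n)) ⟩
        + n ℤ.* + n′ ℤ.* + (N ℕ.% n) ℤ.+ + (N ℕ./ n) ℤ.* + n
          ≈⟨ ≋-+ {y = + (N ℕ./ n) ℤ.* + n} (≋-*ʳ (+ (N ℕ.% n)) inv) ≋-refl ⟩
        + 1 ℤ.* + (N ℕ.% n) ℤ.+ + (N ℕ./ n) ℤ.* + n
          ≡⟨ ≡.cong₂ ℤ._+_ (ℤ.*-identityˡ (+ (N ℕ.% n))) (≡.sym (ℤ.pos-* (N ℕ./ n) n)) ⟩
        + (N ℕ.% n ℕ.+ N ℕ./ n ℕ.* n)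
          ≡⟨ ≡.cong +_ (ℕ.m≡m%n+[m/n]*n N n) ⟨
        + N ∎
        where
        lem : ∀ n r n′ q → n ℤ.* (r ℤ.* n′ ℤ.+ q) ≡ n ℤ.* n′ ℤ.* r ℤ.+ q ℤ.* n
        lem = solve-∀

      private
        f : ℕ → ℤ
        f = morita ∘ divide

        -- `p` divides `N` exactly when it divides `divide N`: it divides `P`, it is prime to `n`,
        -- and `n` times `divide N` is congruent to `N` modulo `P`. So the mixed cases are absurd.
        step : ∀ N → nFactor N ℤ.* moritaStep (divide N) ≋ moritaStep N [ P ]
        step N with p ℕ.∣? N | p ℕ.∣? divide N
        ... | yes _ | yes _ = ≋-refl
        ... | yes d | no ¬d = ⊥-elim (¬d (∣-n* (∣-cong (≋-trans (≋-reflexive (ℤ.pos-* n (divide N))) (n*divide N)) d)))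
        ... | no ¬d | yes d = ⊥-elim (¬d (∣-cong (≋-sym (≋-trans (≋-reflexive (ℤ.pos-* n (divide N))) (n*divide N))) (ℕ.∣n⇒∣m*n n d)))
        ... | no _  | no _  = ≋-trans (≋-reflexive (≡.sym (ℤ.neg-distribʳ-* (+ n) (+ divide N)))) (≋-neg (n*divide N))

        f-+n : ∀ N → f (N ℕ.+ n) ≡ moritaStep (divide N) ℤ.* f N
        f-+n N = ≡.trans (≡.cong morita (divide-+ N)) (morita-suc (divide N))

        shift : ∀ k N → f N ℤ.* ∏< k (λ h → f (suc N ℕ.+ h)) ≋ ∏< k (λ h → f (N ℕ.+ h)) ℤ.* f (N ℕ.+ k) [ P ]
        shift k N = ≋-trans (≋-reflexive (≡.cong₂ ℤ._*_ (≡.cong f (≡.sym (ℕ.+-identityʳ N))) ≡.refl))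
          (≋-trans (≋-*ˡ (f (N ℕ.+ 0)) (∏<-cong k {λ h → f (suc N ℕ.+ h)} {λ h → f (N ℕ.+ suc h)} (λ h _ → ≋-reflexive (≡.cong f (≡.sym (ℕ.+-suc N h))))))
            (∏<-last k (λ h → f (N ℕ.+ h))))

      -- Induction on `N`. Passing to `N + 1` exchanges the factor `f N` for `f (N + n)`; since
      -- `divide (N + n)` is the successor of `divide N`, the two differ by one step of the
      -- functional equation. Instead of dividing by `f N`, both sides are multiplied by it and the
      -- unit is cancelled.
      gauss : ∀ N → ∏< n (λ h → morita (divide (N ℕ.+ h))) ℤ.* (+ n) ℤ.^ unitCount N ≋
                    ∏< n (λ h → morita (divide h)) ℤ.* morita N [ P ]
      gauss N = ≋-trans (≋-*ˡ (∏< n (λ h → f (N ℕ.+ h))) (≋-sym (∏-nFactor N))) (go N)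
        where
        R : ℕ → ℤ
        R N = ∏< n (λ h → f (N ℕ.+ h))

        reorder₁ : ∀ a r c d → a ℤ.* (r ℤ.* (c ℤ.* d)) ≡ (a ℤ.* r) ℤ.* (c ℤ.* d)
        reorder₁ = solve-∀
        reorder₂ : ∀ r a c d s → (r ℤ.* (s ℤ.* a)) ℤ.* (c ℤ.* d) ≡ a ℤ.* ((r ℤ.* c) ℤ.* (d ℤ.* s))
        reorder₂ = solve-∀

        go : ∀ N → R N ℤ.* ∏< N nFactor ≋ R 0 ℤ.* morita N [ P ]
        go zero    = ≋-refl
        go (suc N) = ≋-cancel (unit-morita (suc M) (divide N)) (begin
          f N ℤ.* (R (suc N) ℤ.* ∏< (suc N) nFactor)
            ≈⟨ ≋-*ˡ (f N) (≋-*ˡ (R (suc N)) (∏<-last N nFactor)) ⟩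
          f N ℤ.* (R (suc N) ℤ.* (∏< N nFactor ℤ.* nFactor N))
            ≡⟨ reorder₁ (f N) (R (suc N)) (∏< N nFactor) (nFactor N) ⟩
          (f N ℤ.* R (suc N)) ℤ.* (∏< N nFactor ℤ.* nFactor N)
            ≈⟨ ≋-*ʳ (∏< N nFactor ℤ.* nFactor N) (shift n N) ⟩
          (R N ℤ.* f (N ℕ.+ n)) ℤ.* (∏< N nFactor ℤ.* nFactor N)
            ≡⟨ ≡.cong (λ t → (R N ℤ.* t) ℤ.* (∏< N nFactor ℤ.* nFactor N)) (f-+n N) ⟩
          (R N ℤ.* (moritaStep (divide N) ℤ.* f N)) ℤ.* (∏< N nFactor ℤ.* nFactor N)
            ≡⟨ reorder₂ (R N) (f N) (∏< N nFactor) (nFactor N) (moritaStep (divide N)) ⟩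
          f N ℤ.* ((R N ℤ.* ∏< N nFactor) ℤ.* (nFactor N ℤ.* moritaStep (divide N)))
            ≈⟨ ≋-*ˡ (f N) (≋-* (go N) (step N)) ⟩
          f N ℤ.* ((R 0 ℤ.* morita N) ℤ.* moritaStep N)
            ≡⟨ ≡.cong (f N ℤ.*_) (≡.trans (ℤ.*-assoc (R 0) (morita N) (moritaStep N)) (≡.cong (R 0 ℤ.*_) (≡.trans (ℤ.*-comm (morita N) (moritaStep N)) (≡.sym (morita-suc N))))) ⟩
          f N ℤ.* (R 0 ℤ.* morita (suc N)) ∎)

-- Fractions with a fixed denominator

fracᵘ : ∀ z N .{{_ : NonZero N}} → ℚ.toℚᵘ (z ℚ./ N) ℚᵘ.≃ z ℚᵘ./ N
fracᵘ z (suc N) = ℚ.toℚᵘ-fromℚᵘ (ℚᵘ.mkℚᵘ z N)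

frac-≡ : ∀ x N y M .{{_ : NonZero N}} .{{_ : NonZero M}} → x ℤ.* + M ≡ y ℤ.* + N → x ℚ./ N ≡ y ℚ./ M
frac-≡ x N@(suc _) y M@(suc _) eq = ℚ.toℚᵘ-injective
  (ℚᵘ.≃-trans (fracᵘ x N) (ℚᵘ.≃-trans (ℚᵘ.*≡* eq) (ℚᵘ.≃-sym (fracᵘ y M))))

frac-≡⁻¹ : ∀ x N y M .{{_ : NonZero N}} .{{_ : NonZero M}} → x ℚ./ N ≡ y ℚ./ M → x ℤ.* + M ≡ y ℤ.* + N
frac-≡⁻¹ x N@(suc _) y M@(suc _) eq
  with ℚᵘ.*≡* e ← ℚᵘ.≃-trans (ℚᵘ.≃-sym (fracᵘ x N)) (ℚᵘ.≃-trans (ℚ.toℚᵘ-cong eq) (fracᵘ y M)) = e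

frac-+ : ∀ x N y M .{{_ : NonZero N}} .{{_ : NonZero M}} .{{_ : NonZero (N ℕ.* M)}} →
         x ℚ./ N ℚ.+ y ℚ./ M ≡ (x ℤ.* + M ℤ.+ y ℤ.* + N) ℚ./ (N ℕ.* M)
frac-+ x N@(suc _) y M@(suc _) = ℚ.toℚᵘ-injective
  (ℚᵘ.≃-trans (ℚ.toℚᵘ-homo-+ (x ℚ./ N) (y ℚ./ M))
    (ℚᵘ.≃-trans (ℚᵘ.+-cong (fracᵘ x N) (fracᵘ y M))
      (ℚᵘ.≃-sym (fracᵘ (x ℤ.* + M ℤ.+ y ℤ.* + N) (N ℕ.* M)))))

frac-* : ∀ x N y M .{{_ : NonZero N}} .{{_ : NonZero M}} .{{_ : NonZero (N ℕ.* M)}} →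
         (x ℚ./ N) ℚ.* (y ℚ./ M) ≡ (x ℤ.* y) ℚ./ (N ℕ.* M)
frac-* x N@(suc _) y M@(suc _) = ℚ.toℚᵘ-injective
  (ℚᵘ.≃-trans (ℚ.toℚᵘ-homo-* (x ℚ./ N) (y ℚ./ M))
    (ℚᵘ.≃-trans (ℚᵘ.*-cong (fracᵘ x N) (fracᵘ y M))
      (ℚᵘ.≃-sym (fracᵘ (x ℤ.* y) (N ℕ.* M)))))

frac-neg : ∀ x N .{{_ : NonZero N}} → ℚ.- (x ℚ./ N) ≡ (ℤ.- x) ℚ./ N
frac-neg x N@(suc _) = ℚ.toℚᵘ-injective
  (ℚᵘ.≃-trans (ℚ.toℚᵘ-homo‿- (x ℚ./ N))
    (ℚᵘ.≃-trans (ℚᵘ.-‿cong (fracᵘ x N)) (ℚᵘ.≃-sym (fracᵘ (ℤ.- x) N))))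

module Fractions (N : ℕ) .{{N≢0 : NonZero N}} where

  private
    instance
      N*1≢0 : NonZero (N ℕ.* 1)
      N*1≢0 = ℕ.m*n≢0 N 1

  frac : ℤ → ℚ
  frac z = z ℚ./ N

  +-frac : ∀ x y → frac x ℚ.+ frac y ≡ frac (x ℤ.+ y)
  +-frac x y = ≡.trans (frac-+ x N y N)
    (frac-≡ (x ℤ.* + N ℤ.+ y ℤ.* + N) (N ℕ.* N) (x ℤ.+ y) N
      (≡.trans (lem x y (+ N)) (≡.cong ((x ℤ.+ y) ℤ.*_) (≡.sym (ℤ.pos-* N N)))))
    where
    instance
      N*N≢0 : NonZero (N ℕ.* N)
      N*N≢0 = ℕ.m*n≢0 N N
    lem : ∀ x y n → (x ℤ.* n ℤ.+ y ℤ.* n) ℤ.* n ≡ (x ℤ.+ y) ℤ.* (n ℤ.* n)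
    lem = solve-∀

  neg-frac : ∀ x → ℚ.- frac x ≡ frac (ℤ.- x)
  neg-frac x = frac-neg x N

  frac-*ℤ : ∀ x k → frac x ℚ.* (k ℚ./ 1) ≡ frac (x ℤ.* k)
  frac-*ℤ x k = ≡.trans (frac-* x N k 1) (frac-≡ (x ℤ.* k) (N ℕ.* 1) (x ℤ.* k) N
    (≡.cong (λ t → x ℤ.* k ℤ.* + t) (≡.sym (ℕ.*-identityʳ N))))

  ℤ*-frac : ∀ k x → (k ℚ./ 1) ℚ.* frac x ≡ frac (k ℤ.* x)
  ℤ*-frac k x = ≡.trans (ℚ.*-comm (k ℚ./ 1) (frac x)) (≡.trans (frac-*ℤ x k) (≡.cong frac (ℤ.*-comm x k)))

  frac-N* : ∀ k → frac (k ℤ.* + N) ≡ k ℚ./ 1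
  frac-N* k = frac-≡ (k ℤ.* + N) N k 1 (ℤ.*-identityʳ _)

  ↥-frac : ∀ z → ↥ frac z ℤ.* + N ≡ z ℤ.* + ↧ₙ frac z
  ↥-frac z = frac-≡⁻¹ (↥ frac z) (↧ₙ frac z) z N (ℚ.↥p/↧p≡p (frac z))

  ↧-frac : ∀ z → ↧ₙ frac z ∣ N
  ↧-frac z = ℕ.divides ℤ.∣ g ∣ (≡.trans (≡.cong ℤ.∣_∣ (≡.sym (ℚ.↧-/ z N)))
    (≡.trans (ℤ.abs-* (+ ↧ₙ frac z) g) (ℕ.*-comm (↧ₙ frac z) ℤ.∣ g ∣)))
    where g = ℤ.gcd z (+ N)

  -- `floor` divides the reduced numerator by the reduced denominator `D`. Cross-multiplied, this
  -- division and that of `z` by `N` become two divisions of one number by `N D`, both with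
  -- remainder below `N D`, so the quotients agree.
  ⌊frac⌋ : ∀ z → floor (frac z) ≡ z ℤ./ℕ N
  ⌊frac⌋ z = ≡.trans (floor-/ (frac z)) (unique _ _ bounds)
    where
    D = ↧ₙ frac z
    A = ↥ frac z
    floor-/ : ∀ x → floor x ≡ ↥ x ℤ./ℕ ↧ₙ x
    floor-/ x@(ℚ.mkℚ _ _ _) = ℤ.div-pos-is-/ℕ (↥ x) (↧ₙ x)
    bounds : A ℤ./ℕ D ℤ.* + N ℤ.* + D ℤ.+ + (A ℤ.%ℕ D) ℤ.* + N ≡ (z ℤ./ℕ N ℤ.* + N ℤ.+ + (z ℤ.%ℕ N)) ℤ.* + D
    bounds = ≡.trans (lem (A ℤ./ℕ D) (+ N) (+ D) (+ (A ℤ.%ℕ D)))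
      (≡.trans (≡.cong (ℤ._* + N) (≡.sym (ℤ.a≡a%ℕn+[a/ℕn]*n A D)))
        (≡.trans (↥-frac z) (≡.cong (ℤ._* + D) (≡.trans (ℤ.a≡a%ℕn+[a/ℕn]*n z N) (ℤ.+-comm (+ (z ℤ.%ℕ N)) (z ℤ./ℕ N ℤ.* + N))))))
      where
      lem : ∀ a n d r → a ℤ.* n ℤ.* d ℤ.+ r ℤ.* n ≡ (r ℤ.+ a ℤ.* d) ℤ.* n
      lem = solve-∀
    unique : ∀ a b → a ℤ.* + N ℤ.* + D ℤ.+ + (A ℤ.%ℕ D) ℤ.* + N ≡ (b ℤ.* + N ℤ.+ + (z ℤ.%ℕ N)) ℤ.* + D → a ≡ b
    unique a b eq = ℤ.i-j≡0⇒i≡j a b (ℤ.∣i∣≡0⇒i≡0 (case (ℤ.∣ a ℤ.- b ∣) ≡.refl))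
      where
      ND = N ℕ.* D
      r = A ℤ.%ℕ D ℕ.* N
      s = z ℤ.%ℕ N ℕ.* D
      instance
        ND≢0 : NonZero ND
        ND≢0 = ℕ.m*n≢0 N D
      eq′ : (a ℤ.- b) ℤ.* + ND ≡ + s ℤ.- + r
      eq′ = ≡.trans (≡.cong ((a ℤ.- b) ℤ.*_) (ℤ.pos-* N D))
        (≡.trans (lem a b (+ N) (+ D) (+ (A ℤ.%ℕ D)) (+ (z ℤ.%ℕ N)) eq)
          (≡.cong₂ ℤ._-_ (≡.sym (ℤ.pos-* (z ℤ.%ℕ N) D)) (≡.sym (ℤ.pos-* (A ℤ.%ℕ D) N))))
        where
        lem′ : ∀ a b n d r s → (a ℤ.- b) ℤ.* (n ℤ.* d) ≡ (a ℤ.* n ℤ.* d ℤ.+ r ℤ.* n) ℤ.- (b ℤ.* n ℤ.* d ℤ.+ r ℤ.* n)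
        lem′ = solve-∀
        lem″ : ∀ b n d r s → (b ℤ.* n ℤ.+ s) ℤ.* d ℤ.- (b ℤ.* n ℤ.* d ℤ.+ r ℤ.* n) ≡ s ℤ.* d ℤ.- r ℤ.* n
        lem″ = solve-∀
        lem : ∀ a b n d r s → a ℤ.* n ℤ.* d ℤ.+ r ℤ.* n ≡ (b ℤ.* n ℤ.+ s) ℤ.* d →
              (a ℤ.- b) ℤ.* (n ℤ.* d) ≡ s ℤ.* d ℤ.- r ℤ.* n
        lem a b n d r s e = ≡.trans (lem′ a b n d r s) (≡.trans (≡.cong (ℤ._- _) e) (lem″ b n d r s))
      small : ℤ.∣ + s ℤ.- + r ∣ ℕ.< ND
      small = ℕ.≤-<-trans (ℕ.≤-reflexive (≡.cong ℤ.∣_∣ (ℤ.m-n≡m⊖n s r))) (ℕ.≤-<-trans (ℤ.∣m⊝n∣≤m⊔n s r)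
        (ℕ.⊔-lub (ℕ.*-monoˡ-< D (ℤ.n%ℕd<d z N)) (≡.subst (r ℕ.<_) (ℕ.*-comm D N) (ℕ.*-monoˡ-< N (ℤ.n%ℕd<d A D)))))
      case : ∀ k → k ≡ ℤ.∣ a ℤ.- b ∣ → ℤ.∣ a ℤ.- b ∣ ≡ 0
      case zero    e = ≡.sym e
      case (suc k) e = ⊥-elim (ℕ.<⇒≱ small (ℕ.≤-trans (ℕ.m≤m+n ND (k ℕ.* ND)) (ℕ.≤-reflexive
        (≡.trans (≡.cong (ℕ._* ND) {suc k} {ℤ.∣ a ℤ.- b ∣} e) (≡.trans (≡.sym (ℤ.abs-* (a ℤ.- b) (+ ND))) (≡.cong ℤ.∣_∣ eq′))))))

  ⟨frac⟩ : ∀ z → ⟨ frac z ⟩ ≡ frac (+ (z ℤ.%ℕ N))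
  ⟨frac⟩ z = ≡.trans (≡.cong (λ t → frac z ℚ.- t ℚ./ 1) (⌊frac⌋ z))
    (≡.trans (≡.cong (λ t → frac z ℚ.- t) (≡.sym (frac-N* (z ℤ./ℕ N))))
      (≡.trans (≡.cong (frac z ℚ.+_) (neg-frac t))
        (≡.trans (+-frac z (ℤ.- t)) (≡.cong frac (lem z (+ (z ℤ.%ℕ N)) t (ℤ.a≡a%ℕn+[a/ℕn]*n z N))))))
    where
    t = z ℤ./ℕ N ℤ.* + N
    lem′ : ∀ r t → (r ℤ.+ t) ℤ.+ ℤ.- t ≡ r
    lem′ = solve-∀
    lem : ∀ z r t → z ≡ r ℤ.+ t → z ℤ.+ ℤ.- t ≡ r
    lem z r t ≡.refl = lem′ r t

ℕ→ℚ-suc-* : ∀ n α → ℕ→ℚ (suc n) ℚ.* α ≡ α ℚ.+ ℕ→ℚ n ℚ.* α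
ℕ→ℚ-suc-* n α = begin
  ℕ→ℚ (suc n) ℚ.* α                 ≡⟨ ≡.cong (ℚ._* α) (Fractions.+-frac 1 (+ 1) (+ n)) ⟨
  (ℕ→ℚ 1 ℚ.+ ℕ→ℚ n) ℚ.* α           ≡⟨ ℚ.*-distribʳ-+ α (ℕ→ℚ 1) (ℕ→ℚ n) ⟩
  ℕ→ℚ 1 ℚ.* α ℚ.+ ℕ→ℚ n ℚ.* α       ≡⟨ ≡.cong (ℚ._+ ℕ→ℚ n ℚ.* α) (ℚ.*-identityˡ α) ⟩
  α ℚ.+ ℕ→ℚ n ℚ.* α                 ∎
  where open ≡.≡-Reasoning

-- Polynomials and their values

module PolynomialFunctions (R : CommutativeRing c ℓ) where
  open CommutativeRing R
  open RingProperties ring using (x≈y⇒x∙y⁻¹≈ε; x∙y⁻¹≈ε⇒x≈y; -1*x≈-x)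
  open NaturalCoefficients commutativeSemiring using (solve; _:=_; _:+_; _:*_)
  open Polynomial R using (Poly; coeff; _≈ᴾ_; constant; X^; X^ⁿ-1; X-_) renaming (_+_ to _+ᴾ_; _*_ to _*ᴾ_; ∏ to ∏ᴾ)
  open Exp semiring using (_^_)
  open SetoidReasoning setoid

  module ∏ = FiniteSums *-commutativeMonoid
  open ∏ using () renaming (∑< to ∏<)

  IsUnit : Carrier → Set _
  IsUnit x = ∃ λ y → y * x ≈ 1#

  isUnit-cong : ∀ {x y} → x ≈ y → IsUnit x → IsUnit y
  isUnit-cong x≈y (z , eq) = z , trans (*-congˡ (sym x≈y)) eq

  isUnit-* : ∀ {x y} → IsUnit x → IsUnit y → IsUnit (x * y)
  isUnit-* {x} {y} (u , eq) (v , eq′) = u * v , trans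
    (solve 4 (λ u v x y → (u :* v :* (x :* y)) := ((u :* x) :* (v :* y))) refl u v x y)
    (trans (*-cong eq eq′) (*-identityˡ 1#))

  isUnit-1 : IsUnit 1#
  isUnit-1 = 1# , *-identityˡ 1#

  isUnit-cancel : ∀ {u x y} → IsUnit u → u * x ≈ u * y → x ≈ y
  isUnit-cancel {u} {x} {y} (v , eq) e = trans (sym (undo x)) (trans (*-congˡ e) (undo y))
    where
    undo : ∀ x → v * (u * x) ≈ x
    undo x = trans (sym (*-assoc v u x)) (trans (*-congʳ eq) (*-identityˡ x))

  isUnit-cancel-0 : ∀ {u x} → IsUnit u → u * x ≈ 0# → x ≈ 0#
  isUnit-cancel-0 {u} unit e = isUnit-cancel unit (trans e (sym (zeroʳ u)))

  eval : Poly → Carrier → Carrier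
  eval []      x = 0#
  eval (a ∷ f) x = a + x * eval f x

  eval-congˡ : ∀ f {x y} → x ≈ y → eval f x ≈ eval f y
  eval-congˡ []      eq = refl
  eval-congˡ (a ∷ f) eq = +-congˡ (*-cong eq (eval-congˡ f eq))

  eval-0 : ∀ f x → (∀ k → coeff f k ≈ 0#) → eval f x ≈ 0#
  eval-0 []      x eq = refl
  eval-0 (a ∷ f) x eq = trans (+-cong (eq 0) (trans (*-congˡ (eval-0 f x (eq ∘ suc))) (zeroʳ x))) (+-identityˡ 0#)

  eval-cong : ∀ f g {x} → f ≈ᴾ g → eval f x ≈ eval g x
  eval-cong []      g       eq = sym (eval-0 g _ (sym ∘ eq))
  eval-cong (a ∷ f) []      eq = eval-0 (a ∷ f) _ eq
  eval-cong (a ∷ f) (b ∷ g) eq = +-cong (eq 0) (*-congˡ (eval-cong f g (eq ∘ suc)))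

  eval-+ : ∀ f g x → eval (f +ᴾ g) x ≈ eval f x + eval g x
  eval-+ []      g       x = sym (+-identityˡ _)
  eval-+ (a ∷ f) []      x = sym (+-identityʳ _)
  eval-+ (a ∷ f) (b ∷ g) x = trans (+-congˡ (*-congˡ (eval-+ f g x)))
    (solve 5 (λ a b x f g → (a :+ b :+ x :* (f :+ g)) := (a :+ x :* f :+ (b :+ x :* g))) refl a b x (eval f x) (eval g x))

  eval-map : ∀ a f x → eval (List.map (a *_) f) x ≈ a * eval f x
  eval-map a []      x = sym (zeroʳ a)
  eval-map a (b ∷ f) x = trans (+-congˡ (*-congˡ (eval-map a f x)))
    (solve 4 (λ a b x f → (a :* b :+ x :* (a :* f)) := (a :* (b :+ x :* f))) refl a b x (eval f x))

  eval-* : ∀ f g x → eval (f *ᴾ g) x ≈ eval f x * eval g x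
  eval-* []      g x = sym (zeroˡ _)
  eval-* (a ∷ f) g x = begin
    eval (List.map (a *_) g +ᴾ (0# ∷ f *ᴾ g)) x    ≈⟨ eval-+ (List.map (a *_) g) (0# ∷ f *ᴾ g) x ⟩
    eval (List.map (a *_) g) x + (0# + x * eval (f *ᴾ g) x)
      ≈⟨ +-cong (eval-map a g x) (trans (+-identityˡ _) (*-congˡ (eval-* f g x))) ⟩
    a * eval g x + x * (eval f x * eval g x)
      ≈⟨ solve 4 (λ a x f g → (a :* g :+ x :* (f :* g)) := ((a :+ x :* f) :* g)) refl a x (eval f x) (eval g x) ⟩
    (a + x * eval f x) * eval g x ∎

  eval-constant : ∀ a x → eval (constant a) x ≈ a
  eval-constant a x = trans (+-congˡ (zeroʳ x)) (+-identityʳ a)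

  eval-X^ : ∀ n x → eval (X^ n) x ≈ x ^ n
  eval-X^ zero    x = eval-constant 1# x
  eval-X^ (suc n) x = trans (+-identityˡ _) (*-congˡ (eval-X^ n x))

  eval-X^ⁿ-1 : ∀ n x → eval (X^ⁿ-1 n) x ≈ x ^ n - 1#
  eval-X^ⁿ-1 n x = trans (eval-+ (X^ n) (constant (- 1#)) x) (+-cong (eval-X^ n x) (eval-constant (- 1#) x))

  eval-X- : ∀ a x → eval (X- a) x ≈ x - a
  eval-X- a x = trans (eval-+ (X^ 1) (constant (- a)) x)
    (+-cong (trans (eval-X^ 1 x) (*-identityʳ x)) (eval-constant (- a) x))

  ∏ᴸ : List Carrier → Carrier
  ∏ᴸ = List.foldr _*_ 1#

  eval-∏ : ∀ {a} {A : Set a} (f : A → Poly) (g : A → Carrier) x → (∀ y → eval (f y) x ≈ g y) →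
           ∀ ys → eval (∏ᴾ (List.map f ys)) x ≈ ∏ᴸ (List.map g ys)
  eval-∏ f g x eq []       = eval-constant 1# x
  eval-∏ f g x eq (y ∷ ys) = trans (eval-* (f y) _ x) (*-cong (eq y) (eval-∏ f g x eq ys))

  coeff-+ : ∀ f g k → coeff (f +ᴾ g) k ≈ coeff f k + coeff g k
  coeff-+ []      g       k       = sym (+-identityˡ _)
  coeff-+ (a ∷ f) []      k       = sym (+-identityʳ _)
  coeff-+ (a ∷ f) (b ∷ g) zero    = refl
  coeff-+ (a ∷ f) (b ∷ g) (suc k) = coeff-+ f g k

  coeff-map : ∀ a f k → coeff (List.map (a *_) f) k ≈ a * coeff f k
  coeff-map a []      k       = sym (zeroʳ a)
  coeff-map a (b ∷ f) zero    = refl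
  coeff-map a (b ∷ f) (suc k) = coeff-map a f k

  -- Synthetic division: (f(x) - f(r)) / (x - r), where f = a + X g.
  quotient : Carrier → Poly → Poly
  quotient r []      = []
  quotient r (b ∷ g) = eval (b ∷ g) r ∷ quotient r g

  length-quotient : ∀ r g → List.length (quotient r g) ≡ List.length g
  length-quotient r []      = ≡.refl
  length-quotient r (b ∷ g) = ≡.cong suc (length-quotient r g)

  eval-quotient : ∀ r a g x → eval (a ∷ g) x ≈ eval (a ∷ g) r + (x - r) * eval (quotient r g) x
  eval-quotient r a []      x = trans (eval-constant a x) (sym (trans (+-cong (eval-constant a r) (zeroʳ (x - r))) (+-identityʳ a)))
  eval-quotient r a (b ∷ g) x = begin
    a + x * eval (b ∷ g) x
      ≈⟨ +-congˡ (*-congˡ (eval-quotient r b g x)) ⟩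
    a + x * (g[r] + (x - r) * q)
      ≈⟨ +-identityʳ _ ⟨
    a + x * (g[r] + (x - r) * q) + 0#
      -- The solver has no negation and treats `- r` as a separate variable `r′`. Adding the
      -- vanishing term `(r - r) g[r]` turns the claim into an identity that holds for every `r′`.
      ≈⟨ +-congˡ (trans (*-congʳ (-‿inverseʳ r)) (zeroˡ g[r])) ⟨
    a + x * (g[r] + (x - r) * q) + (r - r) * g[r]
      ≈⟨ solve 6 (λ a x r r′ g q → (a :+ x :* (g :+ (x :+ r′) :* q) :+ (r :+ r′) :* g) :=
           (a :+ r :* g :+ (x :+ r′) :* (g :+ x :* q))) refl a x r (- r) g[r] q ⟩
    a + r * g[r] + (x - r) * (g[r] + x * q) ∎
    where
    g[r] = eval (b ∷ g) r
    q    = eval (quotient r g) x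

  coeff-quotient-0 : ∀ r g → (∀ k → coeff (quotient r g) k ≈ 0#) → ∀ k → coeff g k ≈ 0#
  coeff-quotient-0 r []      eq k       = refl
  coeff-quotient-0 r (b ∷ g) eq (suc k) = coeff-quotient-0 r g (eq ∘ suc) k
  coeff-quotient-0 r (b ∷ g) eq zero    = begin
    b                   ≈⟨ +-identityʳ b ⟨
    b + 0#              ≈⟨ +-congˡ (trans (*-congˡ (eval-0 g r (coeff-quotient-0 r g (eq ∘ suc)))) (zeroʳ r)) ⟨
    b + r * eval g r    ≈⟨ eq 0 ⟩
    0#                  ∎

  -- Division by `X - r T` uses up one root. The later points remain roots of the quotient because
  -- their differences from `r T` are invertible, a condition that replaces distinctness in a ring
  -- that may have zero divisors.
  vanish : (r : ℕ → Carrier) → (∀ i j → i ℕ.< j → IsUnit (r j - r i)) →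
           ∀ N f → List.length f ≡ N → ∀ T → (∀ t → T ℕ.≤ t → eval f (r t) ≈ 0#) → ∀ k → coeff f k ≈ 0#
  vanish r apart zero    []      eq T f[r]≈0 k = refl
  vanish r apart (suc N) (a ∷ g) eq T f[r]≈0 = result
    where
    root : eval (a ∷ g) (r T) ≈ 0#
    root = f[r]≈0 T ℕ.≤-refl

    g≈0 : ∀ k → coeff g k ≈ 0#
    g≈0 = coeff-quotient-0 (r T) g (vanish r apart N (quotient (r T) g)
      (≡.trans (length-quotient (r T) g) (ℕ.suc-injective eq)) (suc T)
      (λ t T<t → isUnit-cancel-0 (apart T t T<t) (begin
        (r t - r T) * eval (quotient (r T) g) (r t)           ≈⟨ +-identityˡ _ ⟨
        0# + (r t - r T) * eval (quotient (r T) g) (r t)      ≈⟨ +-congʳ root ⟨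
        eval (a ∷ g) (r T) + (r t - r T) * eval (quotient (r T) g) (r t) ≈⟨ eval-quotient (r T) a g (r t) ⟨
        eval (a ∷ g) (r t)                                    ≈⟨ f[r]≈0 t (ℕ.<⇒≤ T<t) ⟩
        0#                                                    ∎)))

    result : ∀ k → coeff (a ∷ g) k ≈ 0#
    result (suc k) = g≈0 k
    result zero    = trans (sym (trans (+-congˡ (trans (*-congˡ (eval-0 g (r T) g≈0)) (zeroʳ (r T)))) (+-identityʳ a))) root

  ≈ᴾ-from-values : (r : ℕ → Carrier) → (∀ i j → i ℕ.< j → IsUnit (r j - r i)) →
                   ∀ f g → (∀ t → eval f (r t) ≈ eval g (r t)) → f ≈ᴾ g
  ≈ᴾ-from-values r apart f g eq k = x∙y⁻¹≈ε⇒x≈y (coeff f k) (coeff g k) (begin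
    coeff f k - coeff g k                    ≈⟨ +-congˡ (-1*x≈-x (coeff g k)) ⟨
    coeff f k + - 1# * coeff g k             ≈⟨ +-congˡ (coeff-map (- 1#) g k) ⟨
    coeff f k + coeff (List.map (- 1# *_) g) k ≈⟨ coeff-+ f (List.map (- 1# *_) g) k ⟨
    coeff (f +ᴾ List.map (- 1# *_) g) k      ≈⟨ vanish r apart _ (f +ᴾ List.map (- 1# *_) g) ≡.refl 0 (λ t _ → difference t) k ⟩
    0#                                       ∎)
    where
    difference : ∀ t → eval (f +ᴾ List.map (- 1# *_) g) (r t) ≈ 0#
    difference t = trans (eval-+ f (List.map (- 1# *_) g) (r t))
      (trans (+-congˡ (trans (eval-map (- 1#) g (r t)) (-1*x≈-x _))) (x≈y⇒x∙y⁻¹≈ε (eq t)))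

  lead : Poly → Carrier
  lead []          = 0#
  lead (a ∷ [])    = a
  lead (a ∷ b ∷ f) = lead (b ∷ f)

  lead-quotient : ∀ r g → lead (quotient r g) ≈ lead g
  lead-quotient r []          = refl
  lead-quotient r (b ∷ [])    = eval-constant b r
  lead-quotient r (b ∷ d ∷ g) = lead-quotient r (d ∷ g)

  -- The roots are divided out one at a time: the quotient keeps the leading coefficient and, by
  -- invertibility of the differences, the remaining roots.
  eval-factor : ∀ n (r : ℕ → Carrier) f → List.length f ≡ suc n →
                (∀ i j → i ℕ.< j → j ℕ.< n → IsUnit (r j - r i)) →
                (∀ i → i ℕ.< n → eval f (r i) ≈ 0#) →
                ∀ x → eval f x ≈ ∏< n (λ i → x - r i) * lead f
  eval-factor zero    r (a ∷ [])    eq apart roots x = trans (eval-constant a x) (sym (*-identityˡ a))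
  eval-factor (suc n) r (a ∷ b ∷ g) eq apart roots x = begin
    eval (a ∷ b ∷ g) x
      ≈⟨ eval-quotient (r 0) a (b ∷ g) x ⟩
    eval (a ∷ b ∷ g) (r 0) + (x - r 0) * eval q x
      ≈⟨ trans (+-congʳ (roots 0 ℕ.z<s)) (+-identityˡ _) ⟩
    (x - r 0) * eval q x
      ≈⟨ *-congˡ (eval-factor n (r ∘ suc) q
           (≡.trans (length-quotient (r 0) (b ∷ g)) (ℕ.suc-injective eq))
           (λ i j i<j j<n → apart (suc i) (suc j) (ℕ.s<s i<j) (ℕ.s<s j<n)) q-roots x) ⟩
    (x - r 0) * (∏< n (λ i → x - r (suc i)) * lead q)
      ≈⟨ *-assoc _ _ _ ⟨
    (x - r 0) * ∏< n (λ i → x - r (suc i)) * lead q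
      ≈⟨ *-congˡ (lead-quotient (r 0) (b ∷ g)) ⟩
    (x - r 0) * ∏< n (λ i → x - r (suc i)) * lead (b ∷ g) ∎
    where
    q = quotient (r 0) (b ∷ g)
    q-roots : ∀ i → i ℕ.< n → eval q (r (suc i)) ≈ 0#
    q-roots i i<n = isUnit-cancel-0 (apart 0 (suc i) ℕ.z<s (ℕ.s<s i<n)) (begin
      (r (suc i) - r 0) * eval q (r (suc i))            ≈⟨ +-identityˡ _ ⟨
      0# + (r (suc i) - r 0) * eval q (r (suc i))       ≈⟨ +-congʳ (roots 0 ℕ.z<s) ⟨
      eval (a ∷ b ∷ g) (r 0) + (r (suc i) - r 0) * eval q (r (suc i)) ≈⟨ eval-quotient (r 0) a (b ∷ g) (r (suc i)) ⟨
      eval (a ∷ b ∷ g) (r (suc i))                      ≈⟨ roots (suc i) (ℕ.s<s i<n) ⟩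
      0#                                                ∎)

  X^n-a-factor : ∀ n .{{_ : NonZero n}} a (r : ℕ → Carrier) →
                 (∀ i j → i ℕ.< j → j ℕ.< n → IsUnit (r j - r i)) →
                 (∀ i → i ℕ.< n → r i ^ n ≈ a) →
                 ∀ x → x ^ n - a ≈ ∏< n (λ i → x - r i)
  X^n-a-factor n@(suc m) a r apart roots x = begin
    x ^ n - a                               ≈⟨ eval-X^n-a x ⟨
    eval X^n-a x                            ≈⟨ eval-factor n r X^n-a (≡.cong suc (length-X^ m)) apart
                                                 (λ i i<n → trans (eval-X^n-a (r i)) (x≈y⇒x∙y⁻¹≈ε (roots i i<n))) x ⟩
    ∏< n (λ i → x - r i) * lead X^n-a       ≈⟨ *-congˡ (lead-X^ m) ⟩
    ∏< n (λ i → x - r i) * 1#               ≈⟨ *-identityʳ _ ⟩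
    ∏< n (λ i → x - r i)                    ∎
    where
    X^n-a = X^ n +ᴾ constant (- a)
    eval-X^n-a : ∀ x → eval X^n-a x ≈ x ^ n - a
    eval-X^n-a x = trans (eval-+ (X^ n) (constant (- a)) x) (+-cong (eval-X^ n x) (eval-constant (- a) x))
    length-X^ : ∀ m → List.length (X^ m +ᴾ []) ≡ suc m
    length-X^ zero    = ≡.refl
    length-X^ (suc m) = ≡.cong suc (length-X^′ m)
      where
      length-X^′ : ∀ m → List.length (X^ m) ≡ suc m
      length-X^′ zero    = ≡.refl
      length-X^′ (suc m) = ≡.cong suc (length-X^′ m)
    lead-X^′ : ∀ a m → lead (a ∷ X^ m) ≈ 1#
    lead-X^′ a zero    = refl
    lead-X^′ a (suc m) = lead-X^′ 0# m
    lead-X^ : ∀ {a} m → lead (a ∷ (X^ m +ᴾ [])) ≈ 1#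
    lead-X^ zero    = refl
    lead-X^ (suc m) = lead-X^′ 0# m

-- Values of the exponential at rational points

≋⇒difference : ∀ {d x y} → x ≋ y [ d ] → ∃ λ k → x ℤ.- y ≡ k ℤ.* + d
≋⇒difference (congruent (Signed.divides k eq)) = k , eq

<∧≋0⇒≡0 : ∀ {d x} → x ℕ.< d → + x ≋ + 0 [ d ] → x ≡ 0
<∧≋0⇒≡0 {x = zero}  _   _  = ≡.refl
<∧≋0⇒≡0 {x = suc _} x<d eq = ⊥-elim (ℕ.>⇒∤ x<d (≋0⇒∣ eq))

∑ᴸ : {A : Set} → (A → ℤ) → List A → ℤ
∑ᴸ f = List.foldr (λ x s → f x ℤ.+ s) (+ 0)

∑ᴸ-++ : {A : Set} (f : A → ℤ) (xs ys : List A) → ∑ᴸ f (xs List.++ ys) ≡ ∑ᴸ f xs ℤ.+ ∑ᴸ f ys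
∑ᴸ-++ f []       ys = ≡.sym (ℤ.+-identityˡ _)
∑ᴸ-++ f (x ∷ xs) ys = ≡.trans (≡.cong (ℤ._+_ (f x)) (∑ᴸ-++ f xs ys)) (≡.sym (ℤ.+-assoc (f x) _ _))

module Exponentials (E : ComplexExponential c ℓ ℓ₂) where
  open ComplexExponential E using (exp; exp-+; exp-ℤ; exp-∉ℤ; heytingCommutativeRing; #⇒invertible; #-irrefl)
  open HeytingProperties heytingCommutativeRing using (1#0)

  R : CommutativeRing _ _
  R = HeytingCommutativeRing.commutativeRing heytingCommutativeRing

  open CommutativeRing R
  open RingProperties ring using (-‿distribʳ-*)
  open Polynomial R using (Poly; _≈ᴾ_; X-_) renaming (∏ to ∏ᴾ)
  open PolynomialFunctions R
  open ∏ using () renaming (∑< to ∏<)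
  open Exp semiring using (_^_)
  open NaturalCoefficients commutativeSemiring using (solve; _:=_; _:*_)
  open SetoidReasoning setoid

  1≉0 : ¬ 1# ≈ 0#
  1≉0 eq = #-irrefl eq 1#0

  exp-0 : exp (+ 0 ℚ./ 1) ≈ 1#
  exp-0 = exp-ℤ (+ 0)

  isUnit-exp : ∀ α → IsUnit (exp α)
  isUnit-exp α = exp (ℚ.- α) , trans (sym (exp-+ (ℚ.- α) α)) (trans (reflexive (≡.cong exp (ℚ.+-inverseˡ α))) exp-0)

  exp-^ : ∀ n α → exp (ℕ→ℚ n ℚ.* α) ≈ exp α ^ n
  exp-^ zero    α = trans (reflexive (≡.cong exp (ℚ.*-zeroˡ α))) exp-0
  exp-^ (suc n) α = trans (reflexive (≡.cong exp (ℕ→ℚ-suc-* n α))) (trans (exp-+ α _) (*-congˡ (exp-^ n α)))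

  module _ (N : ℕ) .{{N≢0 : NonZero N}} where
    open Fractions N

    e : ℤ → Carrier
    e z = exp (frac z)

    e-+ : ∀ x y → e (x ℤ.+ y) ≈ e x * e y
    e-+ x y = trans (reflexive (≡.cong exp (≡.sym (+-frac x y)))) (exp-+ (frac x) (frac y))

    e-cong : ∀ {x y} → x ≋ y [ N ] → e x ≈ e y
    e-cong {x} {y} eq with ≋⇒difference eq
    ... | k , x-y≡kN = begin
      e x                     ≡⟨ ≡.cong e (≡.trans (lem x y) (≡.cong (ℤ._+_ (y)) x-y≡kN)) ⟩
      e (y ℤ.+ k ℤ.* + N)     ≈⟨ e-+ y (k ℤ.* + N) ⟩
      e y * e (k ℤ.* + N)     ≈⟨ *-congˡ (trans (reflexive (≡.cong exp (frac-N* k))) (exp-ℤ k)) ⟩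
      e y * 1#                ≈⟨ *-identityʳ _ ⟩
      e y                     ∎
      where
      lem : ∀ x y → x ≡ y ℤ.+ (x ℤ.- y)
      lem = solve-∀

    e-0 : e (+ 0) ≈ 1#
    e-0 = trans (reflexive (≡.cong exp (frac-N* (+ 0)))) exp-0

    e-^ : ∀ z k → e z ^ k ≈ e (+ k ℤ.* z)
    e-^ z k = trans (sym (exp-^ k (frac z))) (reflexive (≡.cong exp (ℤ*-frac (+ k) z)))

    -- The difference is `e y` times `exp α - 1` for `α = (x - y) / N`. As `α` is not an integer,
    -- `exp α` is apart from 1, and apartness in a Heyting field provides an inverse.
    e-apart : ∀ {x y} → ¬ x ≋ y [ N ] → IsUnit (e x - e y)
    e-apart {x} {y} x≢y = isUnit-cong eq (isUnit-* (isUnit-exp (frac y)) unit-difference)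
      where
      α = frac (x ℤ.- y)
      notInteger : ∀ z → α ≢ z ℚ./ 1
      notInteger z eq = x≢y (congruent (Signed.divides z (≡.trans (≡.sym (ℤ.*-identityʳ _)) (frac-≡⁻¹ (x ℤ.- y) N z 1 eq))))
      unit-difference : IsUnit (exp α - 1#)
      unit-difference with #⇒invertible (exp-∉ℤ α notInteger)
      ... | (v , vx≈1 , _) = v , vx≈1
      lem : ∀ x y → x ≡ y ℤ.+ (x ℤ.- y)
      lem = solve-∀
      eq : e y * (exp α - 1#) ≈ e x - e y
      eq = trans (distribˡ (e y) (exp α) (- 1#)) (+-cong
        (sym (trans (reflexive (≡.cong e (lem x y))) (e-+ y (x ℤ.- y))))
        (trans (sym (-‿distribʳ-* (e y) 1#)) (-‿cong (*-identityʳ _))))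

  e-scaleʳ : ∀ N M z .{{_ : NonZero N}} .{{_ : NonZero M}} .{{_ : NonZero (N ℕ.* M)}} →
             e N z ≈ e (N ℕ.* M) (z ℤ.* + M)
  e-scaleʳ N M z = reflexive (≡.cong exp (frac-≡ z N (z ℤ.* + M) (N ℕ.* M)
    (≡.trans (≡.cong (z ℤ.*_) (ℤ.pos-* N M)) (lem z (+ N) (+ M)))))
    where
    lem : ∀ z n m → z ℤ.* (n ℤ.* m) ≡ z ℤ.* m ℤ.* n
    lem = solve-∀

  e-apart₂ : ∀ N M x y .{{_ : NonZero N}} .{{_ : NonZero M}} →
             ¬ x ℤ.* + M ≋ y ℤ.* + N [ N ℕ.* M ] → IsUnit (e N x - e M y)
  e-apart₂ N M x y x≢y = isUnit-cong
    (+-cong (sym (e-scaleʳ N M x)) (-‿cong (sym (trans (e-scaleʳ M N y)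
      (reflexive (≡.cong exp (frac-≡ (y ℤ.* + N) (M ℕ.* N) (y ℤ.* + N) (N ℕ.* M) (≡.cong (λ t → y ℤ.* + N ℤ.* + t) (ℕ.*-comm N M)))))))))
    (e-apart (N ℕ.* M) x≢y)
    where
    instance
      NM≢0 : NonZero (N ℕ.* M)
      NM≢0 = ℕ.m*n≢0 N M
      MN≢0 : NonZero (M ℕ.* N)
      MN≢0 = ℕ.m*n≢0 M N

  -- Points exp(1/s), s > N, which avoid all exponentials of denominator at
  -- most N.
  point : ℕ → ℕ → Carrier
  point N t = e (suc (N ℕ.+ t)) (+ 1)

  -- If `1/b - 1/a` were an integer, `a b` would divide `b - a`, which is positive and smaller than
  -- `b`.
  point-apart : ∀ N i j → i ℕ.< j → IsUnit (point N j - point N i)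
  point-apart N i j i<j = e-apart₂ b a (+ 1) (+ 1) λ eq →
    ℕ.<-irrefl (≡.sym (<∧≋0⇒≡0 small (difference eq))) (ℕ.m<n⇒0<n∸m a<b)
    where
    a = suc (N ℕ.+ i)
    b = suc (N ℕ.+ j)
    a<b : a ℕ.< b
    a<b = ℕ.s<s (ℕ.+-monoʳ-< N i<j)
    small : b ℕ.∸ a ℕ.< b ℕ.* a
    small = ℕ.<-≤-trans (ℕ.∸-monoʳ-< (ℕ.z<s {N ℕ.+ i}) (ℕ.<⇒≤ a<b)) (ℕ.m≤m*n b a)
    difference : + 1 ℤ.* + a ≋ + 1 ℤ.* + b [ b ℕ.* a ] → + (b ℕ.∸ a) ≋ + 0 [ b ℕ.* a ]
    difference eq = ≋-trans (≋-reflexive (≡.sym (≡.trans (ℤ.m-n≡m⊖n b a) (ℤ.⊖-≥ (ℕ.<⇒≤ a<b)))))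
      (≋-trans (≋-+ {y = ℤ.- + a} (≋-trans (≋-reflexive (≡.sym (ℤ.*-identityˡ (+ b)))) (≋-trans (≋-sym eq) (≋-reflexive (ℤ.*-identityˡ (+ a))))) ≋-refl)
        (≋-reflexive (ℤ.+-inverseʳ (+ a))))

  point-e-apart : ∀ N t M y .{{_ : NonZero M}} → M ℕ.≤ N → IsUnit (point N t - e M y)
  point-e-apart N t M y M≤N = e-apart₂ s M (+ 1) y λ eq →
    ℕ.≢-nonZero⁻¹ M (<∧≋0⇒≡0 {s} (ℕ.s≤s (ℕ.≤-trans M≤N (ℕ.m≤m+n N t)))
      (≋-trans (≋-reflexive (≡.sym (ℤ.*-identityˡ (+ M))))
        (≋-trans (≋-weaken (ℕ.m∣m*n M) eq) (≋-trans (≋-reflexive (ℤ.*-comm y (+ s))) (d*k≋0 y)))))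
    where
    s = suc (N ℕ.+ t)

  point-exp-apart : ∀ N t α → ↧ₙ α ℕ.≤ N → IsUnit (point N t - exp α)
  point-exp-apart N t α d≤N = isUnit-cong (+-congˡ (-‿cong (reflexive (≡.cong exp (ℚ.↥p/↧p≡p α)))))
    (point-e-apart N t (↧ₙ α) (↥ α) d≤N)

  point-^-1 : ∀ N t d .{{_ : NonZero d}} → d ℕ.≤ N → IsUnit (point N t ^ d - 1#)
  point-^-1 N t d d≤N = isUnit-cong
    (+-cong (sym (trans (e-^ s (+ 1) d) (reflexive (≡.cong (e s) (ℤ.*-identityʳ (+ d)))))) (-‿cong (e-0 s)))
    (e-apart s λ eq → ℕ.≢-nonZero⁻¹ d (<∧≋0⇒≡0 {s} (ℕ.s≤s (ℕ.≤-trans d≤N (ℕ.m≤m+n N t))) eq))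
    where
    s = suc (N ℕ.+ t)

  ≈ᴾ-from-points : ∀ N f g → (∀ t → eval f (point N t) ≈ eval g (point N t)) → f ≈ᴾ g
  ≈ᴾ-from-points N = ≈ᴾ-from-values (point N) (point-apart N)

  module _ (N : ℕ) .{{N≢0 : NonZero N}} where

    X^d-1-factor : ∀ d k .{{_ : NonZero d}} → N ≡ d ℕ.* k → ∀ x → x ^ d - 1# ≈ ∏< d (λ h → x - e N (+ (h ℕ.* k)))
    X^d-1-factor d k ≡.refl = X^n-a-factor d 1# (λ h → e N (+ (h ℕ.* k)))
      (λ i j i<j j<d → e-apart N (λ eq → ℕ.<-irrefl (≡.sym (vanishes i j i<j j<d eq)) (ℕ.m<n⇒0<n∸m i<j)))
      (λ h _ → trans (e-^ N (+ (h ℕ.* k)) d) (trans (e-cong N (≋-trans (≋-reflexive (lem h)) (d*k≋0 (+ h)))) (e-0 N)))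
      where
      lem : ∀ h → + d ℤ.* + (h ℕ.* k) ≡ + N ℤ.* + h
      lem h = ≡.trans (≡.sym (ℤ.pos-* d _)) (≡.trans (≡.cong +_ (≡.trans (≡.cong (d ℕ.*_) (ℕ.*-comm h k)) (≡.sym (ℕ.*-assoc d k h)))) (ℤ.pos-* N h))
      k≢0 : NonZero k
      k≢0 = ℕ.m*n≢0⇒n≢0 d
      vanishes : ∀ i j → i ℕ.< j → j ℕ.< d → + (j ℕ.* k) ≋ + (i ℕ.* k) [ N ] → j ℕ.∸ i ≡ 0
      vanishes i j i<j j<d eq = ℕ.m*n≡0⇒m≡0 (j ℕ.∸ i) k {{k≢0}} (<∧≋0⇒≡0 {N} (ℕ.*-monoˡ-< k {{k≢0}} (ℕ.≤-<-trans (ℕ.m∸n≤m j i) j<d))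
        (≋-trans (≋-reflexive (≡.trans (≡.cong +_ (ℕ.*-distribʳ-∸ k j i)) (≡.trans (≡.sym (ℤ.⊖-≥ (ℕ.*-monoˡ-≤ k (ℕ.<⇒≤ i<j)))) (≡.sym (ℤ.m-n≡m⊖n (j ℕ.* k) (i ℕ.* k))))))
          (≋-trans (≋-+ {y = ℤ.- + (i ℕ.* k)} eq ≋-refl) (≋-reflexive (ℤ.+-inverseʳ (+ (i ℕ.* k)))))))

    linear : Carrier → ℤ → Carrier
    linear x z = x - e N z

    rootProduct : List ℤ → Carrier → Carrier
    rootProduct ys x = ∏ᴸ (List.map (linear x) ys)

    rootProduct-++ : ∀ xs ys x → rootProduct (xs List.++ ys) x ≈ rootProduct xs x * rootProduct ys x
    rootProduct-++ []       ys x = sym (*-identityˡ _)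
    rootProduct-++ (z ∷ xs) ys x = trans (*-congˡ (rootProduct-++ xs ys x)) (sym (*-assoc _ _ _))

    Periodic : (ℤ → ℤ) → Set
    Periodic f = ∀ {x y} → x ≋ y [ N ] → f x ≡ f y

    -- The integers in `zs` only represent residues, so `y` itself need not occur in the list. What
    -- is left after removing its class is recorded by the linear factor and by the sums of periodic
    -- functions.
    HasRoot : ℤ → List ℤ → Set _
    HasRoot y zs = ∃ λ zs′ → (∀ x → rootProduct zs x ≈ (x - e N y) * rootProduct zs′ x) ×
                             (∀ f → Periodic f → ∑ᴸ f zs ≡ f y ℤ.+ ∑ᴸ f zs′)

    hasRoot-∷ : ∀ y z zs → HasRoot y zs → HasRoot y (z ∷ zs)
    hasRoot-∷ y z zs (zs′ , eq , sums) = z ∷ zs′ ,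
      (λ x → trans (*-congˡ (eq x)) (solve 3 (λ a b c → (a :* (b :* c)) := (b :* (a :* c))) refl (x - e N z) (x - e N y) (rootProduct zs′ x))) ,
      (λ f per → ≡.trans (≡.cong (ℤ._+_ (f z)) (sums f per)) (lem (f z) (f y) (∑ᴸ f zs′)))
      where
      lem : ∀ a b c → a ℤ.+ (b ℤ.+ c) ≡ b ℤ.+ (a ℤ.+ c)
      lem = solve-∀

    removeRoot : ∀ y zs → rootProduct zs (e N y) ≈ 0# → HasRoot y zs
    removeRoot y []       root = ⊥-elim (1≉0 root)
    removeRoot y (z ∷ zs) root = cases (≋-dec N y z)
      where
      cases : Dec (y ≋ z [ N ]) → HasRoot y (z ∷ zs)
      cases (yes y≋z) = zs , (λ x → *-congʳ (+-congˡ (-‿cong (e-cong N (≋-sym y≋z))))) ,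
                        (λ f per → ≡.cong (ℤ._+ ∑ᴸ f zs) (per (≋-sym y≋z)))
      cases (no y≢z)  = hasRoot-∷ y z zs (removeRoot y zs (isUnit-cancel-0 (e-apart N y≢z) root))

    private
      poly : List ℤ → Poly
      poly ys = ∏ᴾ (List.map (λ y → X- e N y) ys)

      eval-poly : ∀ ys x → eval (poly ys) x ≈ rootProduct ys x
      eval-poly ys x = eval-∏ (λ y → X- e N y) (linear x) x (λ y → eval-X- (e N y) x) ys

      everywhere : ∀ ys zs → (∀ t → rootProduct ys (point N t) ≈ rootProduct zs (point N t)) →
                   ∀ x → rootProduct ys x ≈ rootProduct zs x
      everywhere ys zs eq x = trans (sym (eval-poly ys x)) (trans
        (eval-cong (poly ys) (poly zs) (≈ᴾ-from-points N (poly ys) (poly zs)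
          (λ t → trans (eval-poly ys _) (trans (eq t) (sym (eval-poly zs _))))))
        (eval-poly zs x))

      vanishes-at-head : ∀ y ys → rootProduct (y ∷ ys) (e N y) ≈ 0#
      vanishes-at-head y ys = trans (*-congʳ (-‿inverseʳ (e N y))) (zeroˡ _)

    -- Unique factorisation into linear factors, with equality of multisets of residues tested by
    -- periodic functions, the form in which it is applied. The head of `ys` is a root of the other
    -- product; once it is removed there, its factor is cancelled at the points, where it is
    -- invertible.
    root-sums-unique : ∀ ys zs → (∀ t → rootProduct ys (point N t) ≈ rootProduct zs (point N t)) →
                       ∀ f → Periodic f → ∑ᴸ f ys ≡ ∑ᴸ f zs
    root-sums-unique []       []       eq f per = ≡.refl
    root-sums-unique []       (z ∷ zs) eq f per = ⊥-elim (1≉0 (trans (everywhere [] (z ∷ zs) eq (e N z)) (vanishes-at-head z zs)))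
    root-sums-unique (y ∷ ys) zs       eq f per =
      step (removeRoot y zs (trans (sym (everywhere (y ∷ ys) zs eq (e N y))) (vanishes-at-head y ys)))
      where
      step : HasRoot y zs → ∑ᴸ f (y ∷ ys) ≡ ∑ᴸ f zs
      step (zs′ , factor , sums) = ≡.trans
        (≡.cong (ℤ._+_ (f y)) (root-sums-unique ys zs′ (λ t → isUnit-cancel (point-e-apart N t N y ℕ.≤-refl) (trans (eq t) (factor (point N t)))) f per))
        (≡.sym (sums f per))

-- Parameters defined over ℚ and their exponents

coprime-*ʳ : ∀ {u x y} → ℕ.Coprime u x → ℕ.Coprime u y → ℕ.Coprime u (x ℕ.* y)
coprime-*ʳ u⊥x u⊥y {e} (e∣u , e∣xy) =
  u⊥y (e∣u , ℕ.coprime-divisor (λ {f} (f∣e , f∣x) → u⊥x (ℕ.∣-trans f∣e e∣u , f∣x)) e∣xy)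

bounded : ∀ {m} (g : Fin m → ℕ) → ∃ λ N → ∀ i → g i ℕ.≤ N
bounded {zero}  g = 0 , λ ()
bounded {suc m} g with bounded (g ∘ Fin.suc)
... | N , bound = g Fin.zero ℕ.+ N , λ
  { Fin.zero    → ℕ.m≤m+n _ N
  ; (Fin.suc i) → ℕ.≤-trans (bound i) (ℕ.m≤n+m N _)
  }

maximum : ∀ d ds → ∃ λ M → M ∈ d ∷ ds × All (ℕ._≤ M) (d ∷ ds)
maximum d []        = d , here ≡.refl , ℕ.≤-refl ∷ []
maximum d (d′ ∷ ds) with maximum d′ ds
... | M , M∈ , ≤M with ℕ.≤-total d M
...   | inj₁ d≤M = M , there M∈ , d≤M ∷ ≤M
...   | inj₂ M≤d = d , here ≡.refl , ℕ.≤-refl ∷ All.map (λ x≤M → ℕ.≤-trans x≤M M≤d) ≤M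

∈⇒↭ : ∀ {d : ℕ} {ds} → d ∈ ds → ∃ λ ds′ → ds ↭ d ∷ ds′
∈⇒↭ {d} d∈ds with Membership.∈-∃++ d∈ds
... | xs , ys , ≡.refl = xs List.++ ys , ↭.shift d xs ys

quotientBy : ℕ → ℕ → List ℕ
quotientBy n d with n ℕ.∣? d
... | yes (ℕ.divides q _) = List.[ q ]
... | no _                = []

divideAll : ℕ → List ℕ → List ℕ
divideAll n = List.concatMap (quotientBy n)

divideAll-multiples : ∀ n .{{_ : NonZero n}} ds → divideAll n (List.map (n ℕ.*_) ds) ≡ ds
divideAll-multiples n []       = ≡.refl
divideAll-multiples n (d ∷ ds) with n ℕ.∣? (n ℕ.* d)
... | yes (ℕ.divides q eq) = ≡.cong₂ _∷_ (ℕ.*-cancelʳ-≡ q d n (≡.trans (≡.sym eq) (ℕ.*-comm n d))) (divideAll-multiples n ds)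
... | no ¬d                = ⊥-elim (¬d (ℕ.m∣m*n d))

divideAll-↭ : ∀ n {xs ys} → xs ↭ ys → divideAll n xs ↭ divideAll n ys
divideAll-↭ n ↭.refl           = ↭.refl
divideAll-↭ n (↭.prep x eq)    = ↭.++⁺ˡ (quotientBy n x) (divideAll-↭ n eq)
divideAll-↭ n (↭.swap x y eq)  = ↭.trans (↭.shifts (quotientBy n x) (quotientBy n y))
  (↭.++⁺ˡ (quotientBy n y) (↭.++⁺ˡ (quotientBy n x) (divideAll-↭ n eq)))
divideAll-↭ n (↭.trans eq eq′) = ↭.trans (divideAll-↭ n eq) (divideAll-↭ n eq′)

length-divideAll : ∀ n ds → List.length (divideAll n ds) ℕ.≤ List.length ds
length-divideAll n []       = ℕ.z≤n
length-divideAll n (d ∷ ds) with n ℕ.∣? d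
... | yes (ℕ.divides q _) = ℕ.s≤s (length-divideAll n ds)
... | no _                = ℕ.m≤n⇒m≤1+n (length-divideAll n ds)

divideAll-nonZero : ∀ n {ds} → All NonZero ds → All NonZero (divideAll n ds)
divideAll-nonZero n []                = []
divideAll-nonZero n (_∷_ {d} d≢0 all) with n ℕ.∣? d
... | yes (ℕ.divides q eq) = ℕ.m*n≢0⇒m≢0 q {{≡.subst NonZero eq d≢0}} ∷ divideAll-nonZero n all
... | no _                 = divideAll-nonZero n all

module RationalParameters (E : ComplexExponential c ℓ ℓ₂) where
  open Exponentials E
  open ComplexExponential E using (exp; exp-+)
  open CommutativeRing R
  open RingProperties ring using (x≈y⇒x∙y⁻¹≈ε; -‿distribʳ-*)
  open Polynomial R using (Poly; _≈ᶠ_; X^ⁿ-1; X-_) renaming (_*_ to _*ᴾ_; ∏ to ∏ᴾ)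
  open PolynomialFunctions R
  open ∏ using () renaming (∑< to ∏<; sum to ∏F; sum-cong-≋ to ∏F-cong; ∑-comm to ∏F-comm; sum-concat to ∏F-concat)
  open Exp semiring using (_^_; ^-assocʳ)
  open NaturalCoefficients commutativeSemiring using (solve; _:=_; _:*_)
  open SetoidReasoning setoid
  open DefinedOverℚ E

  binomials : List ℕ → Carrier → Carrier
  binomials ds x = ∏ᴸ (List.map (λ d → x ^ d - 1#) ds)

  binomialPoly : List ℕ → Poly
  binomialPoly ds = ∏ᴾ (List.map X^ⁿ-1 ds)

  eval-binomialPoly : ∀ ds x → eval (binomialPoly ds) x ≈ binomials ds x
  eval-binomialPoly ds x = eval-∏ X^ⁿ-1 (λ d → x ^ d - 1#) x (λ d → eval-X^ⁿ-1 d x) ds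

  binomials-++ : ∀ xs ys x → binomials (xs List.++ ys) x ≈ binomials xs x * binomials ys x
  binomials-++ []       ys x = sym (*-identityˡ _)
  binomials-++ (d ∷ xs) ys x = trans (*-congˡ (binomials-++ xs ys x)) (sym (*-assoc _ _ _))

  binomials-↭ : ∀ {xs ys} → xs ↭ ys → ∀ x → binomials xs x ≈ binomials ys x
  binomials-↭ ↭.refl           x = refl
  binomials-↭ (↭.prep d eq)    x = *-congˡ (binomials-↭ eq x)
  binomials-↭ (↭.swap {xs} {ys} d d′ eq) x = trans
    (solve 3 (λ a b c → (a :* (b :* c)) := (b :* (a :* c))) refl (x ^ d - 1#) (x ^ d′ - 1#) (binomials xs x))
    (*-congˡ (*-congˡ (binomials-↭ eq x)))
  binomials-↭ (↭.trans eq eq′) x = trans (binomials-↭ eq x) (binomials-↭ eq′ x)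

  binomials-multiples : ∀ n ds x → binomials (List.map (n ℕ.*_) ds) x ≈ binomials ds (x ^ n)
  binomials-multiples n []       x = refl
  binomials-multiples n (d ∷ ds) x = *-cong (+-congʳ (sym (^-assocʳ x n d))) (binomials-multiples n ds x)

  binomials-isUnit : ∀ N t ds → All NonZero ds → All (ℕ._≤ N) ds → IsUnit (binomials ds (point N t))
  binomials-isUnit N t []       []          []          = isUnit-1
  binomials-isUnit N t (d ∷ ds) (d≢0 ∷ all) (d≤N ∷ ≤N) =
    isUnit-* (point-^-1 N t d {{d≢0}} d≤N) (binomials-isUnit N t ds all ≤N)

  binomials-extend : ∀ N ps qs → (∀ t → binomials ps (point N t) ≈ binomials qs (point N t)) →
                     ∀ x → binomials ps x ≈ binomials qs x
  binomials-extend N ps qs eq x = trans (sym (eval-binomialPoly ps x)) (trans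
    (eval-cong (binomialPoly ps) (binomialPoly qs) (≈ᴾ-from-points N (binomialPoly ps) (binomialPoly qs)
      (λ t → trans (eval-binomialPoly ps _) (trans (eq t) (sym (eval-binomialPoly qs _))))))
    (eval-binomialPoly qs x))

  e-1-^ : ∀ M .{{_ : NonZero M}} d → e M (+ 1) ^ d ≈ e M (+ d)
  e-1-^ M d = trans (e-^ M (+ 1) d) (reflexive (≡.cong (e M) (ℤ.*-identityʳ (+ d))))

  binomials-root : ∀ M .{{_ : NonZero M}} {ds} → M ∈ ds → binomials ds (e M (+ 1)) ≈ 0#
  binomials-root M (here ≡.refl) = trans (*-congʳ (x≈y⇒x∙y⁻¹≈ε (trans (e-1-^ M M)
    (trans (e-cong M (∣⇒≋0 ℕ.∣-refl)) (e-0 M))))) (zeroˡ _)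
  binomials-root M (there M∈ds)  = trans (*-congˡ (binomials-root M M∈ds)) (zeroʳ _)

  -- For `0 < d < M` the number exp(d/M) differs from 1 by a unit, so such a factor can be cancelled
  -- and only `d = M` can make the product vanish.
  root⇒∈ : ∀ M .{{_ : NonZero M}} ds → All NonZero ds → All (ℕ._≤ M) ds → binomials ds (e M (+ 1)) ≈ 0# → M ∈ ds
  root⇒∈ M []       []          []         root = ⊥-elim (1≉0 root)
  root⇒∈ M (d ∷ ds) (d≢0 ∷ all) (d≤M ∷ ≤M) root = cases (d ℕ.≟ M)
    where
    cases : Dec (d ≡ M) → M ∈ d ∷ ds
    cases (yes d≡M) = here (≡.sym d≡M)
    cases (no d≢M)  = there (root⇒∈ M ds all ≤M (isUnit-cancel-0
      (isUnit-cong (+-cong (sym (e-1-^ M d)) (-‿cong (e-0 M)))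
        (e-apart M (λ eq → ℕ.≢-nonZero⁻¹ d {{d≢0}} (<∧≋0⇒≡0 (ℕ.≤∧≢⇒< d≤M d≢M) eq))))
      root))

  binomials-1 : ∀ d ds → binomials (d ∷ ds) 1# ≈ 0#
  binomials-1 d ds = trans (*-congʳ (x≈y⇒x∙y⁻¹≈ε (1^ d))) (zeroˡ _)
    where
    1^ : ∀ d → 1# ^ d ≈ 1#
    1^ zero    = refl
    1^ (suc d) = trans (*-identityˡ _) (1^ d)

  commonElement : ∀ p ps q qs → All NonZero (p ∷ ps) → All NonZero (q ∷ qs) →
                  (∀ x → binomials (p ∷ ps) x ≈ binomials (q ∷ qs) x) → ∃ λ M → M ∈ p ∷ ps × M ∈ q ∷ qs
  commonElement p ps q qs ps≢0 qs≢0 eq with maximum p ps | maximum q qs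
  ... | M , M∈ , ≤M | M′ , M′∈ , ≤M′ = cases (ℕ.≤-total M′ M)
    where
    instance
      M≢0 : NonZero M
      M≢0 = All.lookup ps≢0 M∈
      M′≢0 : NonZero M′
      M′≢0 = All.lookup qs≢0 M′∈
    cases : M′ ℕ.≤ M ⊎ M ℕ.≤ M′ → ∃ λ M → M ∈ p ∷ ps × M ∈ q ∷ qs
    cases (inj₁ M′≤M) = M , M∈ , root⇒∈ M (q ∷ qs) qs≢0 (All.map (λ d≤ → ℕ.≤-trans d≤ M′≤M) ≤M′)
      (trans (sym (eq (e M (+ 1)))) (binomials-root M M∈))
    cases (inj₂ M≤M′) = M′ , root⇒∈ M′ (p ∷ ps) ps≢0 (All.map (λ d≤ → ℕ.≤-trans d≤ M≤M′) ≤M)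
      (trans (eq (e M′ (+ 1))) (binomials-root M′ M′∈)) , M′∈

  -- The recursion is on the length `k`: the lists that remain once the common exponent has been
  -- moved to the front by a permutation are not structurally smaller.
  binomials-unique : ∀ k ps qs → List.length ps ≡ k → All NonZero ps → All NonZero qs →
                     (∀ x → binomials ps x ≈ binomials qs x) → ps ↭ qs
  binomials-unique k       []       []       len ps≢0 qs≢0 eq = ↭.refl
  -- At 1 the empty product has the value 1, whereas every other one vanishes.
  binomials-unique k       []       (q ∷ qs) len ps≢0 qs≢0 eq = ⊥-elim (1≉0 (trans (eq 1#) (binomials-1 q qs)))
  binomials-unique k       (p ∷ ps) []       len ps≢0 qs≢0 eq = ⊥-elim (1≉0 (trans (sym (eq 1#)) (binomials-1 p ps)))
  binomials-unique (suc k) (p ∷ ps) (q ∷ qs) len ps≢0 qs≢0 eq = step (commonElement p ps q qs ps≢0 qs≢0 eq)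
    where
    step : (∃ λ M → M ∈ p ∷ ps × M ∈ q ∷ qs) → p ∷ ps ↭ q ∷ qs
    step (M , M∈ps , M∈qs) with ∈⇒↭ M∈ps | ∈⇒↭ M∈qs
    ... | ps′ , ps↭ | qs′ , qs↭ = ↭.trans ps↭ (↭.trans (↭.prep M ps′↭qs′) (↭.↭-sym qs↭))
      where
      ps′↭qs′ : ps′ ↭ qs′
      ps′↭qs′ = binomials-unique k ps′ qs′ (ℕ.suc-injective (≡.trans (≡.sym (↭.↭-length ps↭)) len))
        (All.tail (↭.All-resp-↭ ps↭ ps≢0)) (All.tail (↭.All-resp-↭ qs↭ qs≢0))
        (binomials-extend M ps′ qs′ λ t → isUnit-cancel (point-^-1 M t M {{All.lookup ps≢0 M∈ps}} ℕ.≤-refl)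
          (trans (sym (binomials-↭ ps↭ _)) (trans (eq _) (binomials-↭ qs↭ _))))

  linears : {m : ℕ} → Vector ℚ m → Carrier → Carrier
  linears α x = ∏F (λ i → x - exp (α i))

  linearPoly : {m : ℕ} → Vector ℚ m → Poly
  linearPoly α = ∏ᴾ (Vector.toList λ i → X- exp (α i))

  eval-linearPoly : ∀ {m} (α : Vector ℚ m) x → eval (linearPoly α) x ≈ linears α x
  eval-linearPoly {zero}  α x = eval-constant 1# x
  eval-linearPoly {suc m} α x = trans (eval-* (X- exp (α Fin.zero)) (linearPoly (α ∘ Fin.suc)) x)
    (*-cong (eval-X- (exp (α Fin.zero)) x) (eval-linearPoly (α ∘ Fin.suc) x))

  linears-isUnit : ∀ N t {m} (α : Vector ℚ m) → (∀ i → ↧ₙ α i ℕ.≤ N) → IsUnit (linears α (point N t))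
  linears-isUnit N t {zero}  α bound = isUnit-1
  linears-isUnit N t {suc m} α bound = isUnit-* (point-exp-apart N t (α Fin.zero) (bound Fin.zero))
    (linears-isUnit N t (α ∘ Fin.suc) (bound ∘ Fin.suc))

  module _ {m : ℕ} (α β : Vector ℚ m) (ps qs : List ℕ) where

    private
      eval-lhs : ∀ x → eval (linearPoly α *ᴾ binomialPoly qs) x ≈ linears α x * binomials qs x
      eval-lhs x = trans (eval-* (linearPoly α) (binomialPoly qs) x) (*-cong (eval-linearPoly α x) (eval-binomialPoly qs x))

      eval-rhs : ∀ x → eval (binomialPoly ps *ᴾ linearPoly β) x ≈ binomials ps x * linears β x
      eval-rhs x = trans (eval-* (binomialPoly ps) (linearPoly β) x) (*-cong (eval-binomialPoly ps x) (eval-linearPoly β x))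

    quotient⇒values : parameterQuotient α β ≈ᶠ exponentQuotient ps qs →
                      ∀ x → linears α x * binomials qs x ≈ binomials ps x * linears β x
    quotient⇒values eq x = trans (sym (eval-lhs x)) (trans
      (eval-cong (linearPoly α *ᴾ binomialPoly qs) (binomialPoly ps *ᴾ linearPoly β) eq) (eval-rhs x))

    -- Agreement at the points suffices, and only there are the factors that have to be cancelled
    -- known to be invertible.
    values⇒quotient : ∀ N → (∀ t → linears α (point N t) * binomials qs (point N t) ≈
                                   binomials ps (point N t) * linears β (point N t)) →
                      parameterQuotient α β ≈ᶠ exponentQuotient ps qs
    values⇒quotient N eq = ≈ᴾ-from-points N (linearPoly α *ᴾ binomialPoly qs) (binomialPoly ps *ᴾ linearPoly β)
      (λ t → trans (eval-lhs _) (trans (eq t) (sym (eval-rhs _))))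

  module _ (n : ℕ) .{{n≢0 : NonZero n}} where

    -- The numbers exp(α + l/n) are `n` roots of X^n - exp(n α). Their differences are those of the
    -- n-th roots of unity times the unit `exp α`, hence invertible.
    exp-translates : ∀ α x → x ^ n - exp (ℕ→ℚ n ℚ.* α) ≈ ∏< n (λ l → x - exp (α ℚ.+ + l ℚ./ n))
    exp-translates α = X^n-a-factor n (exp (ℕ→ℚ n ℚ.* α)) (λ l → exp (α ℚ.+ + l ℚ./ n))
      (λ i j i<j j<n → isUnit-cong (trans (distribˡ (exp α) (e n (+ j)) (- e n (+ i)))
          (+-cong (sym (exp-+ α (+ j ℚ./ n))) (trans (sym (-‿distribʳ-* (exp α) (e n (+ i)))) (-‿cong (sym (exp-+ α (+ i ℚ./ n)))))))
        (isUnit-* (isUnit-exp α) (e-apart n (λ eq → ℕ.<-irrefl (<⇒≋⇒≡ i<j j<n eq) i<j))))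
      (λ l _ → begin
        exp (α ℚ.+ + l ℚ./ n) ^ n                     ≈⟨ exp-^ n (α ℚ.+ + l ℚ./ n) ⟨
        exp (ℕ→ℚ n ℚ.* (α ℚ.+ + l ℚ./ n))             ≡⟨ ≡.cong exp (ℚ.*-distribˡ-+ (ℕ→ℚ n) α (+ l ℚ./ n)) ⟩
        exp (ℕ→ℚ n ℚ.* α ℚ.+ ℕ→ℚ n ℚ.* (+ l ℚ./ n))   ≈⟨ exp-+ (ℕ→ℚ n ℚ.* α) (ℕ→ℚ n ℚ.* (+ l ℚ./ n)) ⟩
        exp (ℕ→ℚ n ℚ.* α) * exp (ℕ→ℚ n ℚ.* (+ l ℚ./ n)) ≈⟨ *-congˡ (trans (reflexive (≡.cong exp (Fractions.ℤ*-frac n (+ n) (+ l))))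
                                                             (trans (e-cong n (d*k≋0 (+ l))) (e-0 n))) ⟩
        exp (ℕ→ℚ n ℚ.* α) * 1#                        ≈⟨ *-identityʳ _ ⟩
        exp (ℕ→ℚ n ℚ.* α)                             ∎)
      where
      <⇒≋⇒≡ : ∀ {i j} → i ℕ.< j → j ℕ.< n → + j ≋ + i [ n ] → i ≡ j
      <⇒≋⇒≡ {i} {j} i<j j<n eq = ≡.trans (≡.sym (ℕ.m<n⇒m%n≡m (ℕ.<-trans i<j j<n)))
        (≡.trans (≋⇒%ℕ≡ n (≋-sym eq)) (ℕ.m<n⇒m%n≡m j<n))

    linears-translates : ∀ {m} (α : Vector ℚ m) x → linears (translates n α) x ≈ linears (multiples n α) (x ^ n)
    linears-translates {m} α x = begin
      ∏F (λ I → x - exp (translates n α I))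
        ≈⟨ ∏F-concat n (λ l i → α i ℚ.+ + toℕ l ℚ./ n) (λ β → x - exp β) ⟩
      ∏F {n} (λ l → ∏F {m} (λ i → x - exp (α i ℚ.+ + toℕ l ℚ./ n)))
        ≈⟨ ∏F-comm {n} {m} (λ l i → x - exp (α i ℚ.+ + toℕ l ℚ./ n)) ⟩
      ∏F (λ i → ∏< n (λ l → x - exp (α i ℚ.+ + l ℚ./ n)))
        ≈⟨ ∏F-cong {m} (λ i → exp-translates (α i) x) ⟨
      ∏F (λ i → x ^ n - exp (ℕ→ℚ n ℚ.* α i)) ∎

    module _ {m : ℕ} (a b : Vector ℚ m) where

      translates-representation : ∀ {ps qs} → IsRepresentation (multiples n a) (multiples n b) ps qs →
        IsRepresentation (translates n a) (translates n b) (List.map (n ℕ.*_) ps) (List.map (n ℕ.*_) qs)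
      translates-representation {ps} {qs} (ps≢0 , qs≢0 , eq) = scaled ps≢0 , scaled qs≢0 ,
        values⇒quotient (translates n a) (translates n b) (List.map (n ℕ.*_) ps) (List.map (n ℕ.*_) qs) 0 (λ t → values (point 0 t))
        where
        scaled : ∀ {ds} → All NonZero ds → All NonZero (List.map (n ℕ.*_) ds)
        scaled all = All.map⁺ (All.map (λ {d} d≢0 → ℕ.m*n≢0 n d {{n≢0}} {{d≢0}}) all)
        values : ∀ x → linears (translates n a) x * binomials (List.map (n ℕ.*_) qs) x ≈
                       binomials (List.map (n ℕ.*_) ps) x * linears (translates n b) x
        values x = begin
          linears (translates n a) x * binomials (List.map (n ℕ.*_) qs) x
            ≈⟨ *-cong (linears-translates a x) (binomials-multiples n qs x) ⟩
          linears (multiples n a) (x ^ n) * binomials qs (x ^ n)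
            ≈⟨ quotient⇒values (multiples n a) (multiples n b) ps qs eq (x ^ n) ⟩
          binomials ps (x ^ n) * linears (multiples n b) (x ^ n)
            ≈⟨ *-cong (binomials-multiples n ps x) (linears-translates b x) ⟨
          binomials (List.map (n ℕ.*_) ps) x * linears (translates n b) x ∎

      -- The two representations are multiplied crosswise. At points of denominator beyond those of
      -- all parameters the linear factors cancel, and the uniqueness of exponents applies to what
      -- is left.
      representations-↭ : ∀ {ps qs ps′ qs′} →
        IsRepresentation (translates n a) (translates n b) ps qs →
        IsRepresentation (translates n a) (translates n b) ps′ qs′ →
        ps′ List.++ qs ↭ ps List.++ qs′
      representations-↭ {ps} {qs} {ps′} {qs′} (ps≢0 , qs≢0 , eq) (ps′≢0 , qs′≢0 , eq′) =
        binomials-unique _ (ps′ List.++ qs) (ps List.++ qs′) ≡.refl (All.++⁺ ps′≢0 qs≢0) (All.++⁺ ps≢0 qs′≢0)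
          (binomials-extend N (ps′ List.++ qs) (ps List.++ qs′) λ t → isUnit-cancel
            (isUnit-* (linears-isUnit N t α (λ i → ℕ.≤-trans (proj₂ boundα i) (ℕ.m≤m+n (proj₁ boundα) (proj₁ boundβ))))
                      (linears-isUnit N t β (λ i → ℕ.≤-trans (proj₂ boundβ i) (ℕ.m≤n+m (proj₁ boundβ) (proj₁ boundα)))))
            (values (point N t)))
        where
        α = translates n a
        β = translates n b
        boundα = bounded (λ i → ↧ₙ α i)
        boundβ = bounded (λ i → ↧ₙ β i)
        N = proj₁ boundα ℕ.+ proj₁ boundβ
        values : ∀ x → linears α x * linears β x * binomials (ps′ List.++ qs) x ≈ linears α x * linears β x * binomials (ps List.++ qs′) x
        values x = begin
          A * B * binomials (ps′ List.++ qs) x        ≈⟨ *-congˡ (binomials-++ ps′ qs x) ⟩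
          A * B * (binomials ps′ x * binomials qs x)  ≈⟨ solve 4 (λ a b p q → (a :* b :* (p :* q)) := ((a :* q) :* (p :* b))) refl A B (binomials ps′ x) (binomials qs x) ⟩
          A * binomials qs x * (binomials ps′ x * B)  ≈⟨ *-cong (quotient⇒values α β ps qs eq x) (sym (quotient⇒values α β ps′ qs′ eq′ x)) ⟩
          binomials ps x * B * (A * binomials qs′ x)  ≈⟨ solve 4 (λ a b p q → ((p :* b) :* (a :* q)) := (a :* b :* (p :* q))) refl A B (binomials ps x) (binomials qs′ x) ⟩
          A * B * (binomials ps x * binomials qs′ x)  ≈⟨ *-congˡ (binomials-++ ps qs′ x) ⟨
          A * B * binomials (ps List.++ qs′) x        ∎
          where
          A = linears α x
          B = linears β x

      -- By comparison with the representation `(n ps, n qs)` of the translates, `ps′` with `n qs`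
      -- is a permutation of `n ps` with `qs′`. Dividing by `n` preserves this and turns `n qs`,
      -- `n ps` back into `qs`, `ps`, which the given representation then eliminates.
      divide-representation : ∀ {ps qs ps′ qs′} →
        IsRepresentation (multiples n a) (multiples n b) ps qs →
        IsRepresentation (translates n a) (translates n b) ps′ qs′ →
        IsRepresentation (multiples n a) (multiples n b) (divideAll n ps′) (divideAll n qs′)
      divide-representation {ps} {qs} {ps′} {qs′} rep@(ps≢0 , qs≢0 , eq) rep′@(ps′≢0 , qs′≢0 , _) =
        divideAll-nonZero n ps′≢0 , divideAll-nonZero n qs′≢0 ,
        values⇒quotient α β Dps Dqs N λ t → isUnit-cancel
          (binomials-isUnit N t ps ps≢0 (All.tabulate (ListAction.∈⇒≤product ps≢0)))
          (values (point N t))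
        where
        α = multiples n a
        β = multiples n b
        Dps = divideAll n ps′
        Dqs = divideAll n qs′
        -- Nonzero exponents are bounded by their product, so the factors belonging to `ps` are
        -- invertible at these points.
        N = ℕ-product ps
        D↭ : Dps List.++ qs ↭ ps List.++ Dqs
        D↭ = ≡.subst₂ _↭_
          (≡.trans (List.concatMap-++ (quotientBy n) ps′ _) (≡.cong (Dps List.++_) (divideAll-multiples n qs)))
          (≡.trans (List.concatMap-++ (quotientBy n) (List.map (n ℕ.*_) ps) qs′) (≡.cong (List._++ Dqs) (divideAll-multiples n ps)))
          (divideAll-↭ n (representations-↭ (translates-representation rep) rep′))
        values : ∀ x → binomials ps x * (linears α x * binomials Dqs x) ≈ binomials ps x * (binomials Dps x * linears β x)
        values x = begin
          P * (A * binomials Dqs x)         ≈⟨ solve 3 (λ p a d → (p :* (a :* d)) := (a :* (p :* d))) refl P A (binomials Dqs x) ⟩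
          A * (P * binomials Dqs x)         ≈⟨ *-congˡ (trans (sym (binomials-++ ps Dqs x)) (trans (sym (binomials-↭ D↭ x)) (binomials-++ Dps qs x))) ⟩
          A * (binomials Dps x * Q)         ≈⟨ solve 3 (λ a d q → (a :* (d :* q)) := (d :* (a :* q))) refl A (binomials Dps x) Q ⟩
          binomials Dps x * (A * Q)         ≈⟨ *-congˡ (quotient⇒values α β ps qs eq x) ⟩
          binomials Dps x * (P * linears β x) ≈⟨ solve 3 (λ d p b → (d :* (p :* b)) := (p :* (d :* b))) refl (binomials Dps x) P (linears β x) ⟩
          P * (binomials Dps x * linears β x) ∎
          where
          A = linears α x
          P = binomials ps x
          Q = binomials qs x

      -- Minimality is inherited because `divideAll` never lengthens a list: a representation of the
      -- translates yields one of the multiples that is at most as long.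
      translates-hasExponents : ∀ ps qs → HasExponents (multiples n a) (multiples n b) ps qs →
        HasExponents (translates n a) (translates n b) (List.map (n ℕ.*_) ps) (List.map (n ℕ.*_) qs)
      translates-hasExponents ps qs (rep , minimal) = translates-representation rep , λ ps′ qs′ rep′ →
        let Dps≤ , Dqs≤ = minimal _ _ (divide-representation rep rep′) in
        ℕ.≤-trans (ℕ.≤-reflexive (List.length-map (n ℕ.*_) ps)) (ℕ.≤-trans Dps≤ (length-divideAll n ps′)) ,
        ℕ.≤-trans (ℕ.≤-reflexive (List.length-map (n ℕ.*_) qs)) (ℕ.≤-trans Dqs≤ (length-divideAll n qs′))

-- Invariance of the parameters under multiplication by p

prime-free-part : ∀ {p} → Prime p → ∀ c .{{_ : NonZero c}} → ∃₂ λ e c′ → c ≡ p ℕ.^ e ℕ.* c′ × ¬ p ∣ c′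
prime-free-part {p} p-prime = ℕ.<-rec _ go
  where
  1<p : 1 ℕ.< p
  1<p = ℕ.nonTrivial⇒n>1 p {{ℕ.prime⇒nonTrivial p-prime}}

  go : ∀ c → (∀ {d} → d ℕ.< c → .{{_ : NonZero d}} → ∃₂ λ e c′ → d ≡ p ℕ.^ e ℕ.* c′ × ¬ p ∣ c′) →
       .{{_ : NonZero c}} → ∃₂ λ e c′ → c ≡ p ℕ.^ e ℕ.* c′ × ¬ p ∣ c′
  go c rec {{c≢0}} with p ℕ.∣? c
  ... | no  p∤c                  = 0 , c , ≡.sym (ℕ.+-identityʳ c) , p∤c
  ... | yes (ℕ.divides d c≡d*p)  = extend (rec d<c {{d≢0}})
    where
    d≢0 : NonZero d
    d≢0 = ℕ.m*n≢0⇒m≢0 d {p} {{ℕ.≢-nonZero λ dp≡0 → ℕ.≢-nonZero⁻¹ c {{c≢0}} (≡.trans c≡d*p dp≡0)}}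
    d<c : d ℕ.< c
    d<c = ≡.subst (d ℕ.<_) (≡.sym c≡d*p) (ℕ.m<m*n d p {{d≢0}} 1<p)
    extend : (∃₂ λ e c′ → d ≡ p ℕ.^ e ℕ.* c′ × ¬ p ∣ c′) → ∃₂ λ e c′ → c ≡ p ℕ.^ e ℕ.* c′ × ¬ p ∣ c′
    extend (e , c′ , eq , p∤c′) = suc e , c′ , ≡.trans c≡d*p (≡.trans (ℕ.*-comm d p) (≡.trans (≡.cong (p ℕ.*_) eq) (≡.sym (ℕ.*-assoc p _ c′)))) , p∤c′

-- With `c = p^e c′` take `u = p + L c′`. It is prime to `p` because `p` divides neither `L` nor
-- `c′`; a common divisor of `u` and `c′` divides `p`, hence is 1.
coprime-representative : ∀ {p} → Prime p → ∀ L c .{{_ : NonZero c}} → ¬ p ∣ L →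
                         ∃ λ u → ℕ.Coprime u c × + u ≋ + p [ L ]
coprime-representative {p} p-prime L c p∤L with prime-free-part p-prime c
... | e , c′ , ≡.refl , p∤c′ = u , coprime-*ʳ (PAdic.coprime-p^ p-prime p∤u e) u⊥c′ ,
  ≋-trans (≋-reflexive (≡.cong (ℤ._+_ (+ p)) (ℤ.pos-* L c′))) (≋-+d* (+ p) (+ c′))
  where
  u = p ℕ.+ L ℕ.* c′
  p∤u : ¬ p ∣ u
  p∤u p∣u = [ p∤L , p∤c′ ]′ (ℕ.euclidsLemma L c′ p-prime (ℕ.∣m+n∣m⇒∣n p∣u ℕ.∣-refl))
  u⊥c′ : ℕ.Coprime u c′
  u⊥c′ {f} (f∣u , f∣c′) = [ id , (λ { ≡.refl → ⊥-elim (p∤c′ f∣c′) }) ]′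
    (ℕ.prime⇒irreducible p-prime (ℕ.∣m+n∣m⇒∣n (≡.subst (f ∣_) (ℕ.+-comm p _) f∣u) (ℕ.∣n⇒∣m*n L f∣c′)))

module ∑ℤ = FiniteSums ℤ.+-0-commutativeMonoid
open ∑ℤ using () renaming (sum to ∑ℤ; sum-cong-≋ to ∑ℤ-cong) public

∑ᴸ-tabulate : ∀ {A : Set} (f : A → ℤ) {m} (g : Fin m → A) → ∑ᴸ f (List.tabulate g) ≡ ∑ℤ (f ∘ g)
∑ᴸ-tabulate f {zero}  g = ≡.refl
∑ᴸ-tabulate f {suc m} g = ≡.cong (ℤ._+_ (f (g Fin.zero))) (∑ᴸ-tabulate f (g ∘ Fin.suc))

∑ᴸ-applyUpTo : ∀ {A : Set} (f : A → ℤ) (g : ℕ → A) n → ∑ᴸ f (List.applyUpTo g n) ≡ ∑ℤ.∑< n (f ∘ g)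
∑ᴸ-applyUpTo f g zero    = ≡.refl
∑ᴸ-applyUpTo f g (suc n) = ≡.cong (ℤ._+_ (f (g 0))) (∑ᴸ-applyUpTo f (g ∘ suc) n)

ρ : (L : ℕ) .{{_ : NonZero L}} → ℤ → ℤ
ρ L z = + (z ℤ.%ℕ L)

ρ-cong : ∀ L .{{_ : NonZero L}} {x y} → x ≋ y [ L ] → ρ L x ≡ ρ L y
ρ-cong L eq = ≡.cong +_ (≋⇒%ℕ≡ L eq)

≋-*c : ∀ {L x y} c → x ≋ y [ L ] → x ℤ.* + c ≋ y ℤ.* + c [ L ℕ.* c ]
≋-*c {L} {x} {y} c (congruent (Signed.divides k eq)) = congruent (Signed.divides k
  (≡.trans (lem x y (+ c)) (≡.trans (≡.cong (ℤ._* + c) eq) (≡.trans (ℤ.*-assoc k (+ L) (+ c)) (≡.cong (k ℤ.*_) (≡.sym (ℤ.pos-* L c)))))))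
  where
  lem : ∀ x y c → x ℤ.* c ℤ.- y ℤ.* c ≡ (x ℤ.- y) ℤ.* c
  lem = solve-∀

ρ-scale : ∀ L c .{{_ : NonZero L}} .{{_ : NonZero c}} .{{_ : NonZero (L ℕ.* c)}} z →
          ρ (L ℕ.* c) (z ℤ.* + c) ≡ ρ L z ℤ.* + c
ρ-scale L c z = ≡.trans (≡.cong +_ (≡.trans (≋⇒%ℕ≡ (L ℕ.* c) (≋-sym (≋-trans (≋-reflexive (ℤ.pos-* (z ℤ.%ℕ L) c)) (≋-*c c (%ℕ-≋ z L)))))
  (ℕ.m<n⇒m%n≡m (ℕ.*-monoˡ-< c (ℤ.n%ℕd<d z L))))) (ℤ.pos-* (z ℤ.%ℕ L) c)

module ParameterInvariance (E : ComplexExponential c ℓ ℓ₂) where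
  open Exponentials E
  open RationalParameters E
  open ComplexExponential E using (exp)
  open CommutativeRing R
  open PolynomialFunctions R
  open ∏ using () renaming (∑< to ∏<)
  open DefinedOverℚ E
  open SetoidReasoning setoid

  private
    rootProduct-applyUpTo : ∀ N .{{_ : NonZero N}} (g : ℕ → ℤ) n x →
                            rootProduct N (List.applyUpTo g n) x ≈ ∏< n (λ i → x - e N (g i))
    rootProduct-applyUpTo N g zero    x = refl
    rootProduct-applyUpTo N g (suc n) x = *-congˡ (rootProduct-applyUpTo N (g ∘ suc) n x)

  Divisors : ℕ → List ℕ → Set
  Divisors N = All (λ d → NonZero d × d ∣ N)

  -- The residue y modulo N stands for the root of unity exp (y / N).
  rootsOf : ∀ N {ds} → Divisors N ds → List ℤ
  rootsOf N []                                      = []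
  rootsOf N (_∷_ {d} (_ , ℕ.divides k _) divisors) = List.applyUpTo (λ h → + (h ℕ.* k)) d List.++ rootsOf N divisors

  rootProduct-rootsOf : ∀ N .{{_ : NonZero N}} {ds} (divisors : Divisors N ds) x →
                        rootProduct N (rootsOf N divisors) x ≈ binomials ds x
  rootProduct-rootsOf N []                                               x = refl
  rootProduct-rootsOf N (_∷_ {d} (d≢0 , ℕ.divides k N≡k*d) divisors) x = trans
    (rootProduct-++ N (List.applyUpTo (λ h → + (h ℕ.* k)) d) (rootsOf N divisors) x)
    (*-cong (trans (rootProduct-applyUpTo N (λ h → + (h ℕ.* k)) d x)
               (sym (X^d-1-factor N d k {{d≢0}} (≡.trans N≡k*d (ℕ.*-comm k d)) x)))
            (rootProduct-rootsOf N divisors x))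

  -- For each exponent `d` the roots are the multiples of `k = N / d`, on which `u`, being prime to
  -- `d`, acts as a permutation.
  sum-rootsOf-* : ∀ N .{{_ : NonZero N}} u {ds} (divisors : Divisors N ds) → All (ℕ.Coprime u) ds →
                  ∀ f → Periodic N f → ∑ᴸ (λ y → f (+ u ℤ.* y)) (rootsOf N divisors) ≡ ∑ᴸ f (rootsOf N divisors)
  sum-rootsOf-* N u []                                              []           f per = ≡.refl
  sum-rootsOf-* N u (_∷_ {d} (d≢0 , ℕ.divides k N≡k*d) divisors) (u⊥d ∷ u⊥) f per =
    ≡.trans (∑ᴸ-++ (λ y → f (+ u ℤ.* y)) roots (rootsOf N divisors))
      (≡.trans (≡.cong₂ ℤ._+_ permuted (sum-rootsOf-* N u divisors u⊥ f per))
        (≡.sym (∑ᴸ-++ f roots (rootsOf N divisors))))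
    where
    g : ℕ → ℤ
    g h = + (h ℕ.* k)
    roots = List.applyUpTo g d
    g-u : ∀ h → + u ℤ.* g h ≡ g (u ℕ.* h)
    g-u h = ≡.trans (≡.sym (ℤ.pos-* u (h ℕ.* k))) (≡.cong +_ (≡.sym (ℕ.*-assoc u h k)))
    g-periodic : ∀ h → f (g (d ℕ.+ h)) ≡ f (g h)
    g-periodic h = per (≋-trans (≋-reflexive (≡.cong +_ (≡.trans (ℕ.*-distribʳ-+ k d h)
        (≡.cong (ℕ._+ h ℕ.* k) (≡.trans (ℕ.*-comm d k) (≡.sym N≡k*d))))))
      (≋-trans (≋-+ {y = g h} (∣⇒≋0 ℕ.∣-refl) ≋-refl) (≋-reflexive (ℤ.+-identityˡ (g h)))))
    permuted : ∑ᴸ (λ y → f (+ u ℤ.* y)) roots ≡ ∑ᴸ f roots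
    permuted = ≡.trans (∑ᴸ-applyUpTo (λ y → f (+ u ℤ.* y)) g d)
      (≡.trans (∑ℤ.∑<-cong d {λ h → f (+ u ℤ.* g h)} {λ h → f (g (u ℕ.* h))} (λ h _ → ≡.cong f (g-u h)))
        (≡.trans (∑ℤ.∑<-*-permute d u {f ∘ g} u⊥d g-periodic) (≡.sym (∑ᴸ-applyUpTo f g d))))

  module _ (L : ℕ) .{{L≢0 : NonZero L}} {m : ℕ} {α β : Vector ℚ m} (A B : Fin m → ℤ)
    (α≡A/L : ∀ i → α i ≡ A i ℚ./ L) (β≡B/L : ∀ i → β i ≡ B i ℚ./ L)
    {ps qs : List ℕ} (representation : IsRepresentation α β ps qs) where

    private
      -- A common multiple of all exponents. Modulo `N = L c₀` both the parameters and the roots of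
      -- every X^d - 1 become residues.
      c₀ = ℕ-product ps ℕ.* ℕ-product qs
      N = L ℕ.* c₀
      ps≢0 = proj₁ representation
      qs≢0 = proj₁ (proj₂ representation)
      instance
        c₀≢0 : NonZero c₀
        c₀≢0 = ℕ.m*n≢0 (ℕ-product ps) (ℕ-product qs) {{ListAction.product≢0 ps≢0}} {{ListAction.product≢0 qs≢0}}
        N≢0 : NonZero N
        N≢0 = ℕ.m*n≢0 L c₀

      ps∣c₀ : All (_∣ c₀) ps
      ps∣c₀ = All.tabulate (λ d∈ → ℕ.∣m⇒∣m*n (ℕ-product qs) (ListAction.∈⇒∣product d∈))
      qs∣c₀ : All (_∣ c₀) qs
      qs∣c₀ = All.tabulate (λ d∈ → ℕ.∣n⇒∣m*n (ℕ-product ps) (ListAction.∈⇒∣product d∈))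

      divisors : ∀ {ds} → All NonZero ds → All (_∣ c₀) ds → Divisors N ds
      divisors ds≢0 ds∣ = All.zipWith (λ (d≢0 , d∣) → d≢0 , ℕ.∣n⇒∣m*n L d∣) (ds≢0 , ds∣)

      scaled : (Fin m → ℤ) → List ℤ
      scaled A = List.tabulate (λ i → A i ℤ.* + c₀)

      rootProduct-scaled : ∀ {m} {α : Vector ℚ m} (A : Fin m → ℤ) → (∀ i → α i ≡ A i ℚ./ L) →
                           ∀ x → rootProduct N (List.tabulate (λ i → A i ℤ.* + c₀)) x ≈ linears α x
      rootProduct-scaled {zero}  A eq x = refl
      rootProduct-scaled {suc m} A eq x = *-cong
        (+-congˡ (-‿cong (trans (sym (e-scaleʳ L c₀ (A Fin.zero))) (reflexive (≡.cong exp (≡.sym (eq Fin.zero)))))))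
        (rootProduct-scaled (A ∘ Fin.suc) (eq ∘ Fin.suc) x)

      lhs = scaled A List.++ rootsOf N (divisors qs≢0 qs∣c₀)
      rhs = scaled B List.++ rootsOf N (divisors ps≢0 ps∣c₀)

      products-agree : ∀ x → rootProduct N lhs x ≈ rootProduct N rhs x
      products-agree x = begin
        rootProduct N lhs x
          ≈⟨ rootProduct-++ N (scaled A) _ x ⟩
        rootProduct N (scaled A) x * rootProduct N (rootsOf N (divisors qs≢0 qs∣c₀)) x
          ≈⟨ *-cong (rootProduct-scaled A α≡A/L x) (rootProduct-rootsOf N (divisors qs≢0 qs∣c₀) x) ⟩
        linears α x * binomials qs x
          ≈⟨ quotient⇒values α β ps qs (proj₂ (proj₂ representation)) x ⟩
        binomials ps x * linears β x
          ≈⟨ *-comm _ _ ⟩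
        linears β x * binomials ps x
          ≈⟨ *-cong (rootProduct-scaled B β≡B/L x) (rootProduct-rootsOf N (divisors ps≢0 ps∣c₀) x) ⟨
        rootProduct N (scaled B) x * rootProduct N (rootsOf N (divisors ps≢0 ps∣c₀)) x
          ≈⟨ rootProduct-++ N (scaled B) _ x ⟨
        rootProduct N rhs x ∎

    module _ {p : ℕ} (p-prime : Prime p) (p∤L : ¬ p ∣ L) where

      private
        representative = coprime-representative p-prime L c₀ p∤L
        u = proj₁ representative
        u⊥c₀ = proj₁ (proj₂ representative)
        u≋p = proj₂ (proj₂ representative)

        coprimes : ∀ {ds} → All (_∣ c₀) ds → All (ℕ.Coprime u) ds
        coprimes = All.map (λ d∣ {f} (f∣u , f∣d) → u⊥c₀ (f∣u , ℕ.∣-trans f∣d d∣))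

        exchange : ∀ a b a′ b′ x y → a ℤ.+ x ≡ b ℤ.+ y → a′ ℤ.+ x ≡ b′ ℤ.+ y → a ℤ.+ b′ ≡ b ℤ.+ a′
        exchange a b a′ b′ x y eq eq′ =
          ≡.trans (lem₁ a b′ x y) (≡.trans (≡.cong₂ (λ s t → s ℤ.+ t ℤ.- (x ℤ.+ y)) eq (≡.sym eq′)) (lem₂ b y a′ x))
          where
          lem₁ : ∀ a b′ x y → a ℤ.+ b′ ≡ (a ℤ.+ x) ℤ.+ (b′ ℤ.+ y) ℤ.- (x ℤ.+ y)
          lem₁ = solve-∀
          lem₂ : ∀ b y a′ x → (b ℤ.+ y) ℤ.+ (a′ ℤ.+ x) ℤ.- (x ℤ.+ y) ≡ b ℤ.+ a′
          lem₂ = solve-∀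

      -- Multiplication by u permutes the roots of unity in the representation,
      -- hence leaves the signed multiset of the parameters modulo ℤ fixed.
      invariance : ∀ w t →
        ∑ℤ (λ i → ρ L (w ℤ.* A i ℤ.+ t)) ℤ.+ ∑ℤ (λ i → ρ L (w ℤ.* (+ p ℤ.* B i) ℤ.+ t)) ≡
        ∑ℤ (λ i → ρ L (w ℤ.* B i ℤ.+ t)) ℤ.+ ∑ℤ (λ i → ρ L (w ℤ.* (+ p ℤ.* A i) ℤ.+ t))
      invariance w t = ℤ.*-cancelʳ-≡ _ _ (+ c₀) {{c₀≢0}}
        (≡.trans (ℤ.*-distribʳ-+ (+ c₀) (S A) (S′ B))
          (≡.trans (exchange (S A ℤ.* + c₀) (S B ℤ.* + c₀) (S′ A ℤ.* + c₀) (S′ B ℤ.* + c₀) Σqs Σps plain twisted)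
            (≡.sym (ℤ.*-distribʳ-+ (+ c₀) (S B) (S′ A)))))
        where
        -- The test function is chosen so that at a numerator scaled by `c₀` it takes the value
        -- `c₀ ρ L (w z + t)`; the factor `c₀` is cancelled at the end.
        f : ℤ → ℤ
        f y = ρ N (w ℤ.* y ℤ.+ t ℤ.* + c₀)
        f-periodic : Periodic N f
        f-periodic eq = ρ-cong N (≋-+ {y = t ℤ.* + c₀} (≋-*ˡ w eq) ≋-refl)

        S S′ : (Fin m → ℤ) → ℤ
        S A = ∑ℤ (λ i → ρ L (w ℤ.* A i ℤ.+ t))
        S′ A = ∑ℤ (λ i → ρ L (w ℤ.* (+ p ℤ.* A i) ℤ.+ t))

        Σqs = ∑ᴸ f (rootsOf N (divisors qs≢0 qs∣c₀))
        Σps = ∑ᴸ f (rootsOf N (divisors ps≢0 ps∣c₀))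

        reorder : ∀ w a t c → w ℤ.* (a ℤ.* c) ℤ.+ t ℤ.* c ≡ (w ℤ.* a ℤ.+ t) ℤ.* c
        reorder = solve-∀

        f-scaled : ∀ z → f (z ℤ.* + c₀) ≡ ρ L (w ℤ.* z ℤ.+ t) ℤ.* + c₀
        f-scaled z = ≡.trans (≡.cong (ρ N) (reorder w z t (+ c₀))) (ρ-scale L c₀ (w ℤ.* z ℤ.+ t))

        f-u-scaled : ∀ z → f (+ u ℤ.* (z ℤ.* + c₀)) ≡ ρ L (w ℤ.* (+ p ℤ.* z) ℤ.+ t) ℤ.* + c₀
        f-u-scaled z = ≡.trans (≡.cong f (≡.sym (ℤ.*-assoc (+ u) z (+ c₀)))) (≡.trans (f-scaled (+ u ℤ.* z))
          (≡.cong (ℤ._* + c₀) (ρ-cong L (≋-+ {y = t} (≋-*ˡ w (≋-*ʳ z u≋p)) ≋-refl))))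

        ∑-*c₀ : ∀ {m} (g h : Fin m → ℤ) → (∀ i → g i ≡ h i ℤ.* + c₀) → ∑ℤ g ≡ ∑ℤ h ℤ.* + c₀
        ∑-*c₀ {zero}  g h eq = ≡.refl
        ∑-*c₀ {suc m} g h eq = ≡.trans (≡.cong₂ ℤ._+_ (eq Fin.zero) (∑-*c₀ (g ∘ Fin.suc) (h ∘ Fin.suc) (eq ∘ Fin.suc)))
          (≡.sym (ℤ.*-distribʳ-+ (+ c₀) (h Fin.zero) _))

        sums : ∀ g A (h : Fin m → ℤ) {ds} (divs : Divisors N ds) →
               (∀ i → g (A i ℤ.* + c₀) ≡ h i ℤ.* + c₀) →
               ∑ᴸ g (scaled A List.++ rootsOf N divs) ≡ ∑ℤ h ℤ.* + c₀ ℤ.+ ∑ᴸ g (rootsOf N divs)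
        sums g A h divs eq = ≡.trans (∑ᴸ-++ g (scaled A) (rootsOf N divs))
          (≡.cong (ℤ._+ ∑ᴸ g (rootsOf N divs)) (≡.trans (∑ᴸ-tabulate g (λ i → A i ℤ.* + c₀)) (∑-*c₀ _ h eq)))

        plain : S A ℤ.* + c₀ ℤ.+ Σqs ≡ S B ℤ.* + c₀ ℤ.+ Σps
        plain = ≡.trans (≡.sym (sums f A _ (divisors qs≢0 qs∣c₀) (f-scaled ∘ A)))
          (≡.trans (root-sums-unique N lhs rhs (products-agree ∘ point N) f f-periodic)
            (sums f B _ (divisors ps≢0 ps∣c₀) (f-scaled ∘ B)))

        fᵤ : ℤ → ℤ
        fᵤ y = f (+ u ℤ.* y)

        -- The same comparison for `f` composed with multiplication by `u`. The contributions of the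
        -- exponents do not change, so they drop out against `plain`; on the parameters `u` acts as
        -- `p`, being congruent to it modulo `L`.
        twisted : S′ A ℤ.* + c₀ ℤ.+ Σqs ≡ S′ B ℤ.* + c₀ ℤ.+ Σps
        twisted = ≡.trans (≡.cong (ℤ._+_ (S′ A ℤ.* + c₀)) (≡.sym (sum-rootsOf-* N u (divisors qs≢0 qs∣c₀) (coprimes qs∣c₀) f f-periodic)))
          (≡.trans (≡.sym (sums fᵤ A _ (divisors qs≢0 qs∣c₀) (f-u-scaled ∘ A)))
            (≡.trans (root-sums-unique N lhs rhs (products-agree ∘ point N) fᵤ (λ eq → f-periodic (≋-*ˡ (+ u) eq)))
              (≡.trans (sums fᵤ B _ (divisors ps≢0 ps∣c₀) (f-u-scaled ∘ B))
                (≡.cong (ℤ._+_ (S′ B ℤ.* + c₀)) (sum-rootsOf-* N u (divisors ps≢0 ps∣c₀) (coprimes ps∣c₀) f f-periodic)))))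

-- The exponents of n in the Gauss multiplication formula

module _ {a b ℓ₁ ℓ₂′ ℓ₃ : Level} {M : CommutativeMonoid a ℓ₁} {M′ : CommutativeMonoid b ℓ₂′} where
  private
    module M = CommutativeMonoid M
    module M′ = CommutativeMonoid M′

  -- Congruence, approximation by integers and homomorphisms are all relations compatible with the
  -- operations; this induction carries each of them over to finite sums and products.
  sum-related : (_~_ : M.Carrier → M′.Carrier → Set ℓ₃) → M.ε ~ M′.ε →
                (∀ {x x′ y y′} → x ~ x′ → y ~ y′ → (x M.∙ y) ~ (x′ M′.∙ y′)) →
                ∀ n {f : Fin n → M.Carrier} {g : Fin n → M′.Carrier} → (∀ i → f i ~ g i) →
                FiniteSums.sum M f ~ FiniteSums.sum M′ g
  sum-related _~_ ε~ε ∙~∙ zero    f~g = ε~ε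
  sum-related _~_ ε~ε ∙~∙ (suc n) f~g = ∙~∙ (f~g Fin.zero) (sum-related _~_ ε~ε ∙~∙ n (f~g ∘ Fin.suc))

module _ (p r : ℕ) {m : ℕ} (A B : Fin m → ℤ) where

  -- The arguments p^k (A i - t) and p^k (t - B i) are those of the values of
  -- Γₚ in the numerators of the hypergeometric function; t = 0 gives the
  -- denominators.
  module Total (M : CommutativeMonoid c ℓ) where
    open CommutativeMonoid M
    open FiniteSums M

    term : (ℤ → Carrier) → ℤ → ℕ → Fin m → Carrier
    term φ t k i = φ ((+ p) ℤ.^ k ℤ.* (A i ℤ.- t)) ∙ φ ((+ p) ℤ.^ k ℤ.* (t ℤ.- B i))

    total : (ℤ → Carrier) → ℤ → Carrier
    total φ t = ∑< r (λ k → sum (term φ t k))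

    total-∙ : ∀ φ ψ t → total (λ y → φ y ∙ ψ y) t ≈ total φ t ∙ total ψ t
    total-∙ φ ψ t = trans
      (∑<-cong r {λ k → sum (term (λ y → φ y ∙ ψ y) t k)} {λ k → sum (term φ t k) ∙ sum (term ψ t k)}
        (λ k _ → trans (sum-cong-≋ {m} (λ i → interchange _ _ _ _)) (∑-distrib-+ (term φ t k) (term ψ t k))))
      (∑-distrib-+ {r} (λ k → sum (term φ t (toℕ k))) (λ k → sum (term ψ t (toℕ k))))
      where
      open CommutativeMonoidSolver M using (solve; _⊕_; _⊜_)
      interchange : ∀ a b c d → (a ∙ b) ∙ (c ∙ d) ≈ (a ∙ c) ∙ (b ∙ d)
      interchange = solve 4 (λ a b c d → (a ⊕ b) ⊕ (c ⊕ d) ⊜ (a ⊕ c) ⊕ (b ⊕ d)) refl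

  total-related : ∀ {a b ℓ₁ ℓ₂′ ℓ₃} (M : CommutativeMonoid a ℓ₁) (M′ : CommutativeMonoid b ℓ₂′) →
    let module M = CommutativeMonoid M ; module M′ = CommutativeMonoid M′ in
    (_~_ : M.Carrier → M′.Carrier → Set ℓ₃) → M.ε ~ M′.ε →
    (∀ {x x′ y y′} → x ~ x′ → y ~ y′ → (x M.∙ y) ~ (x′ M′.∙ y′)) →
    ∀ φ ψ t → (∀ y → φ y ~ ψ y) → Total.total M φ t ~ Total.total M′ ψ t
  total-related M M′ _~_ ε~ε ∙~∙ φ ψ t φ~ψ = sum-related {M = M} {M′} _~_ ε~ε ∙~∙ r
    (λ k → sum-related {M = M} {M′} _~_ ε~ε ∙~∙ m (λ i → ∙~∙ (φ~ψ ((+ p) ℤ.^ toℕ k ℤ.* (A i ℤ.- t))) (φ~ψ ((+ p) ℤ.^ toℕ k ℤ.* (t ℤ.- B i)))))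

^-cong-exponent : ∀ {d e x y b} .{{_ : NonZero e}} → b ℤ.^ e ≋ + 1 [ d ] → + x ≋ + y [ e ] → b ℤ.^ x ≋ b ℤ.^ y [ d ]
^-cong-exponent {d} {e} {x} {y} {b} b^e≋1 x≋y = ≋-trans (reduce x) (≋-trans
  (≋-reflexive (≡.cong (b ℤ.^_) (+∣-⇒%≡ e (divides x≋y)))) (≋-sym (reduce y)))
  where
  1^ : ∀ k → (+ 1) ℤ.^ k ≡ + 1
  1^ = ℤ.^-zeroˡ
  reduce : ∀ x → b ℤ.^ x ≋ b ℤ.^ (x ℕ.% e) [ d ]
  reduce x = ≋-trans (≋-reflexive (≡.trans (≡.cong (b ℤ.^_) (≡.trans (ℕ.m≡m%n+[m/n]*n x e) (≡.cong (x ℕ.% e ℕ.+_) (ℕ.*-comm (x ℕ./ e) e))))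
      (≡.trans (ℤ.^-distribˡ-+-* b (x ℕ.% e) (e ℕ.* (x ℕ./ e))) (≡.cong (b ℤ.^ (x ℕ.% e) ℤ.*_) (≡.sym (ℤ.^-*-assoc b e (x ℕ./ e)))))))
    (≋-trans (≋-*ˡ (b ℤ.^ (x ℕ.% e)) (≋-trans (≋-^ (x ℕ./ e) b^e≋1) (≋-reflexive (1^ (x ℕ./ e)))))
      (≋-reflexive (ℤ.*-identityʳ _)))

module ExponentSums {p : ℕ} (p-prime : Prime p) (L : ℕ) .{{L≢0 : NonZero L}} (p∤L : ¬ p ∣ L)
  (v : ℤ) (inv : v ℤ.* + p ≋ + 1 [ L ]) (r : ℕ) {m : ℕ} (A B : Fin m → ℤ)
  (invariance : ∀ w t →
    ∑ℤ (λ i → ρ L (w ℤ.* A i ℤ.+ t)) ℤ.+ ∑ℤ (λ i → ρ L (w ℤ.* (+ p ℤ.* B i) ℤ.+ t)) ≡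
    ∑ℤ (λ i → ρ L (w ℤ.* B i ℤ.+ t)) ℤ.+ ∑ℤ (λ i → ρ L (w ℤ.* (+ p ℤ.* A i) ℤ.+ t))) where

  open MoritaProduct p-prime
  open Total p r A B ℤ.+-0-commutativeMonoid

  private
    -- The signed residue sum of the parameters. The invariance reads `Q (w p) t ≡ Q w t`, so for
    -- `w` a power of `p`, or `v` times one, the value depends on the shift `t` alone.
    Q : ℤ → ℤ → ℤ
    Q w t = ∑ℤ (λ i → ρ L (w ℤ.* A i ℤ.+ t)) ℤ.- ∑ℤ (λ i → ρ L (w ℤ.* B i ℤ.+ t))

    rearrange : ∀ a b c d → a ℤ.+ b ≡ c ℤ.+ d → a ℤ.- c ≡ d ℤ.- b
    rearrange a b c d eq = ≡.trans (lem₁ a b c) (≡.trans (≡.cong (ℤ._- (c ℤ.+ b)) eq) (lem₂ c d b))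
      where
      lem₁ : ∀ a b c → a ℤ.- c ≡ (a ℤ.+ b) ℤ.- (c ℤ.+ b)
      lem₁ = solve-∀
      lem₂ : ∀ c d b → (c ℤ.+ d) ℤ.- (c ℤ.+ b) ≡ d ℤ.- b
      lem₂ = solve-∀

    Q-cong : ∀ {w w′ t t′} → w ≋ w′ [ L ] → t ≋ t′ [ L ] → Q w t ≡ Q w′ t′
    Q-cong {w} {w′} {t} {t′} w≋ t≋ = ≡.cong₂ ℤ._-_ (part A) (part B)
      where
      part : ∀ (A : Fin m → ℤ) → ∑ℤ (λ i → ρ L (w ℤ.* A i ℤ.+ t)) ≡ ∑ℤ (λ i → ρ L (w′ ℤ.* A i ℤ.+ t′))
      part A = ∑ℤ-cong (λ i → ρ-cong L (≋-+ (≋-*ʳ (A i) w≋) t≋))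

    Q-p : ∀ w t → Q (w ℤ.* + p) t ≡ Q w t
    Q-p w t = ≡.trans (≡.cong₂ ℤ._-_ (part A) (part B))
      (≡.sym (rearrange (∑ℤ (λ i → ρ L (w ℤ.* A i ℤ.+ t))) (∑ℤ (λ i → ρ L (w ℤ.* (+ p ℤ.* B i) ℤ.+ t)))
        (∑ℤ (λ i → ρ L (w ℤ.* B i ℤ.+ t))) (∑ℤ (λ i → ρ L (w ℤ.* (+ p ℤ.* A i) ℤ.+ t))) (invariance w t)))
      where
      part : ∀ (A : Fin m → ℤ) → ∑ℤ (λ i → ρ L (w ℤ.* + p ℤ.* A i ℤ.+ t)) ≡ ∑ℤ (λ i → ρ L (w ℤ.* (+ p ℤ.* A i) ℤ.+ t))
      part A = ∑ℤ-cong (λ i → ≡.cong (λ s → ρ L (s ℤ.+ t)) (ℤ.*-assoc w (+ p) (A i)))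

    Q-p^ : ∀ k t → Q ((+ p) ℤ.^ k) t ≡ Q (+ 1) t
    Q-p^ zero    t = ≡.refl
    Q-p^ (suc k) t = ≡.trans (≡.cong (λ w → Q w t) (ℤ.*-comm (+ p) ((+ p) ℤ.^ k))) (≡.trans (Q-p ((+ p) ℤ.^ k) t) (Q-p^ k t))

    Q-vp^ : ∀ k t → Q (v ℤ.* (+ p) ℤ.^ k) t ≡ Q (+ 1) t
    Q-vp^ k t = ≡.trans (≡.sym (Q-p (v ℤ.* (+ p) ℤ.^ k) t)) (≡.trans (Q-cong {t = t} cancel ≋-refl) (Q-p^ k t))
      where
      lem : ∀ v p q → v ℤ.* q ℤ.* p ≡ v ℤ.* p ℤ.* q
      lem = solve-∀
      cancel : v ℤ.* (+ p) ℤ.^ k ℤ.* + p ≋ (+ p) ℤ.^ k [ L ]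
      cancel = ≋-trans (≋-reflexive (lem v (+ p) ((+ p) ℤ.^ k))) (≋-trans (≋-*ʳ ((+ p) ℤ.^ k) inv) (≋-reflexive (ℤ.*-identityˡ _)))

    -- `L` times the indicator of the nonzero residues. It is unchanged by the unit `v` and serves
    -- to reverse signs by `ρ(-y) = χ(y) - ρ(y)`.
    χ : ℤ → ℤ
    χ y = ρ L y ℤ.+ ρ L (ℤ.- y)

    ρ-small : ∀ {x} → x ℕ.< L → ρ L (+ x) ≡ + x
    ρ-small x<L = ≡.cong +_ (ℕ.m<n⇒m%n≡m x<L)

    χ-0 : ∀ {y} → y ≋ + 0 [ L ] → χ y ≡ + 0
    χ-0 {y} y≋0 = ≡.cong₂ ℤ._+_ (≡.trans (ρ-cong L y≋0) (ρ-small (ℕ.>-nonZero⁻¹ L)))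
      (≡.trans (ρ-cong L (≋-neg y≋0)) (ρ-small (ℕ.>-nonZero⁻¹ L)))

    χ-≢0 : ∀ {y} → ¬ y ≋ + 0 [ L ] → χ y ≡ + L
    χ-≢0 {y} y≢0 = ≡.trans (≡.cong (ℤ._+_ (+ x)) (≡.trans (ρ-cong L -y≋) (ρ-small L∸x<L)))
      (≡.cong +_ (ℕ.m+[n∸m]≡n (ℕ.<⇒≤ x<L)))
      where
      x = y ℤ.%ℕ L
      x<L = ℤ.n%ℕd<d y L
      L∸x<L : L ℕ.∸ x ℕ.< L
      L∸x<L = ℕ.∸-monoʳ-< {L} {x} {0} (ℕ.n≢0⇒n>0 λ x≡0 → y≢0 (≋-trans (≋-sym (%ℕ-≋ y L)) (≋-reflexive (≡.cong +_ x≡0)))) (ℕ.<⇒≤ x<L)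
      -y≋ : ℤ.- y ≋ + (L ℕ.∸ x) [ L ]
      -y≋ = ≋-trans (≋-neg (≋-sym (%ℕ-≋ y L))) (≋-sym (≋-trans
        (≋-reflexive (≡.trans (≡.sym (≡.trans (ℤ.m-n≡m⊖n L x) (ℤ.⊖-≥ (ℕ.<⇒≤ x<L)))) (ℤ.+-comm (+ L) (ℤ.- + x))))
        (≋-trans (≋-+ {x = ℤ.- + x} ≋-refl (∣⇒≋0 ℕ.∣-refl)) (≋-reflexive (ℤ.+-identityʳ _)))))

    χ-v : ∀ y → χ (v ℤ.* y) ≡ χ y
    χ-v y = cases (≋-dec L y (+ 0))
      where
      cases : Dec (y ≋ + 0 [ L ]) → χ (v ℤ.* y) ≡ χ y
      cases (yes y≋0) = ≡.trans (χ-0 (≋-trans (≋-*ˡ v y≋0) (≋-reflexive (ℤ.*-zeroʳ v)))) (≡.sym (χ-0 y≋0))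
      cases (no y≢0)  = ≡.trans (χ-≢0 (λ vy≋0 → y≢0 (≋-trans (≋-sym (pv y))
        (≋-trans (≋-*ˡ (+ p) vy≋0) (≋-reflexive (ℤ.*-zeroʳ (+ p))))))) (≡.sym (χ-≢0 y≢0))
        where
        pv : ∀ y → + p ℤ.* (v ℤ.* y) ≋ y [ L ]
        pv y = ≋-trans (≋-reflexive (≡.trans (≡.sym (ℤ.*-assoc (+ p) v y)) (≡.cong (ℤ._* y) (ℤ.*-comm (+ p) v))))
          (≋-trans (≋-*ʳ y inv) (≋-reflexive (ℤ.*-identityˡ y)))

    -- The arguments with `t - B` are reversed by means of `χ`, so that the residues of the
    -- denominators enter with a minus sign and `Q` appears.
    ∑ρ : ∀ w k t → ∑ℤ (term (λ y → ρ L (w ℤ.* y)) t k) ≡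
                   Q (w ℤ.* (+ p) ℤ.^ k) (ℤ.- (w ℤ.* ((+ p) ℤ.^ k ℤ.* t))) ℤ.+
                   ∑ℤ (λ i → χ (w ℤ.* ((+ p) ℤ.^ k ℤ.* (B i ℤ.- t))))
    ∑ρ w k t = ≡.trans (∑ℤ-cong pointwise) (≡.trans (∑ℤ.∑-distrib-+ {m} (λ i → a i ℤ.- b i) x)
      (≡.cong (ℤ._+ ∑ℤ x) (≡.trans (∑ℤ.∑-distrib-+ {m} a (ℤ.-_ ∘ b)) (≡.cong (ℤ._+_ (∑ℤ a)) (∑-neg b)))))
      where
      q = (+ p) ℤ.^ k
      a b x : Fin m → ℤ
      a i = ρ L (w ℤ.* q ℤ.* A i ℤ.+ ℤ.- (w ℤ.* (q ℤ.* t)))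
      b i = ρ L (w ℤ.* q ℤ.* B i ℤ.+ ℤ.- (w ℤ.* (q ℤ.* t)))
      x i = χ (w ℤ.* (q ℤ.* (B i ℤ.- t)))
      ∑-neg : ∀ {m} (b : Fin m → ℤ) → ∑ℤ (ℤ.-_ ∘ b) ≡ ℤ.- ∑ℤ b
      ∑-neg {zero}  b = ≡.refl
      ∑-neg {suc m} b = ≡.trans (≡.cong (ℤ._+_ (ℤ.- b Fin.zero)) (∑-neg (b ∘ Fin.suc))) (≡.sym (ℤ.neg-distrib-+ (b Fin.zero) _))
      lem₁ : ∀ w q a t → w ℤ.* (q ℤ.* (a ℤ.- t)) ≡ w ℤ.* q ℤ.* a ℤ.+ ℤ.- (w ℤ.* (q ℤ.* t))
      lem₁ = solve-∀
      lem₂ : ∀ w q b t → w ℤ.* (q ℤ.* (t ℤ.- b)) ≡ ℤ.- (w ℤ.* (q ℤ.* (b ℤ.- t)))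
      lem₂ = solve-∀
      lem₃ : ∀ r s → s ≡ (r ℤ.+ s) ℤ.- r
      lem₃ = solve-∀
      lem₄ : ∀ a b x → a ℤ.+ (x ℤ.- b) ≡ (a ℤ.- b) ℤ.+ x
      lem₄ = solve-∀
      second : ∀ i → ρ L (w ℤ.* (q ℤ.* (t ℤ.- B i))) ≡ x i ℤ.- b i
      second i = ≡.trans (≡.cong (ρ L) (lem₂ w q (B i) t)) (≡.trans (lem₃ (ρ L (w ℤ.* (q ℤ.* (B i ℤ.- t)))) _)
        (≡.cong (λ s → x i ℤ.- ρ L s) (lem₁ w q (B i) t)))
      pointwise : ∀ i → term (λ y → ρ L (w ℤ.* y)) t k i ≡ (a i ℤ.- b i) ℤ.+ x i
      pointwise i = ≡.trans (≡.cong₂ ℤ._+_ (≡.cong (ρ L) (lem₁ w q (A i) t)) (second i)) (lem₄ (a i) (b i) (x i))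

  -- The k-th term contributes a value of `Q` with shift `- v p^k t` on one side and `- p^k t` on
  -- the other. The latter is `- v p^(k+1) t` modulo `L`, so the two sides differ by a step in `k`,
  -- and the period of `t` closes the cycle. The sums of `χ` agree term by term.
  total-ρ : ∀ t → (+ p) ℤ.^ r ℤ.* t ≋ t [ L ] → total (λ y → ρ L (v ℤ.* y)) t ≡ total (ρ L) t
  total-ρ t period = ≡.trans (≡.trans (∑ℤ.∑<-cong r {s v} {λ k → h k ℤ.+ x k} (λ k _ → with-v k)) (∑ℤ.∑-distrib-+ {r} (h ∘ toℕ) (x ∘ toℕ)))
    (≡.trans (≡.cong (ℤ._+ ∑ℤ.∑< r x) (≡.sym (∑ℤ.∑<-rotate r h h-periodic)))
      (≡.sym (≡.trans (∑ℤ.∑<-cong r {s′} {λ k → h (suc k) ℤ.+ x k} (λ k _ → without-v k)) (∑ℤ.∑-distrib-+ {r} (h ∘ suc ∘ toℕ) (x ∘ toℕ)))))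
    where
    s : ℤ → ℕ → ℤ
    s w k = ∑ℤ (term (λ y → ρ L (w ℤ.* y)) t k)
    s′ h x : ℕ → ℤ
    s′ k = ∑ℤ (term (ρ L) t k)
    h k = Q (+ 1) (ℤ.- (v ℤ.* ((+ p) ℤ.^ k ℤ.* t)))
    x k = ∑ℤ (λ i → χ ((+ p) ℤ.^ k ℤ.* (B i ℤ.- t)))

    h-periodic : h r ≡ h 0
    h-periodic = Q-cong {+ 1} ≋-refl (≋-neg (≋-*ˡ v (≋-trans period (≋-reflexive (≡.sym (ℤ.*-identityˡ t))))))

    with-v : ∀ k → s v k ≡ h k ℤ.+ x k
    with-v k = ≡.trans (∑ρ v k t) (≡.cong₂ ℤ._+_ (Q-vp^ k (ℤ.- (v ℤ.* ((+ p) ℤ.^ k ℤ.* t)))) (∑ℤ-cong {m} (λ i → χ-v ((+ p) ℤ.^ k ℤ.* (B i ℤ.- t)))))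

    without-v : ∀ k → s′ k ≡ h (suc k) ℤ.+ x k
    without-v k = ≡.trans (∑ℤ-cong {m} (λ i → ≡.sym (≡.cong₂ ℤ._+_ (≡.cong (ρ L) (ℤ.*-identityˡ (q ℤ.* (A i ℤ.- t)))) (≡.cong (ρ L) (ℤ.*-identityˡ (q ℤ.* (t ℤ.- B i)))))))
      (≡.trans (∑ρ (+ 1) k t) (≡.cong₂ ℤ._+_
        (≡.trans (≡.cong (λ w → Q w (ℤ.- (+ 1 ℤ.* (q ℤ.* t)))) (ℤ.*-identityˡ q)) (≡.trans (Q-p^ k (ℤ.- (+ 1 ℤ.* (q ℤ.* t)))) (Q-cong {+ 1} ≋-refl (≋-neg shifted))))
        (∑ℤ-cong {m} (λ i → ≡.cong χ (ℤ.*-identityˡ (q ℤ.* (B i ℤ.- t)))))))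
      where
      q = (+ p) ℤ.^ k
      lem : ∀ v p q t → v ℤ.* (p ℤ.* q ℤ.* t) ≡ v ℤ.* p ℤ.* (q ℤ.* t)
      lem = solve-∀
      shifted : + 1 ℤ.* (q ℤ.* t) ≋ v ℤ.* (+ p ℤ.* q ℤ.* t) [ L ]
      shifted = ≋-sym (≋-trans (≋-reflexive (lem v (+ p) q t)) (≋-*ʳ (q ℤ.* t) inv))

  -- Modulo `L` the residues may be replaced by their arguments, and `t` cancels between
  -- `v q (A - t)` and `v q (t - B)`.
  total-ρ-difference : ∀ t → ∃ λ s → total (λ y → ρ L (v ℤ.* y)) t ℤ.- total (λ y → ρ L (v ℤ.* y)) (+ 0) ≡ s ℤ.* + L
  total-ρ-difference t = ≋⇒difference (≋-trans (approximate t) (≋-trans (≋-reflexive linear-part) (≋-sym (approximate (+ 0)))))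
    where
    approximate : ∀ t → total (λ y → ρ L (v ℤ.* y)) t ≋ total (v ℤ.*_) t [ L ]
    approximate t = total-related p r A B ℤ.+-0-commutativeMonoid ℤ.+-0-commutativeMonoid
      (λ x y → x ≋ y [ L ]) ≋-refl ≋-+ (λ y → ρ L (v ℤ.* y)) (v ℤ.*_) t (λ y → %ℕ-≋ (v ℤ.* y) L)
    lem : ∀ v q a b t → v ℤ.* (q ℤ.* (a ℤ.- t)) ℤ.+ v ℤ.* (q ℤ.* (t ℤ.- b)) ≡ v ℤ.* (q ℤ.* (a ℤ.- + 0)) ℤ.+ v ℤ.* (q ℤ.* (+ 0 ℤ.- b))
    lem = solve-∀
    linear-part : total (v ℤ.*_) t ≡ total (v ℤ.*_) (+ 0)
    linear-part = ∑ℤ.∑<-cong r {λ k → ∑ℤ (term (v ℤ.*_) t k)} {λ k → ∑ℤ (term (v ℤ.*_) (+ 0) k)}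
      (λ k _ → ∑ℤ-cong {m} (λ i → lem v ((+ p) ℤ.^ k) (A i) (B i) t))

  total-*ʳ : ∀ φ d t → total (λ y → φ y ℤ.* d) t ≡ total φ t ℤ.* d
  total-*ʳ φ d t = ≡.sym (total-related p r A B ℤ.+-0-commutativeMonoid ℤ.+-0-commutativeMonoid
    (λ x y → x ℤ.* d ≡ y) ≡.refl (λ {x} {x′} {y} {y′} eq eq′ → ≡.trans (ℤ.*-distribʳ-+ d x y) (≡.cong₂ ℤ._+_ eq eq′)) φ (λ y → φ y ℤ.* d) t (λ y → ≡.refl))

  module Approximants (K : ℕ) (L⁻¹ : ℕ) (L-inv : + L ℤ.* + L⁻¹ ≋ + 1 [ p ℕ.^ suc K ]) where

    private
      P = p ℕ.^ suc K
      instance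
        P≢0 : NonZero P
        P≢0 = PAdic.p^≢0 p-prime (suc K)

      -- `X⁻ y / L` is the preimage of `y / L` under multiplication by `p` modulo ℤ, and `g y` is
      -- the integer part lost in that multiplication: `p X⁻ = ρ + g L`.
      X⁻ g : ℤ → ℕ
      X⁻ y = (v ℤ.* y) ℤ.%ℕ L
      g y  = (p ℕ.* X⁻ y) ℕ./ L

      -- Congruent to `X⁻ / L - 1` modulo `P`; the summand `P` keeps it a natural number. The
      -- missing 1 returns in `approximant`, where `p (base + 1) - g` is written as
      -- `p base + suc (p - 1 - g)` to suit `unitCount-block`.
      base : ℤ → ℕ
      base y = X⁻ y ℕ.* L⁻¹ ℕ.+ (P ℕ.∸ 1)

      g<p : ∀ y → g y ℕ.< p
      g<p y = ℕ.m<n*o⇒m/o<n (ℕ.*-monoʳ-< p (ℤ.n%ℕd<d (v ℤ.* y) L))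

      ρ-formula : ∀ y → + p ℤ.* + X⁻ y ≡ ρ L y ℤ.+ + g y ℤ.* + L
      ρ-formula y = ≡.trans (≡.sym (ℤ.pos-* p (X⁻ y))) (≡.trans (≡.cong +_ (ℕ.m≡m%n+[m/n]*n (p ℕ.* X⁻ y) L))
        (≡.cong₂ ℤ._+_ (ρ-cong L {+ (p ℕ.* X⁻ y)} {y} (≋-trans (≋-reflexive (ℤ.pos-* p (X⁻ y))) (≋-trans (≋-*ˡ (+ p) (%ℕ-≋ (v ℤ.* y) L))
          (≋-trans (≋-reflexive (lem (+ p) v y)) (≋-trans (≋-*ʳ y inv) (≋-reflexive (ℤ.*-identityˡ y))))))) (ℤ.pos-* (g y) L)))
        where
        lem : ∀ p v y → p ℤ.* (v ℤ.* y) ≡ v ℤ.* p ℤ.* y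
        lem = solve-∀

      pos-∸ : ∀ {a b} → b ℕ.≤ a → + (a ℕ.∸ b) ≡ + a ℤ.- + b
      pos-∸ {a} {b} b≤a = ≡.sym (≡.trans (ℤ.m-n≡m⊖n a b) (ℤ.⊖-≥ b≤a))

      1≤p : 1 ℕ.≤ p
      1≤p = ℕ.>-nonZero⁻¹ p

      g≤p-1 : ∀ y → g y ℕ.≤ p ℕ.∸ 1
      g≤p-1 y = ℕ.≤-pred (≡.subst (suc (g y) ℕ.≤_) (≡.sym (ℕ.suc-pred p)) (g<p y))

      +base : ∀ y → + base y ≡ + X⁻ y ℤ.* + L⁻¹ ℤ.+ (+ P ℤ.- + 1)
      +base y = ≡.cong₂ ℤ._+_ (ℤ.pos-* (X⁻ y) L⁻¹) (pos-∸ (ℕ.>-nonZero⁻¹ P))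

      +top : ∀ y → + (p ℕ.∸ 1 ℕ.∸ g y) ≡ (+ p ℤ.- + 1) ℤ.- + g y
      +top y = ≡.trans (pos-∸ (g≤p-1 y)) (≡.cong (ℤ._- + g y) (pos-∸ 1≤p))

    -- An approximation p X - g of y / L, where X approximates v y / L,
    -- arranged so that unitCount is an affine function of X and g.
    approximant : ℤ → ℕ
    approximant y = p ℕ.* base y ℕ.+ suc (p ℕ.∸ 1 ℕ.∸ g y)

    approximant-correct : ∀ y → + approximant y ℤ.* + L ≋ ρ L y [ P ]
    approximant-correct y = ≋-trans (≋-reflexive expand)
      (≋-trans (≋-+ (≋-+ (≋-*ˡ (+ p ℤ.* + X⁻ y) L-inv) (d*k≋0 {P} (+ p ℤ.* + L))) (≋-refl {x = ℤ.- (+ g y ℤ.* + L)}))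
        (≋-reflexive (finish (+ p ℤ.* + X⁻ y) (ρ L y) (+ g y ℤ.* + L) (ρ-formula y))))
      where
      lem : ∀ p x l P g L → (p ℤ.* (x ℤ.* l ℤ.+ (P ℤ.- + 1)) ℤ.+ (+ 1 ℤ.+ ((p ℤ.- + 1) ℤ.- g))) ℤ.* L ≡
                            (p ℤ.* x) ℤ.* (L ℤ.* l) ℤ.+ P ℤ.* (p ℤ.* L) ℤ.+ ℤ.- (g ℤ.* L)
      lem = solve-∀
      expand : + approximant y ℤ.* + L ≡ (+ p ℤ.* + X⁻ y) ℤ.* (+ L ℤ.* + L⁻¹) ℤ.+ + P ℤ.* (+ p ℤ.* + L) ℤ.+ ℤ.- (+ g y ℤ.* + L)
      expand = ≡.trans (≡.cong (ℤ._* + L) (≡.cong₂ ℤ._+_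
          (≡.trans (ℤ.pos-* p (base y)) (≡.cong (+ p ℤ.*_) (+base y)))
          (≡.cong (ℤ._+_ (+ 1)) (+top y))))
        (lem (+ p) (+ X⁻ y) (+ L⁻¹) (+ P) (+ g y) (+ L))
      finish′ : ∀ r g → (r ℤ.+ g) ℤ.* + 1 ℤ.+ + 0 ℤ.+ ℤ.- g ≡ r
      finish′ = solve-∀
      finish : ∀ x r g → x ≡ r ℤ.+ g → x ℤ.* + 1 ℤ.+ + 0 ℤ.+ ℤ.- g ≡ r
      finish x r g ≡.refl = finish′ r g

    private
      count : ℤ → ℕ
      count = unitCount ∘ approximant

      -- The count is `(p - 1)(X⁻ L⁻¹ + P) - g`. Multiplied by `L`, with `p X⁻ - ρ` for `g L`, it is
      -- affine in `X⁻` and `ρ`, with slope `κ` in `X⁻` and constant term `γ₀`.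
      κ = (+ p ℤ.- + 1) ℤ.* (+ L ℤ.* + L⁻¹) ℤ.- + p
      γ₀ = (+ p ℤ.- + 1) ℤ.* + P ℤ.* + L

      count-formula : ∀ y → + count y ℤ.* + L ≡ (ρ L (v ℤ.* y) ℤ.* κ ℤ.+ ρ L y) ℤ.+ γ₀
      count-formula y = ≡.trans (≡.cong (λ c → + c ℤ.* + L) (unitCount-block (base y) (p ℕ.∸ 1 ℕ.∸ g y) top<p))
        (≡.trans (≡.cong (ℤ._* + L) (≡.cong₂ ℤ._+_
            (≡.trans (ℤ.pos-* (p ℕ.∸ 1) (base y)) (≡.cong₂ ℤ._*_ (pos-∸ 1≤p) (+base y))) (+top y)))
          (finish (+ p) (+ X⁻ y) (+ L⁻¹) (+ P) (+ g y) (+ L) (ρ L y) (ρ-formula y)))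
        where
        top<p : p ℕ.∸ 1 ℕ.∸ g y ℕ.< p
        top<p = ℕ.≤-<-trans (ℕ.m∸n≤m (p ℕ.∸ 1) (g y)) (ℕ.≤-reflexive (ℕ.suc-pred p))
        lem : ∀ p x l P g L → ((p ℤ.- + 1) ℤ.* (x ℤ.* l ℤ.+ (P ℤ.- + 1)) ℤ.+ ((p ℤ.- + 1) ℤ.- g)) ℤ.* L ≡
              (x ℤ.* ((p ℤ.- + 1) ℤ.* (L ℤ.* l) ℤ.- p) ℤ.+ (p ℤ.* x ℤ.- g ℤ.* L)) ℤ.+ (p ℤ.- + 1) ℤ.* P ℤ.* L
        lem = solve-∀
        cancel : ∀ r g → (r ℤ.+ g) ℤ.- g ≡ r
        cancel = solve-∀
        finish : ∀ p x l P g L r → p ℤ.* x ≡ r ℤ.+ g ℤ.* L →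
              ((p ℤ.- + 1) ℤ.* (x ℤ.* l ℤ.+ (P ℤ.- + 1)) ℤ.+ ((p ℤ.- + 1) ℤ.- g)) ℤ.* L ≡
              (x ℤ.* ((p ℤ.- + 1) ℤ.* (L ℤ.* l) ℤ.- p) ℤ.+ r) ℤ.+ (p ℤ.- + 1) ℤ.* P ℤ.* L
        finish p x l P g L r eq = ≡.trans (lem p x l P g L)
          (≡.cong (λ s → (x ℤ.* ((p ℤ.- + 1) ℤ.* (L ℤ.* l) ℤ.- p) ℤ.+ s) ℤ.+ (p ℤ.- + 1) ℤ.* P ℤ.* L)
            (≡.trans (≡.cong (ℤ._- g ℤ.* L) eq) (cancel r (g ℤ.* L))))

      total-count : ∀ t → total (+_ ∘ count) t ℤ.* + L ≡
                          (total (λ y → ρ L (v ℤ.* y)) t ℤ.* κ ℤ.+ total (ρ L) t) ℤ.+ total (λ _ → γ₀) (+ 0)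
      total-count t = ≡.trans (≡.sym (total-*ʳ (+_ ∘ count) (+ L) t)) (≡.trans (total-cong {λ y → + count y ℤ.* + L} {λ y → (ρ L (v ℤ.* y) ℤ.* κ ℤ.+ ρ L y) ℤ.+ γ₀} count-formula t)
        (≡.trans (total-∙ (λ y → ρ L (v ℤ.* y) ℤ.* κ ℤ.+ ρ L y) (λ _ → γ₀) t)
          (≡.cong (ℤ._+ total (λ _ → γ₀) (+ 0)) (≡.trans (total-∙ (λ y → ρ L (v ℤ.* y) ℤ.* κ) (ρ L) t)
            (≡.cong (ℤ._+ total (ρ L) t) (total-*ʳ (λ y → ρ L (v ℤ.* y)) κ t))))))
        where
        total-cong : ∀ {φ ψ : ℤ → ℤ} → (∀ y → φ y ≡ ψ y) → ∀ t → total φ t ≡ total ψ t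
        total-cong {φ} {ψ} eq t = total-related p r A B ℤ.+-0-commutativeMonoid ℤ.+-0-commutativeMonoid
          _≡_ ≡.refl (≡.cong₂ ℤ._+_) φ ψ t eq

    totalCount : ℤ → ℕ
    totalCount = Total.total p r A B ℕ.+-0-commutativeMonoid count

    -- `total-ρ` merges the two residue totals into one with the factor
    -- `κ + 1 = (p - 1)(L L⁻¹ - 1)`, a multiple of `(p - 1) P`. That total changes by a multiple of
    -- `L` between `t` and 0, which accounts for the factor `L` on the counts.
    totalCount-≋ : ∀ t → (+ p) ℤ.^ r ℤ.* t ≋ t [ L ] → + totalCount t ≋ + totalCount (+ 0) [ (p ℕ.∸ 1) ℕ.* p ℕ.^ K ]
    totalCount-≋ t period = ≋-trans (≋-reflexive (positive t)) (≋-trans difference (≋-reflexive (≡.sym (positive (+ 0)))))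
      where
      positive : ∀ t → + totalCount t ≡ total (+_ ∘ count) t
      positive t = total-related p r A B ℕ.+-0-commutativeMonoid ℤ.+-0-commutativeMonoid
        (λ x y → + x ≡ y) ≡.refl (λ {x} {x′} {y} eq eq′ → ≡.trans (ℤ.pos-+ x y) (≡.cong₂ ℤ._+_ eq eq′)) count (+_ ∘ count) t (λ _ → ≡.refl)

      s = proj₁ (total-ρ-difference t)
      k = proj₁ (≋⇒difference L-inv)

      T₁ T₀ V₁ V₀ c₁ : ℤ
      T₁ = total (+_ ∘ count) t
      T₀ = total (+_ ∘ count) (+ 0)
      V₁ = total (λ y → ρ L (v ℤ.* y)) t
      V₀ = total (λ y → ρ L (v ℤ.* y)) (+ 0)
      c₁ = total (λ _ → γ₀) (+ 0)

      lem₁ : ∀ a b c κ → (a ℤ.* κ ℤ.+ a ℤ.+ c) ℤ.- (b ℤ.* κ ℤ.+ b ℤ.+ c) ≡ (a ℤ.- b) ℤ.* (κ ℤ.+ + 1)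
      lem₁ = solve-∀
      lem₂ : ∀ a b l → (a ℤ.- b) ℤ.* l ≡ a ℤ.* l ℤ.- b ℤ.* l
      lem₂ = solve-∀
      lem₃ : ∀ s l c → s ℤ.* l ℤ.* c ≡ s ℤ.* c ℤ.* l
      lem₃ = solve-∀
      lem₄ : ∀ p l → (p ℤ.- + 1) ℤ.* l ℤ.- p ℤ.+ + 1 ≡ (p ℤ.- + 1) ℤ.* (l ℤ.- + 1)
      lem₄ = solve-∀
      lem₅ : ∀ s p k P → s ℤ.* ((p ℤ.- + 1) ℤ.* (k ℤ.* (p ℤ.* P))) ≡ s ℤ.* k ℤ.* p ℤ.* ((p ℤ.- + 1) ℤ.* P)
      lem₅ = solve-∀

      formula : ∀ t → (+ p) ℤ.^ r ℤ.* t ≋ t [ L ] → total (+_ ∘ count) t ℤ.* + L ≡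
                total (λ y → ρ L (v ℤ.* y)) t ℤ.* κ ℤ.+ total (λ y → ρ L (v ℤ.* y)) t ℤ.+ c₁
      formula t period = ≡.trans (total-count t) (≡.cong (λ s → total (λ y → ρ L (v ℤ.* y)) t ℤ.* κ ℤ.+ s ℤ.+ c₁) (≡.sym (total-ρ t period)))

      T₁-T₀ : T₁ ℤ.- T₀ ≡ s ℤ.* (κ ℤ.+ + 1)
      T₁-T₀ = ℤ.*-cancelʳ-≡ (T₁ ℤ.- T₀) (s ℤ.* (κ ℤ.+ + 1)) (+ L) {{L≢0}}
        (≡.trans (lem₂ T₁ T₀ (+ L)) (≡.trans (≡.cong₂ ℤ._-_ (formula t period) (formula (+ 0) (≋-reflexive (ℤ.*-zeroʳ ((+ p) ℤ.^ r)))))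
          (≡.trans (lem₁ V₁ V₀ c₁ κ) (≡.trans (≡.cong (ℤ._* (κ ℤ.+ + 1)) (proj₂ (total-ρ-difference t))) (lem₃ s (+ L) (κ ℤ.+ + 1))))))

      difference : T₁ ≋ T₀ [ (p ℕ.∸ 1) ℕ.* p ℕ.^ K ]
      difference = congruent (Signed.divides (s ℤ.* k ℤ.* + p)
        (≡.trans T₁-T₀ (≡.trans (≡.cong (s ℤ.*_) (≡.trans (lem₄ (+ p) (+ L ℤ.* + L⁻¹))
            (≡.cong ((+ p ℤ.- + 1) ℤ.*_) (≡.trans (proj₂ (≋⇒difference L-inv)) (≡.cong (k ℤ.*_) (ℤ.pos-* p (p ℕ.^ K)))))))
          (≡.trans (lem₅ s (+ p) k (+ (p ℕ.^ K))) (≡.cong (s ℤ.* k ℤ.* + p ℤ.*_)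
            (≡.sym (≡.trans (ℤ.pos-* (p ℕ.∸ 1) (p ℕ.^ K)) (≡.cong (ℤ._* + (p ℕ.^ K)) (pos-∸ 1≤p)))))))))

    power-totalCount : ∀ n .{{_ : NonZero n}} → ¬ p ∣ n → ∀ t → (+ p) ℤ.^ r ℤ.* t ≋ t [ L ] →
                       (+ n) ℤ.^ totalCount t ≋ (+ n) ℤ.^ totalCount (+ 0) [ P ]
    power-totalCount n p∤n t period = ^-cong-exponent {b = + n} {{e≢0}} (euler K n p∤n) (totalCount-≋ t period)
      where
      e≢0 : NonZero ((p ℕ.∸ 1) ℕ.* p ℕ.^ K)
      e≢0 = ℕ.m*n≢0 (p ℕ.∸ 1) (p ℕ.^ K) {{ℕ.>-nonZero (ℕ.m<n⇒0<n∸m (ℕ.nonTrivial⇒n>1 p {{ℕ.prime⇒nonTrivial p-prime}}))}} {{PAdic.p^≢0 p-prime K}}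

-- Approximating values of Γₚ

module Translates (M : CommutativeMonoid c ℓ) (n d : ℕ) .{{_ : NonZero n}} .{{_ : NonZero d}}
  {φ : ℤ → CommutativeMonoid.Carrier M}
  (φ-cong : ∀ {x y} → x ≋ y [ n ℕ.* d ] → CommutativeMonoid._≈_ M (φ x) (φ y)) where
  open CommutativeMonoid M
  open FiniteSums M
  open SetoidReasoning setoid

  translated : ℤ → ℕ → Carrier
  translated z l = φ (z ℤ.+ + (l ℕ.* d))

  translated-periodic : ∀ z → Periodic n (translated z)
  translated-periodic z l = φ-cong (≋-trans (≋-reflexive (≡.trans
      (≡.cong (λ t → z ℤ.+ + t) (≡.trans (ℕ.*-distribʳ-+ d n l) (ℕ.+-comm (n ℕ.* d) (l ℕ.* d))))
      (≡.sym (ℤ.+-assoc z (+ (l ℕ.* d)) (+ (n ℕ.* d))))))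
    (≋-trans (≋-+ {x = z ℤ.+ + (l ℕ.* d)} ≋-refl (∣⇒≋0 ℕ.∣-refl)) (≋-reflexive (ℤ.+-identityʳ _))))

  sum-translates-* : ∀ u → ℕ.Coprime u n → ∀ z →
    ∑< n (λ l → φ (+ u ℤ.* (z ℤ.+ + (l ℕ.* d)))) ≈ ∑< n (translated (+ u ℤ.* z))
  sum-translates-* u u⊥n z = trans
    (∑<-cong n {λ l → φ (+ u ℤ.* (z ℤ.+ + (l ℕ.* d)))} {λ l → translated (+ u ℤ.* z) (u ℕ.* l)}
      (λ l _ → reflexive (≡.cong φ (≡.trans (ℤ.*-distribˡ-+ (+ u) z (+ (l ℕ.* d)))
        (≡.cong (ℤ._+_ (+ u ℤ.* z)) (≡.trans (≡.sym (ℤ.pos-* u (l ℕ.* d))) (≡.cong +_ (≡.sym (ℕ.*-assoc u l d)))))))))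
    (∑<-*-permute n u u⊥n (translated-periodic (+ u ℤ.* z)))

  -- Reducing `z` modulo `d` removes a multiple `q d`, which only shifts the translates cyclically
  -- by `q` modulo `n`.
  sum-translates-% : ∀ z → ∑< n (translated z) ≈ ∑< n (translated (+ (z ℤ.%ℕ d)))
  sum-translates-% z = trans
    (∑<-cong n {translated z} {λ l → translated w (s ℕ.+ l)} (λ l _ → φ-cong (shifted l)))
    (∑<-shift n s (translated-periodic w))
    where
    w = + (z ℤ.%ℕ d)
    q = z ℤ./ℕ d
    s = q ℤ.%ℕ n
    lem : ∀ w q d l → (w ℤ.+ q ℤ.* d) ℤ.+ l ≡ w ℤ.+ (q ℤ.* d ℤ.+ l)
    lem = solve-∀
    shifted : ∀ l → z ℤ.+ + (l ℕ.* d) ≋ w ℤ.+ + ((s ℕ.+ l) ℕ.* d) [ n ℕ.* d ]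
    shifted l = ≋-trans (≋-reflexive (≡.trans (≡.cong (ℤ._+ + (l ℕ.* d)) (ℤ.a≡a%ℕn+[a/ℕn]*n z d)) (lem w q (+ d) (+ (l ℕ.* d)))))
      (≋-trans (≋-+ {x = w} ≋-refl (≋-+ {y = + (l ℕ.* d)} (≋-*c d (≋-sym (%ℕ-≋ q n))) ≋-refl))
        (≋-reflexive (≡.cong (ℤ._+_ w) (≡.trans (≡.cong (ℤ._+ + (l ℕ.* d)) (≡.sym (ℤ.pos-* s d))) (≡.cong +_ (≡.sym (ℕ.*-distribʳ-+ d s l)))))))

module UnitInverses {p q : ℕ} {F : FiniteField q c ℓ} (Z : UnramifiedIntegers p F c′ ℓ′) where
  private module F = FiniteField F
  open UnramifiedIntegers Z

  unitInverse-inverse : ∀ x → ¬ residue x F.≈ F.0# → x * unitInverse x ≈ 1#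
  unitInverse-inverse x x≉0 with residue x F.≟ F.0#
  ... | yes x≈0 = ⊥-elim (x≉0 x≈0)
  ... | no x≉0′ = proj₂ (unit x x≉0′)

module Approximation {p : ℕ} (p-prime : Prime p) {q : ℕ} {F : FiniteField q c ℓ}
  (Z : UnramifiedIntegers p F c′ ℓ′) (Γₚ : MoritaGamma p-prime) where

  open PAdic p-prime using (morita; p^≢0; fromℚ; fromℤ; coprime-p^; _≡_[mod-p^_]) renaming (residue to digits)
  open MoritaGamma Γₚ
  open MoritaProduct p-prime
  private
    module F = FiniteField F
    module F-ring = RingProperties F.ring
    module Z = UnramifiedIntegers Z
    module ρF = RingMorphisms.IsRingHomomorphism Z.residue-isHom
  open CommutativeRing Z.commutativeRing
  open Z using (fromℕ; fromℤₚ)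
  open Exp semiring using (_^_)
  open Mult semiring using (×1-homo-*)
  open MonoidMult +-monoid using (×-homo-+; ×-homo-1)
  open RingProperties ring using (xyx⁻¹≈y)
  open NaturalCoefficients commutativeSemiring using (solve; _:=_; _:+_; _:*_)
  open SetoidReasoning setoid

  private
    π : Carrier
    π = fromℕ p

    infixl 7 _%_
    _%_ : ℤ → ℕ → ℕ
    a % K = ℤ._%ℕ_ a (p ℕ.^ K) {{p^≢0 K}}

  infix 4 _≈_[π^_]
  record _≈_[π^_] (x y : Carrier) (K : ℕ) : Set (c′ ⊔ ℓ′) where
    constructor offset
    field
      multiplier : Carrier
      equality   : x ≈ y + multiplier * π ^ K

  module _ {K : ℕ} where

    π-reflexive : ∀ {x y} → x ≈ y → x ≈ y [π^ K ]
    π-reflexive {x} {y} x≈y = offset 0# (trans x≈y (sym (trans (+-congˡ (zeroˡ _)) (+-identityʳ y))))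

    π-sym : ∀ {x y} → x ≈ y [π^ K ] → y ≈ x [π^ K ]
    π-sym {x} {y} (offset k eq) = offset (- k) (begin
      y                                ≈⟨ +-identityʳ y ⟨
      y + 0#                           ≈⟨ +-congˡ (trans (*-congʳ (-‿inverseʳ k)) (zeroˡ _)) ⟨
      y + (k - k) * π ^ K              ≈⟨ solve 4 (λ y k k′ q → (y :+ (k :+ k′) :* q) := (y :+ k :* q :+ k′ :* q)) refl y k (- k) (π ^ K) ⟩
      y + k * π ^ K + - k * π ^ K      ≈⟨ +-congʳ eq ⟨
      x + - k * π ^ K                  ∎)

    π-trans : ∀ {x y z} → x ≈ y [π^ K ] → y ≈ z [π^ K ] → x ≈ z [π^ K ]
    π-trans {x} {y} {z} (offset k eq) (offset l eq′) = offset (l + k) (trans eq (trans (+-congʳ eq′)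
      (solve 4 (λ z l k q → (z :+ l :* q :+ k :* q) := (z :+ (l :+ k) :* q)) refl z l k (π ^ K))))

    π-* : ∀ {x x′ y y′} → x ≈ x′ [π^ K ] → y ≈ y′ [π^ K ] → x * y ≈ x′ * y′ [π^ K ]
    π-* {x} {x′} {y} {y′} (offset k eq) (offset l eq′) = offset (x′ * l + k * y′ + k * l * π ^ K) (trans (*-cong eq eq′)
      (solve 5 (λ x k y l q → ((x :+ k :* q) :* (y :+ l :* q)) := (x :* y :+ (x :* l :+ k :* y :+ k :* l :* q) :* q))
        refl x′ k y′ l (π ^ K)))

  fromℕ-p^ : ∀ K → fromℕ (p ℕ.^ K) ≈ π ^ K
  fromℕ-p^ zero    = ×-homo-1 1#
  fromℕ-p^ (suc K) = trans (×1-homo-* p (p ℕ.^ K)) (*-congˡ (fromℕ-p^ K))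

  fromℕ-% : ∀ K a → fromℕ a ≈ fromℕ ((+ a) % K) [π^ K ]
  fromℕ-% K a = offset (fromℕ k) (begin
    fromℕ a                              ≡⟨ ≡.cong fromℕ (ℕ.m≡m%n+[m/n]*n a P {{p^≢0 K}}) ⟩
    fromℕ (r ℕ.+ k ℕ.* P)                ≈⟨ ×-homo-+ 1# r (k ℕ.* P) ⟩
    fromℕ r + fromℕ (k ℕ.* P)            ≈⟨ +-congˡ (trans (×1-homo-* k P) (*-congˡ (fromℕ-p^ K))) ⟩
    fromℕ r + fromℕ k * π ^ K            ∎)
    where
    P = p ℕ.^ K
    r = (+ a) % K
    k = ℕ._/_ a P {{p^≢0 K}}

  -- `x ≡ a` modulo p^K. The integer is first reduced to a natural number, for which `fromℕ` is
  -- available.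
  Represents : ℕ → Carrier → ℤ → Set _
  Represents K x a = x ≈ fromℕ (a % K) [π^ K ]

  represents-≋ : ∀ {K x a b} → a ≋ b [ p ℕ.^ K ] → Represents K x a → Represents K x b
  represents-≋ {K} {x} a≋b = ≡.subst (λ r → x ≈ fromℕ r [π^ K ]) (≋⇒%ℕ≡ (p ℕ.^ K) {{p^≢0 K}} a≋b)

  represents-ℕ : ∀ K a → Represents K (fromℕ a) (+ a)
  represents-ℕ K a = fromℕ-% K a

  represents-1 : ∀ {K} → Represents K 1# (+ 1)
  represents-1 {K} = π-trans (π-reflexive (sym (×-homo-1 1#))) (represents-ℕ K 1)

  represents-* : ∀ {K x y a b} → Represents K x a → Represents K y b → Represents K (x * y) (a ℤ.* b)
  represents-* {K} {x} {y} {a} {b} x~a y~b = represents-≋ {K} product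
    (π-trans (π-* x~a y~b) (π-trans (π-reflexive (sym (×1-homo-* (a % K) (b % K)))) (represents-ℕ K (a % K ℕ.* (b % K)))))
    where
    product : + (a % K ℕ.* (b % K)) ≋ a ℤ.* b [ p ℕ.^ K ]
    product = ≋-trans (≋-reflexive (ℤ.pos-* (a % K) (b % K))) (≋-* (%ℕ-≋ a (p ℕ.^ K) {{p^≢0 K}}) (%ℕ-≋ b (p ℕ.^ K) {{p^≢0 K}}))

  represents-unique : ∀ {K x y a} → Represents K x a → Represents K y a → x ≈ y [π^ K ]
  represents-unique x~a y~a = π-trans x~a (π-sym y~a)

  ≈-from-representatives : ∀ x y → (∀ K → x ≈ y [π^ K ]) → x ≈ y
  ≈-from-representatives x y eq = RingProperties.x∙y⁻¹≈ε⇒x≈y ring x y (Z.separated (x - y) λ K → divides-difference K (eq K))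
    where
    divides-difference : ∀ K → x ≈ y [π^ K ] → Z._∣_ (Z._^_ π K) (x - y)
    divides-difference K (offset k eq) = record { quotient = k ; equality = sym (trans (+-congʳ eq) (xyx⁻¹≈y y (k * π ^ K))) }

  fromℤₚ-represents : ∀ K X a → digits X K ≡ a % K → Represents K (fromℤₚ p-prime X) a
  fromℤₚ-represents K X a eq = limit (proj₂ (Z.complete (λ n → fromℕ (digits X n)) _) K)
    where
    limit : ∀ {x} → Z._∣_ (Z._^_ π K) (x - fromℕ (digits X K)) → Represents K x a
    limit {x} record { quotient = k ; equality = equality } = offset k (begin
      x                                     ≈⟨ xyx⁻¹≈y s x ⟨
      s + x - s                             ≈⟨ +-assoc s x (- s) ⟩
      s + (x - s)                           ≈⟨ +-cong (reflexive (≡.cong fromℕ eq)) (sym equality) ⟩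
      fromℕ (a % K) + k * π ^ K             ∎)
      where s = fromℕ (digits X K)

  digits-fromℚ : ∀ x → ¬ p ∣ ↧ₙ x → ∀ M a → a ℤ.* + ↧ₙ x ≋ ↥ x [ p ℕ.^ M ] → digits (fromℚ x) M ≡ a % M
  digits-fromℚ x p∤d M a a*d≋ with p ℕ.∣? ↧ₙ x
  ... | yes p∣d = ⊥-elim (p∤d p∣d)
  ... | no p∤d′ = ≋⇒%ℕ≡ (p ℕ.^ M) {{p^≢0 M}} (≋-sym
    (≋-trans (≋-reflexive (≡.sym (ℤ.*-identityʳ a))) (≋-trans (≋-*ˡ a (≋-sym correct))
      (≋-trans (≋-reflexive (≡.sym (ℤ.*-assoc a (+ ↧ₙ x) u))) (≋-*ʳ u a*d≋)))))
    where
    u = inverseMod (coprime-p^ p∤d′ M)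
    correct : + ↧ₙ x ℤ.* u ≋ + 1 [ p ℕ.^ M ]
    correct = congruent (inverseMod-correct (coprime-p^ p∤d′ M))

  -- Continuity replaces `X` by a nearby natural number, where Γₚ is Morita's product. The number 0
  -- is included, as `morita 0` is 1.
  Γ-approximation : ∀ X K → ∃ λ M → ∀ N → digits X M ≡ (+ N) % M → Represents K (fromℤₚ p-prime (Γ X)) (morita N)
  Γ-approximation X K = approximate (continuous X K)
    where
    at-0 : digits (Γ (fromℤ (+ 0))) K ≡ morita 0 % K
    at-0 = Γ-zero K
    at-ℕ : ∀ N → Dec (N ≡ 0) → digits (Γ (fromℤ (+ N))) K ≡ morita N % K
    at-ℕ N (yes N≡0) = ≡.subst (λ N → digits (Γ (fromℤ (+ N))) K ≡ morita N % K) (≡.sym N≡0) at-0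
    at-ℕ N (no N≢0)  = Γ-positive N {{ℕ.≢-nonZero N≢0}} K
    approximate : (∃ λ M → ∀ Y → X ≡ Y [mod-p^ M ] → Γ X ≡ Γ Y [mod-p^ K ]) →
                  ∃ λ M → ∀ N → digits X M ≡ (+ N) % M → Represents K (fromℤₚ p-prime (Γ X)) (morita N)
    approximate (M , close) = M , λ N eq → fromℤₚ-represents K (Γ X) (morita N) (≡.trans (close (fromℤ (+ N)) eq) (at-ℕ N (N ℕ.≟ 0)))

  unit-from-representative : ∀ {x a} → Unit (p ℕ.^ 1) a → Represents 1 x a → ¬ Z.residue x F.≈ F.0#
  unit-from-representative {x} {a} (u , ua≋1) x~a x≈0 = F.1≉0 (F.trans (F.sym ρF.1#-homo)
    (F.trans (residue-cong (π-sym (represents-unique {1} {w * x} {1#} {+ 1} wx~1 represents-1)))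
      (F.trans (ρF.*-homo w x) (F.trans (F.*-congˡ x≈0) (F.zeroʳ _)))))
    where
    w = fromℕ (u % 1)
    wx~1 : Represents 1 (w * x) (+ 1)
    wx~1 = represents-≋ ua≋1 (represents-* {1} {w} {x} {u} (π-reflexive refl) x~a)
    residue-π : Z.residue π F.≈ F.0#
    residue-π = Equivalence.from (Z.residue-kernel π) (record { quotient = 1# ; equality = *-identityˡ π })
    residue-cong : ∀ {x y} → x ≈ y [π^ 1 ] → Z.residue x F.≈ Z.residue y
    residue-cong {x} {y} (offset k eq) = F.trans (ρF.⟦⟧-cong eq) (F.trans (ρF.+-homo y (k * π ^ 1))
      (F.trans (F.+-congˡ (F.trans (ρF.*-homo k (π ^ 1)) (F.trans (F.*-congˡ (F.trans (ρF.*-homo π 1#) (F.trans (F.*-congʳ residue-π) (F.zeroˡ _)))) (F.zeroʳ _)))) (F.+-identityʳ _)))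

  module GammaValues (L : ℕ) .{{L≢0 : NonZero L}} (p∤L : ¬ p ∣ L) where
    open Fractions L

    abstract
      -- Γₚ(x/L), kept opaque so that the limits defining it are never unfolded when arguments are
      -- compared.
      γ₀ : ℕ → Carrier
      γ₀ x = fromℤₚ p-prime (Γ (fromℚ (frac (+ x))))

      γ₀-value : ∀ x → γ₀ x ≡ fromℤₚ p-prime (Γ (fromℚ (frac (+ x))))
      γ₀-value x = ≡.refl

    γ : ℤ → Carrier
    γ z = γ₀ (z ℤ.%ℕ L)

    γ-cong : ∀ {x y} → x ≋ y [ L ] → γ x ≡ γ y
    γ-cong {x} {y} x≋y = ≡.cong γ₀ {x ℤ.%ℕ L} {y ℤ.%ℕ L} (≋⇒%ℕ≡ L x≋y)

    digits-quotient : ∀ x z → ↧ₙ x ∣ L → ↥ x ℤ.* + L ≡ z ℤ.* + ↧ₙ x →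
                      ∀ M N → + N ℤ.* + L ≋ z [ p ℕ.^ M ] → digits (fromℚ x) M ≡ (+ N) % M
    digits-quotient x z d∣L x*L≡z*d M N NL≋z = digits-fromℚ x (λ p∣d → p∤L (ℕ.∣-trans p∣d d∣L)) M (+ N)
      (≋-cancel (unit-∤ M p∤L) (≋-trans (≋-reflexive (lem (+ L) (+ N) (+ ↧ₙ x)))
        (≋-trans (≋-*ʳ (+ ↧ₙ x) NL≋z) (≋-reflexive (≡.trans (≡.sym x*L≡z*d) (ℤ.*-comm (↥ x) (+ L)))))))
      where
      lem : ∀ l n d → l ℤ.* (n ℤ.* d) ≡ n ℤ.* l ℤ.* d
      lem = solve-∀

    digits-frac : ∀ z M N → + N ℤ.* + L ≋ z [ p ℕ.^ M ] → digits (fromℚ (frac z)) M ≡ (+ N) % M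
    digits-frac z = digits-quotient (frac z) z (↧-frac z) (↥-frac z)

    -- Only the `L` arguments `x / L` with `x < L` occur, so the largest of their moduli of
    -- continuity serves for all.
    γ-approximation : ∀ K → ∃ λ M → ∀ M′ → M ℕ.≤ M′ → ∀ x → x ℕ.< L → ∀ N → + N ℤ.* + L ≋ + x [ p ℕ.^ M′ ] →
                      Represents K (γ₀ x) (morita N)
    γ-approximation K = M , λ M′ M≤M′ x x<L N NL≋x → ≡.subst (λ y → Represents K (γ₀ y) (morita N)) (Fin.toℕ-fromℕ< x<L)
      (proj₂ (each (Fin.fromℕ< x<L)) N (digits-frac (+ toℕ (Fin.fromℕ< x<L)) _ N
        (≋-weaken (^-∣ (ℕ.≤-trans (bound (Fin.fromℕ< x<L)) M≤M′)) (≋-trans NL≋x (≋-reflexive (≡.cong +_ (≡.sym (Fin.toℕ-fromℕ< x<L))))))))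
      where
      each : (i : Fin L) → ∃ λ M → ∀ N → digits (fromℚ (frac (+ toℕ i))) M ≡ (+ N) % M → Represents K (γ₀ (toℕ i)) (morita N)
      each i = ≡.subst (λ y → ∃ λ M → ∀ N → digits (fromℚ (frac (+ toℕ i))) M ≡ (+ N) % M → Represents K y (morita N))
        (≡.sym (γ₀-value (toℕ i))) (Γ-approximation (fromℚ (frac (+ toℕ i))) K)
      M = proj₁ (bounded (proj₁ ∘ each))
      bound = proj₂ (bounded (proj₁ ∘ each))
      ^-∣ : ∀ {a b} → a ℕ.≤ b → p ℕ.^ a ∣ p ℕ.^ b
      ^-∣ {a} {b} a≤b = ≡.subst (p ℕ.^ a ∣_) (≡.trans (≡.sym (ℕ.^-distribˡ-+-* p a (b ℕ.∸ a))) (≡.cong (p ℕ.^_) (ℕ.m+[n∸m]≡n a≤b))) (ℕ.m∣m*n (p ℕ.^ (b ℕ.∸ a)))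

    -- Modulo `p` the value is a Morita product, whose factors are prime to `p`. The natural number
    -- used is the residue of `z` times an inverse of `L`.
    γ-unit : ∀ z → ¬ Z.residue (γ z) F.≈ F.0#
    γ-unit z = unit-from-representative (unit-morita 1 N) (proj₂ (γ-approximation 1) M ℕ.≤-refl (z ℤ.%ℕ L) (ℤ.n%ℕd<d z L) N correct)
      where
      M = proj₁ (γ-approximation 1)
      L⁻¹ = inverse L (p ℕ.^ M) {{p^≢0 M}} (coprime-p^ p∤L M)
      N = z ℤ.%ℕ L ℕ.* proj₁ L⁻¹
      correct : + N ℤ.* + L ≋ + (z ℤ.%ℕ L) [ p ℕ.^ M ]
      correct = ≋-trans (≋-reflexive (≡.trans (≡.cong (ℤ._* + L) (ℤ.pos-* (z ℤ.%ℕ L) (proj₁ L⁻¹))) (lem (+ (z ℤ.%ℕ L)) (+ proj₁ L⁻¹) (+ L))))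
        (≋-trans (≋-*ˡ (+ (z ℤ.%ℕ L)) (congruent (proj₂ L⁻¹))) (≋-reflexive (ℤ.*-identityʳ _)))
        where
        lem : ∀ x l L → x ℤ.* l ℤ.* L ≡ x ℤ.* (L ℤ.* l)
        lem = solve-∀

coprime-pred : ∀ n .{{_ : NonZero n}} → ℕ.Coprime (n ℕ.∸ 1) n
coprime-pred n {f} (f∣n-1 , f∣n) = ℕ.∣1⇒≡1 (ℕ.∣m+n∣m⇒∣n (≡.subst (f ∣_) (≡.sym (≡.trans (ℕ.+-comm (n ℕ.∸ 1) 1) (ℕ.suc-pred n))) f∣n) f∣n-1)

ρ-multiple : ∀ n d .{{_ : NonZero d}} .{{_ : NonZero n}} .{{_ : NonZero (n ℕ.* d)}} z →
             (+ n ℤ.* z) ℤ.%ℕ (n ℕ.* d) ≡ n ℕ.* (z ℤ.%ℕ d)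
ρ-multiple n d z = ≡.trans (≋⇒%ℕ≡ (n ℕ.* d) scaled) (ℕ.m<n⇒m%n≡m (ℕ.*-monoʳ-< n (ℤ.n%ℕd<d z d)))
  where
  scaled : + n ℤ.* z ≋ + (n ℕ.* (z ℤ.%ℕ d)) [ n ℕ.* d ]
  scaled = ≋-trans (≋-reflexive (ℤ.*-comm (+ n) z))
    (≋-trans (≡.subst (λ L → z ℤ.* + n ≋ + (z ℤ.%ℕ d) ℤ.* + n [ L ]) (ℕ.*-comm d n) (≋-*c n (≋-sym (%ℕ-≋ z d))))
      (≋-reflexive (≡.trans (ℤ.*-comm (+ (z ℤ.%ℕ d)) (+ n)) (≡.sym (ℤ.pos-* n (z ℤ.%ℕ d))))))

w+hd<nd : ∀ {n d w h} → w ℕ.< d → h ℕ.< n → w ℕ.+ h ℕ.* d ℕ.< n ℕ.* d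
w+hd<nd {n} {d} {w} {h} w<d h<n = ℕ.<-≤-trans (ℕ.+-monoˡ-< (h ℕ.* d) w<d) (ℕ.*-monoˡ-≤ d h<n)

-- The Gauss formula for the product over all parameters

module GaussTotals {p : ℕ} (p-prime : Prime p) {q : ℕ} {F : FiniteField q c ℓ}
  (Z : UnramifiedIntegers p F c′ ℓ′) (Γₚ : MoritaGamma p-prime)
  (n d : ℕ) .{{n≢0 : NonZero n}} .{{d≢0 : NonZero d}} .{{L≢0 : NonZero (n ℕ.* d)}} (p∤L : ¬ p ∣ n ℕ.* d) where

  private
    L = n ℕ.* d

    p∤n : ¬ p ∣ n
    p∤n p∣n = p∤L (ℕ.∣m⇒∣m*n d p∣n)

  open PAdic p-prime using (morita; p^≢0; coprime-p^)
  open MoritaProduct p-prime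
  open Approximation p-prime Z Γₚ
  open GammaValues L p∤L
  private module Z = UnramifiedIntegers Z
  open CommutativeRing Z.commutativeRing
  open FiniteSums *-commutativeMonoid using () renaming (∑< to ∏<)

  -- As `L = n d`, this is Γₚ of the fractional part of `z / d`, the value that the Gauss formula
  -- sets against the `n` translates.
  γₙ : ℤ → Carrier
  γₙ z = γ (+ n ℤ.* z)

  γ-translates : ℤ → Carrier
  γ-translates z = ∏< n (λ l → γ (z ℤ.+ + (l ℕ.* d)))

  module _ (r : ℕ) {m : ℕ} (A B : Fin m → ℤ)
    (invariance : ∀ w t →
      ∑ℤ (λ i → ρ L (w ℤ.* (+ n ℤ.* A i) ℤ.+ t)) ℤ.+ ∑ℤ (λ i → ρ L (w ℤ.* (+ p ℤ.* (+ n ℤ.* B i)) ℤ.+ t)) ≡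
      ∑ℤ (λ i → ρ L (w ℤ.* (+ n ℤ.* B i) ℤ.+ t)) ℤ.+ ∑ℤ (λ i → ρ L (w ℤ.* (+ p ℤ.* (+ n ℤ.* A i)) ℤ.+ t)))
    (t : ℤ) (period : (+ p) ℤ.^ r ℤ.* (+ n ℤ.* t) ≋ + n ℤ.* t [ L ]) where

    open Total p r A B *-commutativeMonoid

    private
      module Precision (K : ℕ) where

        -- The second summand is the precision at which values of Γₚ are known modulo p^K; the first
        -- makes p^K divide `P`.
        M = K ℕ.+ proj₁ (γ-approximation K)
        P = p ℕ.^ suc M

        instance
          P≢0 : NonZero P
          P≢0 = p^≢0 (suc M)

        approximation : ∀ x → x ℕ.< L → ∀ N → + N ℤ.* + L ≋ + x [ P ] → Represents K (γ₀ x) (morita N)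
        approximation = proj₂ (γ-approximation K) (suc M) (ℕ.m≤n⇒m≤1+n (ℕ.m≤n+m _ K))

        L⁻¹ = inverse L P (coprime-p^ p∤L (suc M))
        n⁻¹ = inverse n P (coprime-p^ p∤n (suc M))
        p⁻¹ : ∃ λ v → v ℤ.* + p ≋ + 1 [ L ]
        p⁻¹ = inverseMod p⊥L , ≋-trans (≋-reflexive (ℤ.*-comm _ (+ p))) (congruent (inverseMod-correct p⊥L))
          where
          p⊥L : ℕ.Coprime p L
          p⊥L (f∣p , f∣L) = coprime-p^ p∤L 1 (f∣L , ≡.subst (_ ∣_) (≡.sym (ℕ.*-identityʳ p)) f∣p)

        n-inv : + n ℤ.* + proj₁ n⁻¹ ≋ + 1 [ P ]
        n-inv = congruent (proj₂ n⁻¹)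

        open ExponentSums p-prime L p∤L (proj₁ p⁻¹) (proj₂ p⁻¹) r (λ i → + n ℤ.* A i) (λ i → + n ℤ.* B i) invariance
        open Approximants M (proj₁ L⁻¹) (congruent (proj₂ L⁻¹))

        CM = ≋-*-commutativeMonoid P
        module CM = Total p r A B CM
        open FiniteSums CM using () renaming (∑< to ∏ℤ<)

        N : ℤ → ℕ
        N z = approximant (+ n ℤ.* z)

        divideP : ℕ → ℕ
        divideP = divide M n p∤n (proj₁ n⁻¹) n-inv

        a b : ℤ → ℤ
        a z = ∏ℤ< n (λ h → morita (divideP (N z ℕ.+ h)))
        b z = morita (N z)
        g = ∏ℤ< n (λ h → morita (divideP h))

        γₙ-represented : ∀ z → Represents K (γₙ z) (b z)
        γₙ-represented z = approximation ((+ n ℤ.* z) ℤ.%ℕ L) (ℤ.n%ℕd<d (+ n ℤ.* z) L) (N z) (approximant-correct (+ n ℤ.* z))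

        -- With `w` the residue of `z` modulo `d`, the arguments are `(w + h d) / L = (X + h) / n`
        -- for `X = w / d`. As `N z` approximates `X`, dividing `N z + h` by `n` modulo `P`
        -- approximates them.
        γ-translates-represented : ∀ z → Represents K (γ-translates z) (a z)
        γ-translates-represented z = π-trans
          (π-reflexive (Translates.sum-translates-% *-commutativeMonoid n d {γ} (reflexive ∘ γ-cong) z))
          (sum-related {M = *-commutativeMonoid} {CM} (Represents K) represents-1
            (λ {x} {x′} {y} {y′} → represents-* {K} {x} {y} {x′} {y′}) n (λ h → single (toℕ h) (Fin.toℕ<n h)))
          where
          w = z ℤ.%ℕ d
          reorder : ∀ n s L → n ℤ.* (s ℤ.* L) ≡ n ℤ.* s ℤ.* L
          reorder = solve-∀
          expand : ∀ N h L → (N ℤ.+ h) ℤ.* L ≡ N ℤ.* L ℤ.+ h ℤ.* L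
          expand = solve-∀
          collect : ∀ n w h d → n ℤ.* w ℤ.+ h ℤ.* (n ℤ.* d) ≡ n ℤ.* (w ℤ.+ h ℤ.* d)
          collect = solve-∀
          correct : ∀ h → + divideP (N z ℕ.+ h) ℤ.* + L ≋ + (w ℕ.+ h ℕ.* d) [ P ]
          correct h = ≋-cancel (unit-∤ (suc M) p∤n) (≋-trans (≋-reflexive (reorder (+ n) (+ divideP (N z ℕ.+ h)) (+ L)))
            (≋-trans (≋-*ʳ (+ L) (n*divide M n p∤n (proj₁ n⁻¹) n-inv (N z ℕ.+ h)))
              (≋-trans (≋-reflexive (expand (+ N z) (+ h) (+ L)))
                (≋-trans (≋-+ {y = + h ℤ.* + L} (approximant-correct (+ n ℤ.* z)) ≋-refl)
                  (≋-reflexive (≡.trans (≡.cong₂ (λ x y → x ℤ.+ + h ℤ.* y)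
                      (≡.trans (≡.cong +_ (ρ-multiple n d z)) (ℤ.pos-* n w)) (ℤ.pos-* n d))
                    (≡.trans (collect (+ n) (+ w) (+ h) (+ d)) (≡.cong (λ s → + n ℤ.* (+ w ℤ.+ s)) (≡.sym (ℤ.pos-* h d))))))))))
          single : ∀ h → h ℕ.< n → Represents K (γ (+ w ℤ.+ + (h ℕ.* d))) (morita (divideP (N z ℕ.+ h)))
          single h h<n = ≡.subst (λ x → Represents K (γ₀ x) (morita (divideP (N z ℕ.+ h)))) (≡.sym (ℕ.m<n⇒m%n≡m small))
            (approximation (w ℕ.+ h ℕ.* d) small (divideP (N z ℕ.+ h)) (correct h))
            where
            small = w+hd<nd {n} {d} {w} {h} (ℤ.n%ℕd<d z d) h<n

        count : ℤ → ℕ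
        count z = unitCount (N z)

        totalN : ℤ → ℕ
        totalN = Total.total p r A B ℕ.+-0-commutativeMonoid count

        totalN≡ : ∀ t → totalN t ≡ totalCount (+ n ℤ.* t)
        totalN≡ t = sum-related {M = ℕ.+-0-commutativeMonoid} {ℕ.+-0-commutativeMonoid} _≡_ ≡.refl (≡.cong₂ ℕ._+_) r
          (λ k → sum-related {M = ℕ.+-0-commutativeMonoid} {ℕ.+-0-commutativeMonoid} _≡_ ≡.refl (≡.cong₂ ℕ._+_) m
            (λ i → ≡.cong₂ ℕ._+_ (≡.cong (unitCount ∘ approximant) (lem (+ n) ((+ p) ℤ.^ toℕ k) (A i) t))
                                 (≡.cong (unitCount ∘ approximant) (lem (+ n) ((+ p) ℤ.^ toℕ k) t (B i)))))
          where
          lem : ∀ n q a t → n ℤ.* (q ℤ.* (a ℤ.- t)) ≡ q ℤ.* (n ℤ.* a ℤ.- n ℤ.* t)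
          lem = solve-∀

        powers : (+ n) ℤ.^ totalN t ≋ (+ n) ℤ.^ totalN (+ 0) [ P ]
        powers = ≋-trans (≋-reflexive (≡.cong ((+ n) ℤ.^_) (totalN≡ t)))
          (≋-trans (power-totalCount n p∤n (+ n ℤ.* t) period)
            (≋-reflexive (≡.cong ((+ n) ℤ.^_) (≡.trans (≡.cong totalCount (≡.sym (ℤ.*-zeroʳ (+ n)))) (≡.sym (totalN≡ (+ 0)))))))

        gauss-at : ∀ t → CM.total a t ℤ.* (+ n) ℤ.^ totalN t ≋ CM.total (λ _ → g) (+ 0) ℤ.* CM.total b t [ P ]
        gauss-at t = ≋-trans (≋-*ˡ (CM.total a t) power)
          (≋-trans (≋-sym (CM.total-∙ a (λ z → (+ n) ℤ.^ count z) t))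
            (≋-trans (total-related p r A B CM CM (λ x y → x ≋ y [ P ]) ≋-refl ≋-* (λ z → a z ℤ.* (+ n) ℤ.^ count z) (λ z → g ℤ.* b z) t
                (λ z → gauss M n p∤n (proj₁ n⁻¹) n-inv (N z)))
              (CM.total-∙ (λ _ → g) b t)))
          where
          power : (+ n) ℤ.^ totalN t ≋ CM.total (λ z → (+ n) ℤ.^ count z) t [ P ]
          power = total-related p r A B ℕ.+-0-commutativeMonoid CM (λ x y → (+ n) ℤ.^ x ≋ y [ P ]) ≋-refl
            (λ {x} {x′} {y} {y′} eq eq′ → ≋-trans (≋-reflexive (ℤ.^-distribˡ-+-* (+ n) x y)) (≋-* eq eq′))
            count (λ z → (+ n) ℤ.^ count z) t (λ z → ≋-refl)

        -- The Gauss formulas at `t` and at 0 are multiplied crosswise. They share the constant `g`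
        -- to the same power, which is carried from one to the other; only the power of `n`, a unit,
        -- is cancelled.
        totals : CM.total a t ℤ.* CM.total b (+ 0) ≋ CM.total a (+ 0) ℤ.* CM.total b t [ P ]
        totals = ≋-cancel (unit-^ (totalN (+ 0)) (unit-∤ (suc M) p∤n))
          (≋-trans (≋-reflexive (lem₁ (CM.total a t) (CM.total b (+ 0)) _))
            (≋-trans (≋-*ʳ (CM.total b (+ 0)) (≋-trans (≋-*ˡ (CM.total a t) (≋-sym powers)) (gauss-at t)))
              (≋-trans (≋-reflexive (lem₂ (CM.total (λ _ → g) (+ 0)) (CM.total b t) (CM.total b (+ 0))))
                (≋-trans (≋-*ʳ (CM.total b t) (≋-sym (gauss-at (+ 0))))
                  (≋-reflexive (lem₃ (CM.total a (+ 0)) (CM.total b t) _))))))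
          where
          lem₁ : ∀ a b e → e ℤ.* (a ℤ.* b) ≡ a ℤ.* e ℤ.* b
          lem₁ = solve-∀
          lem₂ : ∀ g b b′ → g ℤ.* b ℤ.* b′ ≡ g ℤ.* b′ ℤ.* b
          lem₂ = solve-∀
          lem₃ : ∀ a b e → a ℤ.* e ℤ.* b ≡ e ℤ.* (a ℤ.* b)
          lem₃ = solve-∀

        represented : ∀ (φ : ℤ → Carrier) (ψ : ℤ → ℤ) t → (∀ z → Represents K (φ z) (ψ z)) → Represents K (total φ t) (CM.total ψ t)
        represented φ ψ t = total-related p r A B *-commutativeMonoid CM (Represents K) represents-1
          (λ {x} {x′} {y} {y′} → represents-* {K} {x} {y} {x′} {y′}) φ ψ t

        congruence : total γ-translates t * total γₙ (+ 0) ≈ total γ-translates (+ 0) * total γₙ t [π^ K ]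
        congruence = represents-unique {a = CM.total a t ℤ.* CM.total b (+ 0)}
          (represents-* {K} {total γ-translates t} {total γₙ (+ 0)} {CM.total a t} {CM.total b (+ 0)}
            (represented γ-translates a t γ-translates-represented) (represented γₙ b (+ 0) γₙ-represented))
          (represents-≋ {K} (≋-sym (≋-weaken p^K∣P totals))
            (represents-* {K} {total γ-translates (+ 0)} {total γₙ t} {CM.total a (+ 0)} {CM.total b t}
              (represented γ-translates a (+ 0) γ-translates-represented) (represented γₙ b t γₙ-represented)))
          where
          p^K∣P : p ℕ.^ K ∣ P
          p^K∣P = ≡.subst (p ℕ.^ K ∣_) (≡.trans (≡.sym (ℕ.^-distribˡ-+-* p K _)) (≡.cong (p ℕ.^_) (ℕ.+-suc K _)))
            (ℕ.m∣m*n (p ℕ.^ suc (proj₁ (γ-approximation K))))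

    -- The congruence holds modulo every p^K, and the ring is separated.
    gauss-total : total γ-translates t * total γₙ (+ 0) ≈ total γ-translates (+ 0) * total γₙ t
    gauss-total = ≈-from-representatives _ _ Precision.congruence

-- The summands of the hypergeometric function

pos-^ : ∀ p k → + (p ℕ.^ k) ≡ (+ p) ℤ.^ k
pos-^ p zero    = ≡.refl
pos-^ p (suc k) = ≡.trans (ℤ.pos-* p (p ℕ.^ k)) (≡.cong (+ p ℤ.*_) (pos-^ p k))

module TotalTranslates (M : CommutativeMonoid c ℓ) (n d : ℕ) .{{n≢0 : NonZero n}} .{{d≢0 : NonZero d}}
  {φ : ℤ → CommutativeMonoid.Carrier M}
  (φ-cong : ∀ {x y} → x ≋ y [ n ℕ.* d ] → CommutativeMonoid._≈_ M (φ x) (φ y))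
  (p r : ℕ) (p^⊥n : ∀ k → ℕ.Coprime (p ℕ.^ k) n) {m : ℕ} (A B : Fin m → ℤ) where
  open CommutativeMonoid M
  open FiniteSums M
  open Translates M n d {φ} φ-cong
  open SetoidReasoning setoid

  translate : (Fin m → ℤ) → Fin (n ℕ.* m) → ℤ
  translate A = Vector.concat (λ (l : Fin n) i → A i ℤ.+ + (toℕ l ℕ.* d))

  φ-translates : ℤ → Carrier
  φ-translates z = ∑< n (λ l → φ (z ℤ.+ + (l ℕ.* d)))

  private
    sum₊ : ∀ k a t → ∑< n (λ l → φ ((+ p) ℤ.^ k ℤ.* ((a ℤ.+ + (l ℕ.* d)) ℤ.- t))) ≈ φ-translates ((+ p) ℤ.^ k ℤ.* (a ℤ.- t))
    sum₊ k a t = ≡.subst (λ u → ∑< n (λ l → φ (u ℤ.* ((a ℤ.+ + (l ℕ.* d)) ℤ.- t))) ≈ φ-translates (u ℤ.* (a ℤ.- t))) (pos-^ p k)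
      (trans (∑<-cong n {λ l → φ (+ u ℤ.* ((a ℤ.+ + (l ℕ.* d)) ℤ.- t))} {λ l → φ (+ u ℤ.* ((a ℤ.- t) ℤ.+ + (l ℕ.* d)))}
               (λ l _ → reflexive (≡.cong (λ s → φ (+ u ℤ.* s)) (lem a (+ (l ℕ.* d)) t))))
             (sum-translates-* u (p^⊥n k) (a ℤ.- t)))
      where
      u = p ℕ.^ k
      lem : ∀ a l t → (a ℤ.+ l) ℤ.- t ≡ (a ℤ.- t) ℤ.+ l
      lem = solve-∀

    -- Since n - 1 ≡ -1 modulo n, negating l is multiplying it by n - 1.
    sum₋ : ∀ k b t → ∑< n (λ l → φ ((+ p) ℤ.^ k ℤ.* (t ℤ.- (b ℤ.+ + (l ℕ.* d))))) ≈ φ-translates ((+ p) ℤ.^ k ℤ.* (t ℤ.- b))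
    sum₋ k b t = trans
      (∑<-cong n {λ l → φ (q ℤ.* (t ℤ.- (b ℤ.+ + (l ℕ.* d))))} {λ l → translated (q ℤ.* (t ℤ.- b)) (u ℕ.* l)} (λ l _ → φ-cong (shifted l)))
      (∑<-*-permute n u (ℕ.sym (coprime-*ʳ (ℕ.sym (p^⊥n k)) (ℕ.sym (coprime-pred n)))) (translated-periodic (q ℤ.* (t ℤ.- b))))
      where
      q = (+ p) ℤ.^ k
      u = p ℕ.^ k ℕ.* (n ℕ.∸ 1)
      lem : ∀ q t b l d n → q ℤ.* (t ℤ.- b) ℤ.+ q ℤ.* (n ℤ.- + 1) ℤ.* l ℤ.* d ≡ q ℤ.* (t ℤ.- (b ℤ.+ l ℤ.* d)) ℤ.+ (n ℤ.* d) ℤ.* (q ℤ.* l)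
      lem = solve-∀
      pos-u : ∀ l → + (u ℕ.* l ℕ.* d) ≡ q ℤ.* (+ n ℤ.- + 1) ℤ.* + l ℤ.* + d
      pos-u l = ≡.trans (ℤ.pos-* (u ℕ.* l) d) (≡.cong (ℤ._* + d) (≡.trans (ℤ.pos-* u l) (≡.cong (ℤ._* + l)
        (≡.trans (ℤ.pos-* (p ℕ.^ k) (n ℕ.∸ 1)) (≡.cong₂ ℤ._*_ (pos-^ p k)
          (≡.sym (≡.trans (ℤ.m-n≡m⊖n n 1) (ℤ.⊖-≥ (ℕ.>-nonZero⁻¹ n)))))))))
      shifted : ∀ l → q ℤ.* (t ℤ.- (b ℤ.+ + (l ℕ.* d))) ≋ q ℤ.* (t ℤ.- b) ℤ.+ + (u ℕ.* l ℕ.* d) [ n ℕ.* d ]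
      shifted l = ≋-sym (≋-trans (≋-reflexive (≡.trans (≡.cong (ℤ._+_ (q ℤ.* (t ℤ.- b))) (pos-u l)) (≡.trans (lem q t b (+ l) (+ d) (+ n))
          (≡.cong₂ (λ x y → q ℤ.* (t ℤ.- (b ℤ.+ x)) ℤ.+ y ℤ.* (q ℤ.* + l)) (≡.sym (ℤ.pos-* l d)) (≡.sym (ℤ.pos-* n d))))))
        (≋-+d* (q ℤ.* (t ℤ.- (b ℤ.+ + (l ℕ.* d)))) (q ℤ.* + l)))

  total-translates : ∀ t → Total.total p r (translate A) (translate B) M φ t ≈ Total.total p r A B M φ-translates t
  total-translates t = ∑<-cong r {λ k → sum {n ℕ.* m} (Total.term p r (translate A) (translate B) M φ t k)} {λ k → sum {m} (Total.term p r A B M φ-translates t k)} λ k _ → begin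
    sum {n ℕ.* m} (Total.term p r (translate A) (translate B) M φ t k)
      ≈⟨ sum-concat n (λ l i → A i ℤ.+ + (toℕ l ℕ.* d) , B i ℤ.+ + (toℕ l ℕ.* d))
           (λ (a , b) → φ ((+ p) ℤ.^ k ℤ.* (a ℤ.- t)) ∙ φ ((+ p) ℤ.^ k ℤ.* (t ℤ.- b))) ⟩
    sum {n} (λ l → sum {m} (λ i → f k i (toℕ l) ∙ g k i (toℕ l)))
      ≈⟨ ∑-comm {n} {m} (λ l i → f k i (toℕ l) ∙ g k i (toℕ l)) ⟩
    sum {m} (λ i → sum {n} (λ l → f k i (toℕ l) ∙ g k i (toℕ l)))
      ≈⟨ sum-cong-≋ {m} (λ i → trans (∑-distrib-+ {n} (f k i ∘ toℕ) (g k i ∘ toℕ)) (∙-cong (sum₊ k (A i) t) (sum₋ k (B i) t))) ⟩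
    sum {m} (Total.term p r A B M φ-translates t k) ∎
    where
    f g : ℕ → Fin m → ℕ → Carrier
    f k i l = φ ((+ p) ℤ.^ k ℤ.* ((A i ℤ.+ + (l ℕ.* d)) ℤ.- t))
    g k i l = φ ((+ p) ℤ.^ k ℤ.* (t ℤ.- (B i ℤ.+ + (l ℕ.* d))))

module IntegerPowers (M : CommutativeMonoid c ℓ) where
  open CommutativeMonoid M
  open MonoidMult monoid using () renaming (_×_ to _·_; ×-homo-+ to ·-homo-+)
  open SetoidReasoning setoid

  module _ (x y : Carrier) (x∙y≈ε : x ∙ y ≈ ε) where

    power : ℤ → Carrier
    power (+ k)    = k · x
    power -[1+ k ] = suc k · y

    private
      power-⊖ : ∀ a b → power (a ℤ.⊖ b) ≈ a · x ∙ b · y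
      power-⊖ a       zero    = trans (reflexive (≡.cong power (ℤ.⊖-≥ (ℕ.z≤n {a})))) (sym (identityʳ _))
      power-⊖ zero    (suc b) = sym (identityˡ _)
      power-⊖ (suc a) (suc b) = begin
        power (suc a ℤ.⊖ suc b)             ≡⟨ ≡.cong power (ℤ.[1+m]⊖[1+n]≡m⊖n a b) ⟩
        power (a ℤ.⊖ b)                     ≈⟨ power-⊖ a b ⟩
        a · x ∙ b · y                       ≈⟨ identityˡ _ ⟨
        ε ∙ (a · x ∙ b · y)                 ≈⟨ ∙-congʳ x∙y≈ε ⟨
        (x ∙ y) ∙ (a · x ∙ b · y)           ≈⟨ interchange x y (a · x) (b · y) ⟩
        (x ∙ a · x) ∙ (y ∙ b · y)           ∎
        where
        open CommutativeMonoidSolver M using (solve; _⊕_; _⊜_)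
        interchange : ∀ a b c d → (a ∙ b) ∙ (c ∙ d) ≈ (a ∙ c) ∙ (b ∙ d)
        interchange = solve 4 (λ a b c d → (a ⊕ b) ⊕ (c ⊕ d) ⊜ (a ⊕ c) ⊕ (b ⊕ d)) refl

    power-+ : ∀ i j → power (i ℤ.+ j) ≈ power i ∙ power j
    power-+ (+ a)    (+ b)    = ·-homo-+ x a b
    power-+ (+ a)    -[1+ b ] = power-⊖ a (suc b)
    power-+ -[1+ a ] (+ b)    = trans (power-⊖ b (suc a)) (comm _ _)
    power-+ -[1+ a ] -[1+ b ] = trans (reflexive (≡.cong (λ k → suc k · y) (≡.sym (ℕ.+-suc a b)))) (·-homo-+ y (suc a) (suc b))

module _ {L : ℕ} .{{_ : NonZero L}} where

  /ℕ-*L : ∀ z → (z ℤ./ℕ L) ℤ.* + L ≡ z ℤ.- ρ L z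
  /ℕ-*L z = ≡.trans (lem (ρ L z) ((z ℤ./ℕ L) ℤ.* + L)) (≡.cong (ℤ._- ρ L z) (≡.sym (ℤ.a≡a%ℕn+[a/ℕn]*n z L)))
    where
    lem : ∀ r t → t ≡ (r ℤ.+ t) ℤ.- r
    lem = solve-∀

  /ℕ-ρ-shift : ∀ y s → ((ρ L y ℤ.+ s) ℤ./ℕ L) ℤ.* + L ≡ ρ L y ℤ.+ s ℤ.- ρ L (y ℤ.+ s)
  /ℕ-ρ-shift y s = ≡.trans (/ℕ-*L (ρ L y ℤ.+ s)) (≡.cong (λ x → ρ L y ℤ.+ s ℤ.- x) (ρ-cong L (≋-+ {y = s} (%ℕ-≋ y L) ≋-refl)))

module FactorProduct {p : ℕ} (p-prime : Prime p) {r : ℕ} .{{r≢0 : NonZero r}}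
  {F : FiniteField (p ℕ.^ r) c ℓ} (Z : UnramifiedIntegers p F c′ ℓ′)
  (ω : TeichmüllerCharacter Z) (Γₚ : MoritaGamma p-prime) where

  private
    module F = FiniteField F
    module Z = UnramifiedIntegers Z
    N = p ℕ.^ r ℕ.∸ 1
  open Hypergeometric p-prime Z ω Γₚ using (factor)
  open TeichmüllerCharacter ω using (ω̄^)
  open Z.Fractions using (embed)
  open CommutativeRing Z.fractionField
  open RawSemiringDefs (Semiring.rawSemiring semiring) using (_^_; sum; product)

  sum-≗ : ∀ {k} {f g : Fin k → Carrier} → (∀ i → f i ≡ g i) → sum f ≡ sum g
  sum-≗ {zero}  eq = ≡.refl
  sum-≗ {suc k} eq = ≡.cong₂ _+_ (eq Fin.zero) (sum-≗ (eq ∘ Fin.suc))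

  private
    factors : {m : ℕ} → Vector ℚ m → Vector ℚ m → ℕ → Carrier
    factors {m} a b j = product λ (i : Fin m) → product λ (k : Fin r) → factor (a i) (b i) j (toℕ k)

    c₀ = - embed (Z.unitInverse (Z.fromℕ N))

    G-unfolded : ∀ m (a b : Vector ℚ m) x → Hypergeometric.G p-prime {r} Z ω Γₚ m a b x ≡
      c₀ * sum λ (j : Fin N) → (- 1#) ^ (toℕ j ℕ.* m) * embed (ω̄^ (toℕ j) x) *
        product λ (i : Fin m) → product λ (k : Fin r) → factor (a i) (b i) (toℕ j) (toℕ k)
    G-unfolded m a b x = ≡.refl

  abstract
    -- Opaque, like `hypergeometric` below, so that comparing sums does not unfold the quotients of
    -- values of Γₚ.
    factorProduct : {m : ℕ} → Vector ℚ m → Vector ℚ m → ℕ → Carrier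
    factorProduct = factors

    factorProduct-value : ∀ {m} (a b : Vector ℚ m) j →
      factorProduct a b j ≡ product λ (i : Fin m) → product λ (k : Fin r) → factor (a i) (b i) j (toℕ k)
    factorProduct-value a b j = ≡.refl

    hypergeometric : (m : ℕ) → Vector ℚ m → Vector ℚ m → F.Carrier → Carrier
    hypergeometric = Hypergeometric.G p-prime {r} Z ω Γₚ

    hypergeometric-value : ∀ m (a b : Vector ℚ m) x → hypergeometric m a b x ≡ Hypergeometric.G p-prime {r} Z ω Γₚ m a b x
    hypergeometric-value m a b x = ≡.refl

  hypergeometric-formula : ∀ m (a b : Vector ℚ m) x → hypergeometric m a b x ≡
    c₀ * sum λ (j : Fin N) → (- 1#) ^ (toℕ j ℕ.* m) * embed (ω̄^ (toℕ j) x) * factorProduct a b (toℕ j)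
  hypergeometric-formula m a b x = ≡.trans (hypergeometric-value m a b x) (≡.trans (G-unfolded m a b x)
    (≡.cong (c₀ *_) (sum-≗ {N} (λ j → ≡.cong ((- 1#) ^ (toℕ j ℕ.* m) * embed (ω̄^ (toℕ j) x) *_) (≡.sym (factorProduct-value a b (toℕ j)))))))

  sum-hypergeometric : ∀ n m (a b : Vector ℚ m) (x : Fin n → F.Carrier) →
    sum (λ l → hypergeometric m a b (x l)) ≡ sum (λ l → Hypergeometric.G p-prime {r} Z ω Γₚ m a b (x l))
  sum-hypergeometric n m a b x = sum-≗ {n} (λ l → hypergeometric-value m a b (x l))

module Factors {p : ℕ} (p-prime : Prime p) {r : ℕ} .{{r≢0 : NonZero r}}
  {F : FiniteField (p ℕ.^ r) c ℓ} (Z : UnramifiedIntegers p F c′ ℓ′)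
  (ω : TeichmüllerCharacter Z) (Γₚ : MoritaGamma p-prime)
  (L : ℕ) .{{L≢0 : NonZero L}} (p∤L : ¬ p ∣ L)
  (W : ℕ) .{{q-1≢0 : NonZero (p ℕ.^ r ℕ.∸ 1)}} (L≡ : W ℕ.* (p ℕ.^ r ℕ.∸ 1) ≡ L) where

  private q = p ℕ.^ r

  open Hypergeometric p-prime Z ω Γₚ
  open Approximation p-prime Z Γₚ using (module GammaValues)
  open UnitInverses Z
  open GammaValues L p∤L
  open Fractions L
  private
    module Z = UnramifiedIntegers Z
    module Zᵣ = CommutativeRing Z.commutativeRing
  open Z.Fractions using (embed; cross)
  open CommutativeRing Z.fractionField

  embed-cong : ∀ {x y} → x Zᵣ.≈ y → embed x ≈ embed y
  embed-cong eq = cross (Zᵣ.*-congˡ eq)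

  embed-* : ∀ x y → embed (x Zᵣ.* y) ≈ embed x * embed y
  embed-* x y = refl

  Γ-ratio : ∀ {x y} X Y → x ≡ frac (+ X) → y ≡ frac (+ Y) → Γ[ x ]/Γ[ y ] ≡ embed (γ₀ X Zᵣ.* Z.unitInverse (γ₀ Y))
  Γ-ratio X Y ≡.refl ≡.refl = ≡.cong₂ (λ x y → embed (x Zᵣ.* Z.unitInverse y)) (≡.sym (γ₀-value X)) (≡.sym (γ₀-value Y))

  private
    j/[q-1]≡ : ∀ j → + j ℚ./ (q ℕ.∸ 1) ≡ frac (+ (j ℕ.* W))
    j/[q-1]≡ j = frac-≡ (+ j) (q ℕ.∸ 1) (+ (j ℕ.* W)) L
      (≡.trans (≡.cong (λ l → + j ℤ.* + l) (≡.sym L≡)) (≡.trans (≡.cong (+ j ℤ.*_) (ℤ.pos-* W (q ℕ.∸ 1)))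
        (≡.trans (≡.sym (ℤ.*-assoc (+ j) (+ W) (+ (q ℕ.∸ 1)))) (≡.cong (ℤ._* + (q ℕ.∸ 1)) (≡.sym (ℤ.pos-* j W))))))

    *pᵏ : ∀ k z → frac z ℚ.* ℕ→ℚ (p ℕ.^ k) ≡ frac ((+ p) ℤ.^ k ℤ.* z)
    *pᵏ k z = ≡.trans (frac-*ℤ z (+ (p ℕ.^ k))) (≡.cong frac (≡.trans (ℤ.*-comm z _) (≡.cong (ℤ._* z) (pos-^ p k))))

  module _ (A B : ℤ) (j k : ℕ) where
    private
      t = + (j ℕ.* W)
      q^k = (+ p) ℤ.^ k
      J = + j ℚ./ (q ℕ.∸ 1)
      pᵏ = ℕ→ℚ (p ℕ.^ k)

      zA zB zA₀ zB₀ : ℤ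
      zA  = q^k ℤ.* (A ℤ.- t)
      zB  = q^k ℤ.* (t ℤ.- B)
      zA₀ = q^k ℤ.* (A ℤ.- + 0)
      zB₀ = q^k ℤ.* (+ 0 ℤ.- B)

      eqA : (frac A ℚ.- J) ℚ.* pᵏ ≡ frac zA
      eqA = ≡.trans (≡.cong (λ s → (frac A ℚ.- s) ℚ.* pᵏ) (j/[q-1]≡ j)) (≡.trans (≡.cong (λ s → (frac A ℚ.+ s) ℚ.* pᵏ) (neg-frac t))
        (≡.trans (≡.cong (ℚ._* pᵏ) (+-frac A (ℤ.- t))) (*pᵏ k (A ℤ.- t))))

      eqB : (ℚ.- frac B ℚ.+ J) ℚ.* pᵏ ≡ frac zB
      eqB = ≡.trans (≡.cong (λ s → (ℚ.- frac B ℚ.+ s) ℚ.* pᵏ) (j/[q-1]≡ j)) (≡.trans (≡.cong (λ s → (s ℚ.+ frac t) ℚ.* pᵏ) (neg-frac B))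
        (≡.trans (≡.cong (ℚ._* pᵏ) (≡.trans (+-frac (ℤ.- B) t) (≡.cong frac (ℤ.+-comm (ℤ.- B) t)))) (*pᵏ k (t ℤ.- B))))

      eqA₀ : frac A ℚ.* pᵏ ≡ frac zA₀
      eqA₀ = ≡.trans (*pᵏ k A) (≡.cong (λ s → frac (q^k ℤ.* s)) (≡.sym (ℤ.+-identityʳ A)))

      eqB₀ : ℚ.- frac B ℚ.* pᵏ ≡ frac zB₀
      eqB₀ = ≡.trans (≡.cong (ℚ._* pᵏ) (neg-frac B)) (≡.trans (*pᵏ k (ℤ.- B)) (≡.cong (λ s → frac (q^k ℤ.* s)) (≡.sym (ℤ.+-identityˡ (ℤ.- B)))))

      eqJ : J ℚ.* pᵏ ≡ frac (q^k ℤ.* t)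
      eqJ = ≡.trans (≡.cong (ℚ._* pᵏ) (j/[q-1]≡ j)) (*pᵏ k t)

      fractional : ∀ {x} z → x ≡ frac z → ⟨ x ⟩ ≡ frac (+ (z ℤ.%ℕ L))
      fractional z eq = ≡.trans (≡.cong ⟨_⟩ eq) (⟨frac⟩ z)

      floorA : floor (⟨ frac A ℚ.* pᵏ ⟩ ℚ.- J ℚ.* pᵏ) ≡ (ρ L zA₀ ℤ.+ ℤ.- (q^k ℤ.* t)) ℤ./ℕ L
      floorA = ≡.trans (≡.cong₂ (λ x y → floor (x ℚ.- y)) (fractional zA₀ eqA₀) eqJ)
        (≡.trans (≡.cong (λ s → floor (frac (ρ L zA₀) ℚ.+ s)) (neg-frac (q^k ℤ.* t)))
          (≡.trans (≡.cong floor (+-frac (ρ L zA₀) (ℤ.- (q^k ℤ.* t)))) (⌊frac⌋ (ρ L zA₀ ℤ.+ ℤ.- (q^k ℤ.* t)))))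

      floorB : floor (⟨ ℚ.- frac B ℚ.* pᵏ ⟩ ℚ.+ J ℚ.* pᵏ) ≡ (ρ L zB₀ ℤ.+ q^k ℤ.* t) ℤ./ℕ L
      floorB = ≡.trans (≡.cong₂ (λ x y → floor (x ℚ.+ y)) (fractional zB₀ eqB₀) eqJ)
        (≡.trans (≡.cong floor (+-frac (ρ L zB₀) (q^k ℤ.* t))) (⌊frac⌋ (ρ L zB₀ ℤ.+ q^k ℤ.* t)))

    unitPart : Zᵣ.Carrier
    unitPart = (γ zA Zᵣ.* Z.unitInverse (γ zA₀)) Zᵣ.* (γ zB Zᵣ.* Z.unitInverse (γ zB₀))

    exponent : ℤ
    exponent = ℤ.- ((ρ L zA₀ ℤ.+ ℤ.- (q^k ℤ.* t)) ℤ./ℕ L) ℤ.- ((ρ L zB₀ ℤ.+ q^k ℤ.* t) ℤ./ℕ L)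

    factor-formula : ∀ {a b} → a ≡ frac A → b ≡ frac B → factor a b j k ≡ embed unitPart * Z.[-p]^ exponent
    factor-formula ≡.refl ≡.refl = ≡.cong₂ _*_
      (≡.cong₂ _*_ (Γ-ratio (zA ℤ.%ℕ L) (zA₀ ℤ.%ℕ L) (fractional zA eqA) (fractional zA₀ eqA₀))
                   (Γ-ratio (zB ℤ.%ℕ L) (zB₀ ℤ.%ℕ L) (fractional zB eqB) (fractional zB₀ eqB₀)))
      (≡.cong₂ (λ x y → Z.[-p]^ (ℤ.- x ℤ.- y)) floorA floorB)

    -- Cleared of denominators, the unit part enters the argument only through totals of `γ`, for
    -- which the Gauss formula is available.
    unitPart-* : unitPart Zᵣ.* (γ zA₀ Zᵣ.* γ zB₀) Zᵣ.≈ γ zA Zᵣ.* γ zB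
    unitPart-* = Zᵣ.trans (rearrange (γ zA) (Z.unitInverse (γ zA₀)) (γ zB) (Z.unitInverse (γ zB₀)) (γ zA₀) (γ zB₀))
      (Zᵣ.trans (Zᵣ.*-cong (Zᵣ.*-congˡ (unitInverse-inverse (γ zA₀) (γ-unit zA₀))) (Zᵣ.*-congˡ (unitInverse-inverse (γ zB₀) (γ-unit zB₀))))
        (Zᵣ.*-cong (Zᵣ.*-identityʳ _) (Zᵣ.*-identityʳ _)))
      where
      open NaturalCoefficients Zᵣ.commutativeSemiring using (solve; _:=_; _:*_)
      rearrange : ∀ a u b v x y → ((a Zᵣ.* u) Zᵣ.* (b Zᵣ.* v)) Zᵣ.* (x Zᵣ.* y) Zᵣ.≈ (a Zᵣ.* (x Zᵣ.* u)) Zᵣ.* (b Zᵣ.* (y Zᵣ.* v))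
      rearrange = solve 6 (λ a u b v x y → (((a :* u) :* (b :* v)) :* (x :* y)) := ((a :* (x :* u)) :* (b :* (y :* v)))) Zᵣ.refl

    -- Each floor times `L` is a difference of residues plus its own shift, and the shifts by
    -- `- p^k t` and `p^k t` cancel.
    exponent-* : exponent ℤ.* + L ≡ (ρ L zA ℤ.+ ρ L zB) ℤ.- (ρ L zA₀ ℤ.+ ρ L zB₀)
    exponent-* = ≡.trans (distribute ((ρ L zA₀ ℤ.+ ℤ.- (q^k ℤ.* t)) ℤ./ℕ L) ((ρ L zB₀ ℤ.+ q^k ℤ.* t) ℤ./ℕ L) (+ L))
      (≡.trans (≡.cong₂ (λ x y → ℤ.- x ℤ.- y)
          (≡.trans (/ℕ-ρ-shift zA₀ (ℤ.- (q^k ℤ.* t))) (≡.cong (λ s → ρ L zA₀ ℤ.+ ℤ.- (q^k ℤ.* t) ℤ.- ρ L s) (shiftA q^k A t)))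
          (≡.trans (/ℕ-ρ-shift zB₀ (q^k ℤ.* t)) (≡.cong (λ s → ρ L zB₀ ℤ.+ q^k ℤ.* t ℤ.- ρ L s) (shiftB q^k B t))))
        (collect (ρ L zA₀) (ρ L zB₀) (ρ L zA) (ρ L zB) (q^k ℤ.* t)))
      where
      distribute : ∀ x y l → (ℤ.- x ℤ.- y) ℤ.* l ≡ ℤ.- (x ℤ.* l) ℤ.- (y ℤ.* l)
      distribute = solve-∀
      shiftA : ∀ q a t → q ℤ.* (a ℤ.- + 0) ℤ.+ ℤ.- (q ℤ.* t) ≡ q ℤ.* (a ℤ.- t)
      shiftA = solve-∀
      shiftB : ∀ q b t → q ℤ.* (+ 0 ℤ.- b) ℤ.+ q ℤ.* t ≡ q ℤ.* (t ℤ.- b)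
      shiftB = solve-∀
      collect : ∀ a₀ b₀ a b s → ℤ.- (a₀ ℤ.+ ℤ.- s ℤ.- a) ℤ.- (b₀ ℤ.+ s ℤ.- b) ≡ (a ℤ.+ b) ℤ.- (a₀ ℤ.+ b₀)
      collect = solve-∀

module FactorProducts {p : ℕ} (p-prime : Prime p) {r : ℕ} .{{r≢0 : NonZero r}}
  {F : FiniteField (p ℕ.^ r) c ℓ} (Z : UnramifiedIntegers p F c′ ℓ′)
  (ω : TeichmüllerCharacter Z) (Γₚ : MoritaGamma p-prime)
  (L : ℕ) .{{L≢0 : NonZero L}} (p∤L : ¬ p ∣ L)
  (W : ℕ) .{{q-1≢0 : NonZero (p ℕ.^ r ℕ.∸ 1)}} (L≡ : W ℕ.* (p ℕ.^ r ℕ.∸ 1) ≡ L) where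

  private q = p ℕ.^ r

  open Hypergeometric p-prime Z ω Γₚ using (factor)
  open Factors p-prime Z ω Γₚ L p∤L W L≡
  open FactorProduct p-prime Z ω Γₚ using (factorProduct; factorProduct-value)
  open Approximation p-prime Z Γₚ using (module GammaValues)
  open UnitInverses Z
  open GammaValues L p∤L
  open Fractions L
  private
    module Z = UnramifiedIntegers Z
    module Zᵣ = CommutativeRing Z.commutativeRing
    module ∏Z = FiniteSums Zᵣ.*-commutativeMonoid
  open PolynomialFunctions Z.commutativeRing using (IsUnit; isUnit-*; isUnit-1; isUnit-cancel)
  open Z.Fractions using (embed; cross)
  open CommutativeRing Z.fractionField
  private
    module ∏K = FiniteSums *-commutativeMonoid
    module Powers = IntegerPowers *-commutativeMonoid
  open SetoidReasoning setoid

  [-p]^-+ : ∀ i j → Z.[-p]^ (i ℤ.+ j) ≈ Z.[-p]^ i * Z.[-p]^ j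
  [-p]^-+ i j = trans (same (i ℤ.+ j)) (trans (Powers.power-+ x y inverses i j) (sym (*-cong (same i) (same j))))
    where
    x = embed (Zᵣ.- Z.fromℕ p)
    y = Z.Fractions.⊟ Z.Fractions.s⁻¹
    inverses : x * y ≈ 1#
    inverses = cross (Zᵣ.trans (Zᵣ.*-identityˡ _) (Zᵣ.trans (negatives (Z.fromℕ p) Zᵣ.1#)
      (Zᵣ.sym (Zᵣ.*-identityʳ (Z.fromℕ p Zᵣ.* Zᵣ.1#)))))
      where
      open RingProperties Zᵣ.ring using (-‿distribˡ-*; -‿distribʳ-*; -‿involutive)
      negatives : ∀ x y → Zᵣ.- x Zᵣ.* Zᵣ.- y Zᵣ.≈ x Zᵣ.* y
      negatives x y = Zᵣ.trans (Zᵣ.sym (-‿distribˡ-* x (Zᵣ.- y))) (Zᵣ.trans (Zᵣ.-‿cong (Zᵣ.sym (-‿distribʳ-* x y))) (-‿involutive (x Zᵣ.* y)))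
    same : ∀ i → Z.[-p]^ i ≈ Powers.power x y inverses i
    same (+ k)    = refl
    same -[1+ k ] = refl

  module _ {m : ℕ} (A B : Fin m → ℤ) where

    open Total p r A B using (total)

    totalZ : (ℤ → Zᵣ.Carrier) → ℤ → Zᵣ.Carrier
    totalZ = total Zᵣ.*-commutativeMonoid

    totalℤ : (ℤ → ℤ) → ℤ → ℤ
    totalℤ = total ℤ.+-0-commutativeMonoid

    units : ℕ → Zᵣ.Carrier
    units j = ∏Z.∑< r (λ k → ∏Z.sum {m} (λ i → unitPart (A i) (B i) j k))

    exponents : ℕ → ℤ
    exponents j = ∑ℤ.∑< r (λ k → ∑ℤ {m} (λ i → exponent (A i) (B i) j k))

    units-* : ∀ j → units j Zᵣ.* totalZ γ (+ 0) Zᵣ.≈ totalZ γ (+ (j ℕ.* W))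
    units-* j = Zᵣ.trans (Zᵣ.sym (∏Z.∑-distrib-+ {r} u v))
      (∏Z.sum-cong-≋ {r} (λ k → Zᵣ.trans
        (Zᵣ.sym (∏Z.∑-distrib-+ {m} (λ i → unitPart (A i) (B i) j (toℕ k)) (Total.term p r A B Zᵣ.*-commutativeMonoid γ (+ 0) (toℕ k))))
        (∏Z.sum-cong-≋ {m} (λ i → unitPart-* (A i) (B i) j (toℕ k)))))
      where
      u v : Fin r → Zᵣ.Carrier
      u k = ∏Z.sum {m} (λ i → unitPart (A i) (B i) j (toℕ k))
      v k = ∏Z.sum {m} (Total.term p r A B Zᵣ.*-commutativeMonoid γ (+ 0) (toℕ k))

    exponents-* : ∀ j → exponents j ℤ.* + L ≡ totalℤ (ρ L) (+ (j ℕ.* W)) ℤ.- totalℤ (ρ L) (+ 0)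
    exponents-* j = related r _ _ _ (λ k → related m (λ i → exponent (A i) (B i) j (toℕ k)) _ _ (λ i → exponent-* (A i) (B i) j (toℕ k)))
      where
      lem : ∀ x y l → (x ℤ.+ y) ℤ.* l ≡ x ℤ.* l ℤ.+ y ℤ.* l
      lem = solve-∀
      regroup : ∀ x y z w → (x ℤ.- y) ℤ.+ (z ℤ.- w) ≡ (x ℤ.+ z) ℤ.- (y ℤ.+ w)
      regroup = solve-∀
      related : ∀ n (e f g : Fin n → ℤ) → (∀ i → e i ℤ.* + L ≡ f i ℤ.- g i) → ∑ℤ e ℤ.* + L ≡ ∑ℤ f ℤ.- ∑ℤ g
      related zero    e f g eq = ≡.refl
      related (suc n) e f g eq = ≡.trans (lem (e Fin.zero) (∑ℤ (e ∘ Fin.suc)) (+ L))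
        (≡.trans (≡.cong₂ ℤ._+_ (eq Fin.zero) (related n (e ∘ Fin.suc) (f ∘ Fin.suc) (g ∘ Fin.suc) (eq ∘ Fin.suc)))
          (regroup (f Fin.zero) (g Fin.zero) (∑ℤ (f ∘ Fin.suc)) (∑ℤ (g ∘ Fin.suc))))

    totalZ-isUnit : ∀ t → IsUnit (totalZ γ t)
    totalZ-isUnit t = closed r (λ k → ∏Z.sum {m} (term k)) (λ k → closed m (term k) (λ i → isUnit-*
      (γ-isUnit ((+ p) ℤ.^ toℕ k ℤ.* (A i ℤ.- t))) (γ-isUnit ((+ p) ℤ.^ toℕ k ℤ.* (t ℤ.- B i)))))
      where
      term : Fin r → Fin m → Zᵣ.Carrier
      term k = Total.term p r A B Zᵣ.*-commutativeMonoid γ t (toℕ k)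
      γ-isUnit : ∀ z → IsUnit (γ z)
      γ-isUnit z = Z.unitInverse (γ z) , Zᵣ.trans (Zᵣ.*-comm _ _) (unitInverse-inverse (γ z) (γ-unit z))
      closed : ∀ n (f : Fin n → Zᵣ.Carrier) → (∀ i → IsUnit (f i)) → IsUnit (∏Z.sum f)
      closed zero    f u = isUnit-1
      closed (suc n) f u = isUnit-* (u Fin.zero) (closed n (f ∘ Fin.suc) (u ∘ Fin.suc))

    factors-formula : ∀ {a b} → (∀ i → a i ≡ frac (A i)) → (∀ i → b i ≡ frac (B i)) →
                      ∀ j → factorProduct a b j ≈ embed (units j) * Z.[-p]^ (exponents j)
    factors-formula {a} {b} a≡ b≡ j = begin
      factorProduct a b j
        ≡⟨ factorProduct-value a b j ⟩
      ∏K.sum {m} (λ i → ∏K.sum {r} (λ k → factor (a i) (b i) j (toℕ k)))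
        ≈⟨ ∏K.∑-comm {m} {r} (λ i k → factor (a i) (b i) j (toℕ k)) ⟩
      ∏K.sum {r} (λ k → ∏K.sum {m} (λ i → factor (a i) (b i) j (toℕ k)))
        ≈⟨ ∏K.sum-cong-≋ {r} (λ k → trans
             (∏K.sum-cong-≋ {m} (λ i → reflexive (factor-formula (A i) (B i) j (toℕ k) (a≡ i) (b≡ i))))
             (collect m (λ i → unitPart (A i) (B i) j (toℕ k)) (λ i → exponent (A i) (B i) j (toℕ k)))) ⟩
      ∏K.sum {r} (λ k → embed (∏Z.sum {m} (λ i → unitPart (A i) (B i) j (toℕ k))) * Z.[-p]^ (∑ℤ {m} (λ i → exponent (A i) (B i) j (toℕ k))))
        ≈⟨ collect r (λ k → ∏Z.sum {m} (λ i → unitPart (A i) (B i) j (toℕ k))) (λ k → ∑ℤ {m} (λ i → exponent (A i) (B i) j (toℕ k))) ⟩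
      embed (units j) * Z.[-p]^ (exponents j) ∎
      where
      open NaturalCoefficients commutativeSemiring using (solve; _:=_; _:*_)
      interchange : ∀ a b c d → (a * b) * (c * d) ≈ (a * c) * (b * d)
      interchange = solve 4 (λ a b c d → ((a :* b) :* (c :* d)) := ((a :* c) :* (b :* d))) refl
      collect : ∀ n (u : Fin n → Zᵣ.Carrier) (e : Fin n → ℤ) →
                ∏K.sum {n} (λ i → embed (u i) * Z.[-p]^ (e i)) ≈ embed (∏Z.sum u) * Z.[-p]^ (∑ℤ e)
      collect zero    u e = sym (*-identityˡ 1#)
      collect (suc n) u e = trans (*-congˡ (collect n (u ∘ Fin.suc) (e ∘ Fin.suc)))
        (trans (interchange (embed (u Fin.zero)) (Z.[-p]^ (e Fin.zero)) (embed (∏Z.sum (u ∘ Fin.suc))) (Z.[-p]^ (∑ℤ (e ∘ Fin.suc))))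
          (*-cong (sym (embed-* (u Fin.zero) (∏Z.sum (u ∘ Fin.suc)))) (sym ([-p]^-+ (e Fin.zero) (∑ℤ (e ∘ Fin.suc))))))

    exponents-unique : ∀ {e e′} → e ℤ.* + L ≡ e′ ℤ.* + L → e ≡ e′
    exponents-unique {e} {e′} = ℤ.*-cancelʳ-≡ e e′ (+ L) {{L≢0}}

    -- Unit part and exponent are determined by totals at `t = j W`, and adding `q - 1` to `j` adds
    -- `W (q - 1) = L` to `t`.
    factors-periodic : ∀ {a b} → (∀ i → a i ≡ frac (A i)) → (∀ i → b i ≡ frac (B i)) →
                       ∀ j → factorProduct a b (q ℕ.∸ 1 ℕ.+ j) ≈ factorProduct a b j
    factors-periodic a≡ b≡ j = trans (factors-formula a≡ b≡ (q ℕ.∸ 1 ℕ.+ j)) (trans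
      (*-cong (embed-cong same-units) (reflexive (≡.cong Z.[-p]^ same-exponents)))
      (sym (factors-formula a≡ b≡ j)))
      where
      j′ = q ℕ.∸ 1 ℕ.+ j
      shifted : + (j′ ℕ.* W) ≋ + (j ℕ.* W) [ L ]
      shifted = ≋-trans (≋-reflexive (≡.cong +_ (≡.trans (ℕ.*-distribʳ-+ W (q ℕ.∸ 1) j) (≡.cong (ℕ._+ j ℕ.* W) (≡.trans (ℕ.*-comm (q ℕ.∸ 1) W) L≡)))))
        (≋-trans (≋-+ {y = + (j ℕ.* W)} (∣⇒≋0 ℕ.∣-refl) ≋-refl) (≋-reflexive (ℤ.+-identityˡ (+ (j ℕ.* W)))))
      total-shifted : ∀ {c ℓ} (M : CommutativeMonoid c ℓ) (φ : ℤ → CommutativeMonoid.Carrier M) → (∀ {x y} → x ≋ y [ L ] → φ x ≡ φ y) →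
                      total M φ (+ (j′ ℕ.* W)) ≡ total M φ (+ (j ℕ.* W))
      total-shifted M φ φ-cong = Sum.sum-cong-≗ M {r} (λ k → Sum.sum-cong-≗ M {m} (λ i → ≡.cong₂ (CommutativeMonoid._∙_ M)
        (φ-cong (≋-*ˡ ((+ p) ℤ.^ toℕ k) (≋-+ {x = A i} ≋-refl (≋-neg shifted))))
        (φ-cong (≋-*ˡ ((+ p) ℤ.^ toℕ k) (≋-+ {y = ℤ.- B i} shifted ≋-refl)))))
      same-units : units j′ Zᵣ.≈ units j
      same-units = isUnit-cancel (totalZ-isUnit (+ 0)) (Zᵣ.trans (Zᵣ.*-comm _ _) (Zᵣ.trans (units-* j′)
        (Zᵣ.trans (Zᵣ.reflexive (total-shifted Zᵣ.*-commutativeMonoid γ γ-cong)) (Zᵣ.trans (Zᵣ.sym (units-* j)) (Zᵣ.*-comm _ _)))))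
      same-exponents : exponents j′ ≡ exponents j
      same-exponents = exponents-unique (≡.trans (exponents-* j′)
        (≡.trans (≡.cong (ℤ._- totalℤ (ρ L) (+ 0)) (total-shifted ℤ.+-0-commutativeMonoid (ρ L) (ρ-cong L))) (≡.sym (exponents-* j))))

module FactorMultiplication {p : ℕ} (p-prime : Prime p) {r : ℕ} .{{r≢0 : NonZero r}}
  {F : FiniteField (p ℕ.^ r) c ℓ} (Z : UnramifiedIntegers p F c′ ℓ′)
  (ω : TeichmüllerCharacter Z) (Γₚ : MoritaGamma p-prime)
  (n d : ℕ) .{{n≢0 : NonZero n}} .{{d≢0 : NonZero d}} .{{L≢0 : NonZero (n ℕ.* d)}} (p∤L : ¬ p ∣ n ℕ.* d)
  (W : ℕ) .{{q-1≢0 : NonZero (p ℕ.^ r ℕ.∸ 1)}} (L≡ : W ℕ.* (p ℕ.^ r ℕ.∸ 1) ≡ n ℕ.* d) where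

  private
    q = p ℕ.^ r
    L = n ℕ.* d
    module Z = UnramifiedIntegers Z
    module Zᵣ = CommutativeRing Z.commutativeRing
    module ∏Z = FiniteSums Zᵣ.*-commutativeMonoid

  open Factors p-prime Z ω Γₚ L p∤L W L≡ using (embed-cong)
  open FactorProduct p-prime Z ω Γₚ using (factorProduct)
  open FactorProducts p-prime Z ω Γₚ L p∤L W L≡
  open Approximation p-prime Z Γₚ using (module GammaValues)
  open GammaValues L p∤L
  open GaussTotals p-prime Z Γₚ n d p∤L
  open Fractions L
  open PolynomialFunctions Z.commutativeRing using (isUnit-*; isUnit-cancel; isUnit-cong)
  open CommutativeRing Z.fractionField

  translate : {m : ℕ} → (Fin m → ℤ) → Fin (n ℕ.* m) → ℤ
  translate A = Vector.concat (λ (l : Fin n) i → A i ℤ.+ + (toℕ l ℕ.* d))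

  module _ {m : ℕ} (a : Vector ℚ m) (A : Fin m → ℤ) (a≡ : ∀ i → a i ≡ frac (A i)) where

    multiples≡ : ∀ i → multiples n {m} a i ≡ frac (+ n ℤ.* A i)
    multiples≡ i = ≡.trans (≡.cong (ℕ→ℚ n ℚ.*_) (a≡ i)) (ℤ*-frac (+ n) (A i))

    translates≡ : ∀ I → translates n {m} a I ≡ frac (translate A I)
    translates≡ I = pointwise (proj₂ (Fin.quotRem {n} m I)) (proj₁ (Fin.quotRem {n} m I))
      where
      pointwise : ∀ (l : Fin n) i → a i ℚ.+ + toℕ l ℚ./ n ≡ frac (A i ℤ.+ + (toℕ l ℕ.* d))
      pointwise l i = ≡.trans (≡.cong₂ ℚ._+_ (a≡ i) (frac-≡ (+ toℕ l) n (+ (toℕ l ℕ.* d)) L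
          (≡.trans (≡.sym (ℤ.pos-* (toℕ l) L)) (≡.trans (≡.cong +_ (lem (toℕ l))) (ℤ.pos-* (toℕ l ℕ.* d) n)))))
        (+-frac (A i) (+ (toℕ l ℕ.* d)))
        where
        lem : ∀ l → l ℕ.* (n ℕ.* d) ≡ l ℕ.* d ℕ.* n
        lem l = ≡.trans (≡.cong (l ℕ.*_) (ℕ.*-comm n d)) (≡.sym (ℕ.*-assoc l d n))

  module _ {m : ℕ} (a b : Vector ℚ m) (A B : Fin m → ℤ)
    (a≡ : ∀ i → a i ≡ frac (A i)) (b≡ : ∀ i → b i ≡ frac (B i))
    (invariance : ∀ w t →
      ∑ℤ (λ i → ρ L (w ℤ.* (+ n ℤ.* A i) ℤ.+ t)) ℤ.+ ∑ℤ (λ i → ρ L (w ℤ.* (+ p ℤ.* (+ n ℤ.* B i)) ℤ.+ t)) ≡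
      ∑ℤ (λ i → ρ L (w ℤ.* (+ n ℤ.* B i) ℤ.+ t)) ℤ.+ ∑ℤ (λ i → ρ L (w ℤ.* (+ p ℤ.* (+ n ℤ.* A i)) ℤ.+ t))) where

    private
      p^⊥n : ∀ k → ℕ.Coprime (p ℕ.^ k) n
      p^⊥n k = ℕ.sym (PAdic.coprime-p^ p-prime (λ p∣n → p∤L (ℕ.∣m⇒∣m*n d p∣n)) k)

      nA nB : Fin m → ℤ
      nA i = + n ℤ.* A i
      nB i = + n ℤ.* B i

    private
      total-multiples : ∀ {c ℓ} (M : CommutativeMonoid c ℓ) (φ : ℤ → CommutativeMonoid.Carrier M) t →
        Total.total p r nA nB M φ (+ n ℤ.* t) ≡ Total.total p r A B M (λ z → φ (+ n ℤ.* z)) t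
      total-multiples M φ t = Sum.sum-cong-≗ M {r} (λ k → Sum.sum-cong-≗ M {m} (λ i →
        ≡.cong₂ (λ x y → CommutativeMonoid._∙_ M (φ x) (φ y)) (lem (+ n) ((+ p) ℤ.^ toℕ k) (A i) t) (lem (+ n) ((+ p) ℤ.^ toℕ k) t (B i))))
        where
        lem : ∀ n q a t → q ℤ.* (n ℤ.* a ℤ.- n ℤ.* t) ≡ n ℤ.* (q ℤ.* (a ℤ.- t))
        lem = solve-∀

      n*0≡0 : + n ℤ.* + 0 ≡ + 0
      n*0≡0 = ℤ.*-zeroʳ (+ n)

      module _ (j : ℕ) where
        t = + (j ℕ.* W)

        njW : + (n ℕ.* j ℕ.* W) ≡ + n ℤ.* t
        njW = ≡.trans (≡.cong +_ (ℕ.*-assoc n j W)) (ℤ.pos-* n (j ℕ.* W))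

        -- The difference of the two sides is `(q - 1) n j W`, that is, `n j L`.
        period : (+ p) ℤ.^ r ℤ.* (+ n ℤ.* t) ≋ + n ℤ.* t [ L ]
        period = congruent (Signed.divides (+ n ℤ.* + j) (≡.trans (≡.cong (λ x → x ℤ.* (+ n ℤ.* t) ℤ.- + n ℤ.* t) q≡)
          (≡.trans (≡.cong (λ x → (+ 1 ℤ.+ + (q ℕ.∸ 1)) ℤ.* (+ n ℤ.* x) ℤ.- + n ℤ.* x) (ℤ.pos-* j W))
            (≡.trans (lem (+ (q ℕ.∸ 1)) (+ n) (+ j) (+ W)) (≡.cong (+ n ℤ.* + j ℤ.*_) (≡.trans (≡.sym (ℤ.pos-* W (q ℕ.∸ 1))) (≡.cong +_ L≡)))))))
          where
          q≡ : (+ p) ℤ.^ r ≡ + 1 ℤ.+ + (q ℕ.∸ 1)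
          q≡ = ≡.trans (≡.sym (pos-^ p r)) (≡.cong +_ (≡.sym (ℕ.suc-pred q {{PAdic.p^≢0 p-prime r}})))
          lem : ∀ e n j w → (+ 1 ℤ.+ e) ℤ.* (n ℤ.* (j ℤ.* w)) ℤ.- n ℤ.* (j ℤ.* w) ≡ n ℤ.* j ℤ.* (w ℤ.* e)
          lem = solve-∀

        u₁ = units (translate A) (translate B) j
        u₂ = units nA nB (n ℕ.* j)

        T₁ T₂ : ℤ → Zᵣ.Carrier
        T₁ = Total.total p r A B Zᵣ.*-commutativeMonoid γ-translates
        T₂ = Total.total p r A B Zᵣ.*-commutativeMonoid γₙ

        total-tr : ∀ t → totalZ (translate A) (translate B) γ t Zᵣ.≈ T₁ t
        total-tr = TotalTranslates.total-translates Zᵣ.*-commutativeMonoid n d {γ} (Zᵣ.reflexive ∘ γ-cong) p r p^⊥n A B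

        u₁-T₁ : u₁ Zᵣ.* T₁ (+ 0) Zᵣ.≈ T₁ t
        u₁-T₁ = Zᵣ.trans (Zᵣ.*-congˡ (Zᵣ.sym (total-tr (+ 0)))) (Zᵣ.trans (units-* (translate A) (translate B) j) (total-tr t))

        u₂-T₂ : u₂ Zᵣ.* T₂ (+ 0) Zᵣ.≈ T₂ t
        u₂-T₂ = Zᵣ.trans (Zᵣ.*-congˡ (Zᵣ.reflexive (≡.trans (≡.sym (total-multiples Zᵣ.*-commutativeMonoid γ (+ 0))) (≡.cong (totalZ nA nB γ) n*0≡0))))
          (Zᵣ.trans (units-* nA nB (n ℕ.* j)) (Zᵣ.reflexive (≡.trans (≡.cong (totalZ nA nB γ) njW) (total-multiples Zᵣ.*-commutativeMonoid γ t))))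

        -- Each unit part is the ratio of its total at `t` to that at 0, and `gauss-total` equates
        -- the two ratios in cross-multiplied form.
        units≈ : u₁ Zᵣ.≈ u₂
        units≈ = isUnit-cancel (isUnit-*
            (isUnit-cong (total-tr (+ 0)) (totalZ-isUnit (translate A) (translate B) (+ 0)))
            (isUnit-cong (Zᵣ.reflexive (≡.trans (≡.cong (totalZ nA nB γ) (≡.sym n*0≡0)) (total-multiples Zᵣ.*-commutativeMonoid γ (+ 0)))) (totalZ-isUnit nA nB (+ 0))))
          (Zᵣ.trans (rearrange₁ u₁ (T₁ (+ 0)) (T₂ (+ 0))) (Zᵣ.trans (Zᵣ.*-congʳ u₁-T₁)
            (Zᵣ.trans (gauss-total r A B invariance t period) (Zᵣ.trans (Zᵣ.*-congˡ (Zᵣ.sym u₂-T₂)) (rearrange₂ u₂ (T₁ (+ 0)) (T₂ (+ 0)))))))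
          where
          open NaturalCoefficients Zᵣ.commutativeSemiring using (solve; _:=_; _:*_)
          rearrange₁ : ∀ u a b → (a Zᵣ.* b) Zᵣ.* u Zᵣ.≈ (u Zᵣ.* a) Zᵣ.* b
          rearrange₁ = solve 3 (λ u a b → ((a :* b) :* u) := ((u :* a) :* b)) Zᵣ.refl
          rearrange₂ : ∀ u a b → a Zᵣ.* (u Zᵣ.* b) Zᵣ.≈ (a Zᵣ.* b) Zᵣ.* u
          rearrange₂ = solve 3 (λ u a b → (a :* (u :* b)) := ((a :* b) :* u)) Zᵣ.refl

        open Total p r A B ℤ.+-0-commutativeMonoid using (total-∙) renaming (total to totalS)

        C : ℤ
        C = ∑ℤ.∑< n (λ l → + (l ℕ.* d))

        -- After `z` is reduced to `w` modulo `d`, all `w + l d` lie below `L` and are their own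
        -- residues. Their sum is `n w + C`, where `n w` is the residue of `n z`; the constant `C`
        -- cancels between `t` and 0.
        ρ-translates : ∀ z → ∑ℤ.∑< n (λ l → ρ L (z ℤ.+ + (l ℕ.* d))) ≡ ρ L (+ n ℤ.* z) ℤ.+ C
        ρ-translates z = ≡.trans (Translates.sum-translates-% ℤ.+-0-commutativeMonoid n d {ρ L} (ρ-cong L) z)
          (≡.trans (∑ℤ.∑<-cong n {λ l → ρ L (+ w ℤ.+ + (l ℕ.* d))} {λ l → + w ℤ.+ + (l ℕ.* d)}
              (λ l l<n → ≡.cong +_ (ℕ.m<n⇒m%n≡m (w+hd<nd {n} {d} {w} {l} (ℤ.n%ℕd<d z d) l<n))))
            (≡.trans (∑ℤ.∑-distrib-+ {n} (λ _ → + w) (λ l → + (toℕ l ℕ.* d)))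
              (≡.cong (ℤ._+ C) (≡.trans (constant n) (≡.trans (≡.sym (ℤ.pos-* n w)) (≡.cong +_ (≡.sym (ρ-multiple n d z))))))))
          where
          w = z ℤ.%ℕ d
          constant : ∀ n → ∑ℤ {n} (λ _ → + w) ≡ + n ℤ.* + w
          constant zero    = ≡.refl
          constant (suc n) = ≡.trans (≡.cong (ℤ._+_ (+ w)) (constant n)) (≡.sym (lem (+ n) (+ w)))
            where
            lem : ∀ n w → (+ 1 ℤ.+ n) ℤ.* w ≡ w ℤ.+ n ℤ.* w
            lem = solve-∀

        total-ρ-tr : ∀ t → totalℤ (translate A) (translate B) (ρ L) t ≡ totalS (λ z → ρ L (+ n ℤ.* z)) t ℤ.+ totalS (λ _ → C) (+ 0)
        total-ρ-tr t = ≡.trans (TotalTranslates.total-translates ℤ.+-0-commutativeMonoid n d {ρ L} (ρ-cong L) p r p^⊥n A B t)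
          (≡.trans (total-related p r A B ℤ.+-0-commutativeMonoid ℤ.+-0-commutativeMonoid _≡_ ≡.refl (≡.cong₂ ℤ._+_)
              (λ z → ∑ℤ.∑< n (λ l → ρ L (z ℤ.+ + (l ℕ.* d)))) (λ z → ρ L (+ n ℤ.* z) ℤ.+ C) t ρ-translates)
            (total-∙ (λ z → ρ L (+ n ℤ.* z)) (λ _ → C) t))

        exponents≡ : exponents (translate A) (translate B) j ≡ exponents nA nB (n ℕ.* j)
        exponents≡ = exponents-unique A B (≡.trans (exponents-* (translate A) (translate B) j)
          (≡.trans (≡.cong₂ ℤ._-_ (total-ρ-tr t) (total-ρ-tr (+ 0)))
            (≡.trans (cancel (totalS (λ z → ρ L (+ n ℤ.* z)) t) (totalS (λ z → ρ L (+ n ℤ.* z)) (+ 0)) (totalS (λ _ → C) (+ 0)))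
              (≡.trans (≡.cong₂ ℤ._-_
                  (≡.trans (≡.sym (total-multiples ℤ.+-0-commutativeMonoid (ρ L) t)) (≡.cong (totalℤ nA nB (ρ L)) (≡.sym njW)))
                  (≡.trans (≡.sym (total-multiples ℤ.+-0-commutativeMonoid (ρ L) (+ 0))) (≡.cong (totalℤ nA nB (ρ L)) n*0≡0)))
                (≡.sym (exponents-* nA nB (n ℕ.* j)))))))
          where
          cancel : ∀ x y c → (x ℤ.+ c) ℤ.- (y ℤ.+ c) ≡ x ℤ.- y
          cancel = solve-∀

    factors-multiplication : ∀ j →
      factorProduct (translates n a) (translates n b) j ≈ factorProduct (multiples n a) (multiples n b) (n ℕ.* j)
    factors-multiplication j = trans (factors-formula (translate A) (translate B) (translates≡ a A a≡) (translates≡ b B b≡) j)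
      (trans (*-cong (embed-cong (units≈ j)) (reflexive (≡.cong Z.[-p]^ (exponents≡ j))))
        (sym (factors-formula nA nB (multiples≡ a A a≡) (multiples≡ b B b≡) (n ℕ.* j))))

-- The Teichmüller character

module GeometricSums (R : CommutativeRing c ℓ) where
  open CommutativeRing R
  open PolynomialFunctions R using (IsUnit; isUnit-cancel-0)
  open RingProperties ring using (x≈y⇒x∙y⁻¹≈ε; -‿distribˡ-*; +-cancelˡ)
  open Exp semiring using (_^_)
  module ∑ = FiniteSums +-commutativeMonoid
  open ∑ using (∑<)
  open SetoidReasoning setoid

  geometric : ∀ w n → 1# + w * ∑< n (w ^_) ≈ ∑< n (w ^_) + w ^ n
  geometric w n = trans (+-congˡ (scale-sum n (λ i → w ^ i))) (∑.∑<-last n (w ^_))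
    where
    scale-sum : ∀ n (f : ℕ → Carrier) → w * ∑< n f ≈ ∑< n (λ i → w * f i)
    scale-sum zero    f = zeroʳ w
    scale-sum (suc n) f = trans (distribˡ w _ _) (+-congˡ (scale-sum n (f ∘ suc)))

  geometric-fixed : ∀ w n → w ^ n ≈ 1# → w * ∑< n (w ^_) ≈ ∑< n (w ^_)
  geometric-fixed w n w^n≈1 = +-cancelˡ 1# _ _ (trans (geometric w n) (trans (+-congˡ w^n≈1) (+-comm _ 1#)))

  geometric-root : ∀ w n → w ^ n ≈ 1# → IsUnit (w - 1#) → ∑< n (w ^_) ≈ 0#
  geometric-root w n w^n≈1 unit = isUnit-cancel-0 unit (begin
    (w - 1#) * S         ≈⟨ distribʳ S w (- 1#) ⟩
    w * S + - 1# * S     ≈⟨ +-congˡ (trans (sym (-‿distribˡ-* 1# S)) (-‿cong (*-identityˡ S))) ⟩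
    w * S - S            ≈⟨ x≈y⇒x∙y⁻¹≈ε (geometric-fixed w n w^n≈1) ⟩
    0#                   ∎)
    where S = ∑< n (w ^_)

module Characters {p r : ℕ} .{{r≢0 : NonZero r}} (p-prime : Prime p)
  {F : FiniteField (p ℕ.^ r) c ℓ} (Z : UnramifiedIntegers p F c′ ℓ′) (ω : TeichmüllerCharacter Z) where

  private
    q = p ℕ.^ r
    N = q ℕ.∸ 1
    module F = FiniteField F
    module Z = UnramifiedIntegers Z
    module F^ = Exp F.semiring
    module F* = CommutativeExp (CommutativeRing.commutativeSemiring F.commutativeRing)
    module ρF = RingMorphisms.IsRingHomomorphism Z.residue-isHom
  open CommutativeRing Z.commutativeRing
  open Z using (fromℕ; residue; unitInverse)
  open UnitInverses Z
  open PolynomialFunctions Z.commutativeRing using (IsUnit; isUnit-cancel)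
  open GeometricSums Z.commutativeRing
  open ∑ using (∑<; ∑<-cong; ∑<-ε)
  open Exp semiring using (_^_; ^-congˡ; ^-congʳ; ^-homo-*; ^-assocʳ)
  open CommutativeExp commutativeSemiring using (^-distrib-*)
  open Mult semiring using (×1-homo-*)
  open NaturalCoefficients commutativeSemiring using (solve; _:=_; _:*_)
  open TeichmüllerCharacter ω using (ω̄^; ω-rootOfUnity; ω-residue) renaming (ω to teichmüller)
  open SetoidReasoning setoid

  private
    suc-N : suc N ≡ q
    suc-N = ℕ.suc-pred q {{PAdic.p^≢0 p-prime r}}

  1^≈1 : ∀ n → 1# ^ n ≈ 1#
  1^≈1 zero    = refl
  1^≈1 (suc n) = trans (*-identityˡ _) (1^≈1 n)

  residue-^ : ∀ x n → residue (x ^ n) F.≈ residue x F.^ n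
  residue-^ x zero    = ρF.1#-homo
  residue-^ x (suc n) = F.trans (ρF.*-homo x (x ^ n)) (F.*-congˡ (residue-^ x n))

  residue-p : residue (fromℕ p) F.≈ F.0#
  residue-p = Equivalence.from (Z.residue-kernel (fromℕ p)) (record { quotient = 1# ; equality = *-identityˡ (fromℕ p) })

  residue-q : residue (fromℕ q) F.≈ F.0#
  residue-q = F.trans (ρF.⟦⟧-cong (reflexive (≡.cong (λ r → fromℕ (p ℕ.^ r)) (≡.sym (ℕ.suc-pred r)))))
    (F.trans (ρF.⟦⟧-cong (×1-homo-* p (p ℕ.^ ℕ.pred r)))
      (F.trans (ρF.*-homo (fromℕ p) _) (F.trans (F.*-congʳ residue-p) (F.zeroˡ _))))

  -- `N + 1 = q` has residue 0, so a vanishing residue of `N` would give `1 = 0`.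
  residue-N : ¬ residue (fromℕ N) F.≈ F.0#
  residue-N N≈0 = F.1≉0 (F.trans (F.sym (F.+-identityʳ F.1#)) (F.trans (F.+-cong (F.sym ρF.1#-homo) (F.sym N≈0))
    (F.trans (F.sym (ρF.+-homo 1# (fromℕ N))) (F.trans (ρF.⟦⟧-cong (reflexive (≡.cong fromℕ suc-N))) residue-q))))

  unitsLift : ∀ x → ¬ residue x F.≈ F.0# → IsUnit x
  unitsLift x x≉0 = proj₁ (Z.unit x x≉0) , trans (*-comm _ x) (proj₂ (Z.unit x x≉0))

  -- The sum `S` of the powers of `w` satisfies `w S = S`. Its residue is that of `N`, hence
  -- nonzero, so `S` is a unit and can be cancelled.
  rootOfUnity-1 : ∀ w → w ^ N ≈ 1# → residue w F.≈ F.1# → w ≈ 1#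
  rootOfUnity-1 w w^N≈1 w≡1 = isUnit-cancel (unitsLift S S≉0)
    (trans (*-comm S w) (trans (geometric-fixed w N w^N≈1) (sym (*-identityʳ S))))
    where
    S = ∑< N (w ^_)
    residue-w^ : ∀ i → residue (w ^ i) F.≈ residue 1#
    residue-w^ zero    = F.refl
    residue-w^ (suc i) = F.trans (ρF.*-homo w (w ^ i)) (F.trans (F.*-cong w≡1 (residue-w^ i)) (F.*-identityˡ _))
    residue-S : residue S F.≈ residue (fromℕ N)
    residue-S = F.trans (sum-related {M = +-commutativeMonoid} {+-commutativeMonoid} (λ x y → residue x F.≈ residue y) F.refl
        (λ {x} {x′} {y} {y′} eq eq′ → F.trans (ρF.+-homo x y) (F.trans (F.+-cong eq eq′) (F.sym (ρF.+-homo x′ y′)))) N (residue-w^ ∘ toℕ))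
      (ρF.⟦⟧-cong (∑.∑<-const N 1#))
    S≉0 : ¬ residue S F.≈ F.0#
    S≉0 S≈0 = residue-N (F.trans (F.sym residue-S) S≈0)

  rootOfUnity-unique : .{{NonZero N}} → ∀ u v → u ^ N ≈ 1# → v ^ N ≈ 1# → residue u F.≈ residue v → u ≈ v
  rootOfUnity-unique u v u^N≈1 v^N≈1 u≡v = begin
    u                  ≈⟨ *-identityʳ u ⟨
    u * 1#             ≈⟨ *-congˡ v*v⁻¹≈1 ⟨
    u * (v * v⁻¹)      ≈⟨ solve 3 (λ a b c → (a :* (b :* c)) := ((a :* c) :* b)) refl u v v⁻¹ ⟩
    u * v⁻¹ * v        ≈⟨ *-congʳ (rootOfUnity-1 (u * v⁻¹) power residue≈1) ⟩
    1# * v             ≈⟨ *-identityˡ v ⟩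
    v                  ∎
    where
    v⁻¹ = v ^ ℕ.pred N
    v*v⁻¹≈1 : v * v⁻¹ ≈ 1#
    v*v⁻¹≈1 = trans (^-congʳ v (ℕ.suc-pred N)) v^N≈1
    power : (u * v⁻¹) ^ N ≈ 1#
    power = begin
      (u * v⁻¹) ^ N            ≈⟨ ^-distrib-* u v⁻¹ N ⟩
      u ^ N * v⁻¹ ^ N          ≈⟨ *-cong u^N≈1 (^-assocʳ v (ℕ.pred N) N) ⟩
      1# * v ^ (ℕ.pred N ℕ.* N) ≈⟨ *-identityˡ _ ⟩
      v ^ (ℕ.pred N ℕ.* N)     ≈⟨ ^-congʳ v (ℕ.*-comm (ℕ.pred N) N) ⟩
      v ^ (N ℕ.* ℕ.pred N)     ≈⟨ ^-assocʳ v N (ℕ.pred N) ⟨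
      (v ^ N) ^ ℕ.pred N       ≈⟨ ^-congˡ (ℕ.pred N) v^N≈1 ⟩
      1# ^ ℕ.pred N            ≈⟨ 1^≈1 (ℕ.pred N) ⟩
      1#                       ∎
    residue≈1 : residue (u * v⁻¹) F.≈ F.1#
    residue≈1 = F.trans (ρF.*-homo u v⁻¹) (F.trans (F.*-congʳ u≡v) (F.trans (F.sym (ρF.*-homo v v⁻¹))
      (F.trans (ρF.⟦⟧-cong v*v⁻¹≈1) ρF.1#-homo)))

  -- τ is the value at x of the inverse of the Teichmüller character.
  record IsValue (x : F.Carrier) (τ : Carrier) : Set (ℓ ⊔ ℓ′) where
    constructor value
    field
      rootOfUnity : τ ^ N ≈ 1#
      inverts     : residue τ F.* x F.≈ F.1#

  isValue-cong : ∀ {x y τ} → x F.≈ y → IsValue x τ → IsValue y τ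
  isValue-cong x≈y (value root inv) = value root (F.trans (F.*-congˡ (F.sym x≈y)) inv)

  isValue-1 : IsValue F.1# 1#
  isValue-1 = value (1^≈1 N) (F.trans (F.*-identityʳ _) ρF.1#-homo)

  isValue-* : ∀ {x y τ σ} → IsValue x τ → IsValue y σ → IsValue (x F.* y) (τ * σ)
  isValue-* {x} {y} {τ} {σ} (value root inv) (value root′ inv′) =
    value (trans (^-distrib-* τ σ N) (trans (*-cong root root′) (*-identityˡ 1#)))
      (F.trans (F.*-congʳ (ρF.*-homo τ σ)) (F.trans (interchange (residue τ) (residue σ) x y) (F.trans (F.*-cong inv inv′) (F.*-identityˡ F.1#))))
    where
    open NaturalCoefficients F.commutativeSemiring using () renaming (solve to solveF; _:=_ to _:=ᶠ_; _:*_ to _:*ᶠ_)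
    interchange : ∀ a b c d → (a F.* b) F.* (c F.* d) F.≈ (a F.* c) F.* (b F.* d)
    interchange = solveF 4 (λ a b c d → ((a :*ᶠ b) :*ᶠ (c :*ᶠ d)) :=ᶠ ((a :*ᶠ c) :*ᶠ (b :*ᶠ d))) F.refl

  isValue-^ : ∀ {x τ} n → IsValue x τ → IsValue (x F.^ n) (τ ^ n)
  isValue-^ zero    v = isValue-1
  isValue-^ (suc n) v = isValue-* v (isValue-^ n v)

  module _ .{{N≢0 : NonZero N}} where

    -- The residue of a value is the inverse of `x`, and roots of unity of order dividing `N` are
    -- determined by their residues. In this way `ω̄^`, although specified pointwise, is seen to be
    -- multiplicative and to respect equality in `F`.
    isValue-unique : ∀ {x τ σ} → IsValue x τ → IsValue x σ → τ ≈ σ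
    isValue-unique {x} {τ} {σ} (value root inv) (value root′ inv′) = rootOfUnity-unique τ σ root root′
      (F.trans (F.sym (F.*-identityʳ _)) (F.trans (F.*-congˡ (F.trans (F.sym inv′) (F.*-comm _ x)))
        (F.trans (F.sym (F.*-assoc _ x _)) (F.trans (F.*-congʳ inv) (F.*-identityˡ _)))))

    ω̄-zero : ∀ j x → x F.≈ F.0# → ω̄^ j x ≈ 0#
    ω̄-zero j x x≈0 with x F.≟ F.0#
    ... | yes _  = refl
    ... | no x≉0 = ⊥-elim (x≉0 x≈0)

    teichmüller-value : ∀ x x≉0 → IsValue x (unitInverse (teichmüller x x≉0))
    teichmüller-value x x≉0 = value
      (trans (sym (trans (*-congʳ (ω-rootOfUnity x x≉0)) (*-identityˡ _)))
        (trans (sym (^-distrib-* ωx u N)) (trans (^-congˡ N inverse-ω) (1^≈1 N))))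
      (F.trans (F.*-congˡ (F.sym (ω-residue x x≉0))) (F.trans (F.sym (ρF.*-homo u ωx))
        (F.trans (ρF.⟦⟧-cong (trans (*-comm u ωx) inverse-ω)) ρF.1#-homo)))
      where
      ωx = teichmüller x x≉0
      u  = unitInverse ωx
      inverse-ω : ωx * u ≈ 1#
      inverse-ω = unitInverse-inverse ωx (λ ωx≈0 → x≉0 (F.trans (F.sym (ω-residue x x≉0)) ωx≈0))

    isValue-exists : ∀ x → ¬ x F.≈ F.0# → ∃ (IsValue x)
    isValue-exists x x≉0 = unitInverse (teichmüller x x≉0) , teichmüller-value x x≉0

    ω̄-value : ∀ {x τ} → IsValue x τ → ∀ j → ω̄^ j x ≈ τ ^ j
    ω̄-value {x} v j with x F.≟ F.0#
    ... | yes x≈0 = ⊥-elim (F.1≉0 (F.trans (F.sym (IsValue.inverts v)) (F.trans (F.*-congˡ x≈0) (F.zeroʳ _))))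
    ... | no x≉0  = ^-congˡ j (isValue-unique (teichmüller-value x x≉0) v)

    ω̄-power : ∀ n .{{_ : NonZero n}} j x → ω̄^ j (x F.^ n) ≈ ω̄^ (n ℕ.* j) x
    ω̄-power n j x = cases (x F.≟ F.0#)
      where
      0^n : ∀ n .{{_ : NonZero n}} → x F.≈ F.0# → x F.^ n F.≈ F.0#
      0^n (suc n) x≈0 = F.trans (F.*-congʳ x≈0) (F.zeroˡ _)
      cases : Dec (x F.≈ F.0#) → ω̄^ j (x F.^ n) ≈ ω̄^ (n ℕ.* j) x
      cases (yes x≈0) = trans (ω̄-zero j (x F.^ n) (0^n n x≈0)) (sym (ω̄-zero (n ℕ.* j) x x≈0))
      cases (no x≉0) with isValue-exists x x≉0
      ... | τ , v = trans (ω̄-value (isValue-^ n v) j) (trans (^-assocʳ τ n j) (sym (ω̄-value v (n ℕ.* j))))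

    ω̄-periodic : ∀ j x → ω̄^ (N ℕ.+ j) x ≈ ω̄^ j x
    ω̄-periodic j x = cases (x F.≟ F.0#)
      where
      cases : Dec (x F.≈ F.0#) → ω̄^ (N ℕ.+ j) x ≈ ω̄^ j x
      cases (yes x≈0) = trans (ω̄-zero (N ℕ.+ j) x x≈0) (sym (ω̄-zero j x x≈0))
      cases (no x≉0) with isValue-exists x x≉0
      ... | τ , v = trans (ω̄-value v (N ℕ.+ j)) (trans (^-homo-* τ N j)
        (trans (*-congʳ (IsValue.rootOfUnity v)) (trans (*-identityˡ _) (sym (ω̄-value v j)))))

    module _ (n : ℕ) .{{n≢0 : NonZero n}} (ζ : F.Carrier) (isPrimitive : F.IsPrimitiveRoot n ζ) where

      private
        ζ≉0 : ¬ ζ F.≈ F.0#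
        ζ≉0 ζ≈0 = F.1≉0 (F.trans (F.sym (proj₁ isPrimitive)) (0^n n))
          where
          0^n : ∀ n .{{_ : NonZero n}} → ζ F.^ n F.≈ F.0#
          0^n (suc n) = F.trans (F.*-congʳ ζ≈0) (F.zeroˡ _)

        τ = proj₁ (isValue-exists ζ ζ≉0)
        τ-value = proj₂ (isValue-exists ζ ζ≉0)

        τ^n≈1 : τ ^ n ≈ 1#
        τ^n≈1 = isValue-unique (isValue-cong (proj₁ isPrimitive) (isValue-^ n τ-value)) isValue-1

        ζ*x≈0 : ∀ {x} l → x F.≈ F.0# → ζ F.^ l F.* x F.≈ F.0#
        ζ*x≈0 l x≈0 = F.trans (F.*-congˡ x≈0) (F.zeroʳ _)

      ω̄-twist : ∀ {x σ} → IsValue x σ → ∀ j l → ω̄^ j (ζ F.^ l F.* x) ≈ (τ ^ j) ^ l * σ ^ j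
      ω̄-twist {x} {σ} v j l = trans (ω̄-value (isValue-* (isValue-^ l τ-value) v) j)
        (trans (^-distrib-* (τ ^ l) σ j) (*-congʳ (trans (^-assocʳ τ l j) (trans (^-congʳ τ (ℕ.*-comm l j)) (sym (^-assocʳ τ j l))))))

      ω̄-twist-∣ : ∀ j l x → n ∣ j → ω̄^ j (ζ F.^ l F.* x) ≈ ω̄^ j x
      ω̄-twist-∣ j l x (ℕ.divides k ≡.refl) = cases (x F.≟ F.0#)
        where
        τ^j≈1 : τ ^ (k ℕ.* n) ≈ 1#
        τ^j≈1 = trans (^-congʳ τ (ℕ.*-comm k n)) (trans (sym (^-assocʳ τ n k)) (trans (^-congˡ k τ^n≈1) (1^≈1 k)))
        cases : Dec (x F.≈ F.0#) → ω̄^ (k ℕ.* n) (ζ F.^ l F.* x) ≈ ω̄^ (k ℕ.* n) x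
        cases (yes x≈0) = trans (ω̄-zero (k ℕ.* n) (ζ F.^ l F.* x) (ζ*x≈0 l x≈0)) (sym (ω̄-zero (k ℕ.* n) x x≈0))
        cases (no x≉0) with isValue-exists x x≉0
        ... | σ , v = trans (ω̄-twist v (k ℕ.* n) l) (trans (*-congʳ (trans (^-congˡ l τ^j≈1) (1^≈1 l)))
          (trans (*-identityˡ _) (sym (ω̄-value v (k ℕ.* n)))))

      -- The sum is geometric with ratio `τ ^ j`, an n-th root of unity. Its residue is the inverse
      -- of `ζ ^ j`, which is not 1, so the ratio minus 1 is a unit and the sum vanishes.
      ω̄-twist-∤ : ∀ j x → ¬ n ∣ j → ∑< n (λ l → ω̄^ j (ζ F.^ l F.* x)) ≈ 0#
      ω̄-twist-∤ j x n∤j = cases (x F.≟ F.0#)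
        where
        η = τ ^ j

        η^n≈1 : η ^ n ≈ 1#
        η^n≈1 = trans (^-assocʳ τ j n) (trans (^-congʳ τ (ℕ.*-comm j n)) (trans (sym (^-assocʳ τ n j)) (trans (^-congˡ j τ^n≈1) (1^≈1 j))))

        1F^ : ∀ k → F.1# F.^ k F.≈ F.1#
        1F^ zero    = F.refl
        1F^ (suc k) = F.trans (F.*-identityˡ _) (1F^ k)

        ζ^j≉1 : ¬ ζ F.^ j F.≈ F.1#
        -- Primitivity speaks of exponents strictly between 0 and `n`. So `j` is reduced modulo `n`,
        -- with positive remainder because `n` does not divide `j`.
        ζ^j≉1 ζ^j≈1 = proj₂ isPrimitive (j ℕ.% n) (ℕ.n≢0⇒n>0 (λ j%n≡0 → n∤j (ℕ.m%n≡0⇒n∣m j n j%n≡0))) (ℕ.m%n<n j n)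
          (F.trans (F.sym (F.*-identityʳ _)) (F.trans (F.*-congˡ (F.sym (F.trans (F^.^-congʳ ζ (ℕ.*-comm (j ℕ./ n) n))
              (F.trans (F.sym (F^.^-assocʳ ζ n (j ℕ./ n))) (F.trans (F^.^-congˡ (j ℕ./ n) (proj₁ isPrimitive)) (1F^ (j ℕ./ n)))))))
            (F.trans (F.sym (F^.^-homo-* ζ (j ℕ.% n) (j ℕ./ n ℕ.* n))) (F.trans (F^.^-congʳ ζ (≡.sym (ℕ.m≡m%n+[m/n]*n j n))) ζ^j≈1))))

        residue-η-1 : ¬ residue (η - 1#) F.≈ F.0#
        residue-η-1 η-1≈0 = ζ^j≉1 (F.trans (F.sym (F.*-identityˡ _)) (F.trans (F.*-congʳ (F.sym residue-η)) (IsValue.inverts (isValue-^ j τ-value))))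
          where
          residue-η : residue η F.≈ F.1#
          residue-η = RingProperties.x∙y⁻¹≈ε⇒x≈y F.ring (residue η) F.1# (F.trans (F.+-congˡ (F.-‿cong (F.sym ρF.1#-homo)))
            (F.trans (F.+-congˡ (F.sym (ρF.-‿homo 1#))) (F.trans (F.sym (ρF.+-homo η (- 1#))) η-1≈0)))

        cases : Dec (x F.≈ F.0#) → ∑< n (λ l → ω̄^ j (ζ F.^ l F.* x)) ≈ 0#
        cases (yes x≈0) = ∑<-ε n (λ l _ → ω̄-zero j (ζ F.^ l F.* x) (ζ*x≈0 l x≈0))
        cases (no x≉0) with isValue-exists x x≉0
        ... | σ , v = begin
          ∑< n (λ l → ω̄^ j (ζ F.^ l F.* x))      ≈⟨ ∑<-cong n {λ l → ω̄^ j (ζ F.^ l F.* x)} {λ l → η ^ l * σ ^ j} (λ l _ → ω̄-twist v j l) ⟩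
          ∑< n (λ l → η ^ l * σ ^ j)             ≈⟨ scaleʳ n (λ l → η ^ l) (σ ^ j) ⟩
          ∑< n (λ l → η ^ l) * σ ^ j             ≈⟨ *-congʳ (geometric-root η n η^n≈1 (unitsLift (η - 1#) residue-η-1)) ⟩
          0# * σ ^ j                             ≈⟨ zeroˡ _ ⟩
          0#                                     ∎
          where
          scaleʳ : ∀ n (f : ℕ → Carrier) y → ∑< n (λ l → f l * y) ≈ ∑< n f * y
          scaleʳ zero    f y = sym (zeroˡ y)
          scaleʳ (suc n) f y = trans (+-congˡ (scaleʳ n (f ∘ suc) y)) (sym (distribʳ y (f 0) _))

-- Summation over the twists

odd-prime-power : ∀ {p} → Prime p → p ≢ 2 → ∀ r → ∃ λ k → p ℕ.^ r ≡ suc (2 ℕ.* k)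
odd-prime-power {p} p-prime p≢2 r = p ℕ.^ r ℕ./ 2 ,
  ≡.trans (ℕ.m≡m%n+[m/n]*n (p ℕ.^ r) 2) (≡.cong₂ ℕ._+_ (remainder (p ℕ.^ r ℕ.% 2) ≡.refl (ℕ.m%n<n (p ℕ.^ r) 2)) (ℕ.*-comm (p ℕ.^ r ℕ./ 2) 2))
  where
  2∤p^ : ∀ r → ¬ 2 ∣ p ℕ.^ r
  2∤p^ zero    2∣1 = ℕ.>⇒∤ (ℕ.s≤s (ℕ.s≤s ℕ.z≤n)) 2∣1
  2∤p^ (suc r) 2∣  = [ (λ 2∣p → [ (λ ()) , (λ 2≡p → p≢2 (≡.sym 2≡p)) ]′ (ℕ.prime⇒irreducible p-prime 2∣p)) , 2∤p^ r ]′
    (ℕ.euclidsLemma p (p ℕ.^ r) ℕ.prime[2] 2∣)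
  remainder : ∀ k → k ≡ p ℕ.^ r ℕ.% 2 → k ℕ.< 2 → p ℕ.^ r ℕ.% 2 ≡ 1
  remainder 0 eq _ = ⊥-elim (2∤p^ r (ℕ.m%n≡0⇒n∣m (p ℕ.^ r) 2 (≡.sym eq)))
  remainder 1 eq _ = ≡.sym eq
  remainder (suc (suc _)) _ (ℕ.s≤s (ℕ.s≤s ()))

prime-power-pred-nonZero : ∀ {p} → Prime p → ∀ r .{{_ : NonZero r}} → NonZero (p ℕ.^ r ℕ.∸ 1)
prime-power-pred-nonZero {p} p-prime (suc r) = ℕ.>-nonZero (ℕ.m<n⇒0<n∸m
  (ℕ.<-≤-trans (ℕ.nonTrivial⇒n>1 p {{ℕ.prime⇒nonTrivial p-prime}}) (ℕ.m≤m*n p (p ℕ.^ r) {{PAdic.p^≢0 p-prime r}})))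

∤-* : ∀ {p} → Prime p → ∀ {x y} → ¬ p ∣ x → ¬ p ∣ y → ¬ p ∣ x ℕ.* y
∤-* p-prime {x} {y} p∤x p∤y p∣xy = [ p∤x , p∤y ]′ (ℕ.euclidsLemma x y p-prime p∣xy)

p∤p^r∸1 : ∀ {p} → Prime p → ∀ r .{{_ : NonZero r}} → ¬ p ∣ p ℕ.^ r ℕ.∸ 1
p∤p^r∸1 {p} p-prime (suc r) p∣ = ℕ.>⇒∤ (ℕ.nonTrivial⇒n>1 p {{ℕ.prime⇒nonTrivial p-prime}})
  (ℕ.∣m+n∣m⇒∣n (≡.subst (p ∣_) (≡.sym (≡.trans (ℕ.+-comm _ 1) (ℕ.suc-pred (p ℕ.^ suc r) {{PAdic.p^≢0 p-prime (suc r)}}))) (ℕ.m∣m*n (p ℕ.^ r))) p∣)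

denominator : {m : ℕ} → Vector ℚ m → ℕ
denominator {zero}  a = 1
denominator {suc m} a = ↧ₙ a Fin.zero ℕ.* denominator (a ∘ Fin.suc)

denominator≢0 : ∀ {m} (a : Vector ℚ m) → NonZero (denominator a)
denominator≢0 {zero}  a = _
denominator≢0 {suc m} a = ℕ.m*n≢0 (↧ₙ a Fin.zero) _ {{_}} {{denominator≢0 (a ∘ Fin.suc)}}

↧∣denominator : ∀ {m} (a : Vector ℚ m) i → ↧ₙ a i ∣ denominator a
↧∣denominator a Fin.zero    = ℕ.m∣m*n _
↧∣denominator a (Fin.suc i) = ℕ.∣n⇒∣m*n (↧ₙ a Fin.zero) (↧∣denominator (a ∘ Fin.suc) i)

∤denominator : ∀ {p} → Prime p → ∀ {m} (a : Vector ℚ m) → (∀ i → pIntegral p (a i)) → ¬ p ∣ denominator a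
∤denominator {p} p-prime {zero}  a integral p∣1 = ℕ.>⇒∤ (ℕ.nonTrivial⇒n>1 p {{ℕ.prime⇒nonTrivial p-prime}}) p∣1
∤denominator p-prime {suc m} a integral = ∤-* p-prime {↧ₙ a Fin.zero} {denominator (a ∘ Fin.suc)} (integral Fin.zero) (∤denominator p-prime (a ∘ Fin.suc) (integral ∘ Fin.suc))

numeratorOver : ∀ L .{{_ : NonZero L}} x → ↧ₙ x ∣ L → ∃ λ A → x ≡ A ℚ./ L
numeratorOver L x (ℕ.divides k L≡k*d) = ↥ x ℤ.* + k , ≡.trans (≡.sym (ℚ.↥p/↧p≡p x)) (frac-≡ (↥ x) (↧ₙ x) (↥ x ℤ.* + k) L
  (≡.trans (≡.cong (λ l → ↥ x ℤ.* + l) L≡k*d) (≡.trans (≡.cong (↥ x ℤ.*_) (ℤ.pos-* k (↧ₙ x))) (≡.sym (ℤ.*-assoc (↥ x) (+ k) (+ ↧ₙ x))))))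

module PeriodicSums (M : CommutativeMonoid c ℓ) where
  open CommutativeMonoid M
  open FiniteSums M
  open SetoidReasoning setoid

  ∑<-head : ∀ n .{{_ : NonZero n}} f → (∀ e → 0 ℕ.< e → e ℕ.< n → f e ≈ ε) → ∑< n f ≈ f 0
  ∑<-head (suc n) f vanishes = trans (∙-congˡ (∑<-ε n (λ e e<n → vanishes (suc e) ℕ.z<s (ℕ.s<s e<n)))) (identityʳ _)

  -- Each side is n times the sum of g over the multiples of n below N = Q n.
  ∑<-multiples : ∀ n .{{_ : NonZero n}} Q {N} → N ≡ Q ℕ.* n → (g h : ℕ → Carrier) →
                 (∀ j → g (N ℕ.+ j) ≈ g j) →
                 (∀ j → n ∣ j → h j ≈ ∑< n (λ _ → g j)) → (∀ j → ¬ n ∣ j → h j ≈ ε) →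
                 ∑< N h ≈ ∑< N (λ j → g (n ℕ.* j))
  ∑<-multiples n Q {N} ≡.refl g h periodic h-∣ h-∤ = begin
    ∑< (Q ℕ.* n) h
      ≈⟨ ∑<-* Q n h ⟩
    ∑< Q (λ i → ∑< n (λ e → h (i ℕ.* n ℕ.+ e)))
      ≈⟨ ∑<-cong Q {λ i → ∑< n (λ e → h (i ℕ.* n ℕ.+ e))} {λ i → ∑< n (λ _ → g′ i)} (λ i _ → block i) ⟩
    ∑< Q (λ i → ∑< n (λ _ → g′ i))
      ≈⟨ ∑-comm {Q} {n} (λ i _ → g′ (toℕ i)) ⟩
    ∑< n (λ _ → ∑< Q g′)
      ≈⟨ ∑<-cong n {λ l → ∑< Q (λ i → g′ (l ℕ.* Q ℕ.+ i))} {λ _ → ∑< Q g′}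
           (λ l _ → ∑<-cong Q {λ i → g′ (l ℕ.* Q ℕ.+ i)} {g′} (λ i _ → periodic-* Q {g′} g′-periodic l i)) ⟨
    ∑< n (λ l → ∑< Q (λ i → g′ (l ℕ.* Q ℕ.+ i)))
      ≈⟨ ∑<-* n Q g′ ⟨
    ∑< (n ℕ.* Q) g′
      ≡⟨ ≡.cong (λ N → ∑< N g′) (ℕ.*-comm n Q) ⟩
    ∑< (Q ℕ.* n) g′ ∎
    where
    g′ : ℕ → Carrier
    g′ i = g (n ℕ.* i)

    g′-periodic : ∀ i → g′ (Q ℕ.+ i) ≈ g′ i
    g′-periodic i = trans (reflexive (≡.cong g (≡.trans (ℕ.*-distribˡ-+ n Q i) (≡.cong (ℕ._+ n ℕ.* i) (ℕ.*-comm n Q))))) (periodic (n ℕ.* i))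

    block : ∀ i → ∑< n (λ e → h (i ℕ.* n ℕ.+ e)) ≈ ∑< n (λ _ → g′ i)
    block i = begin
      ∑< n (λ e → h (i ℕ.* n ℕ.+ e))   ≈⟨ ∑<-head n (λ e → h (i ℕ.* n ℕ.+ e)) (λ e 0<e e<n → h-∤ (i ℕ.* n ℕ.+ e)
                                           (λ n∣ → ℕ.>⇒∤ {{ℕ.>-nonZero 0<e}} e<n (ℕ.∣m+n∣m⇒∣n n∣ (ℕ.n∣m*n i)))) ⟩
      h (i ℕ.* n ℕ.+ 0)                ≡⟨ ≡.cong h (ℕ.+-identityʳ (i ℕ.* n)) ⟩
      h (i ℕ.* n)                      ≈⟨ h-∣ (i ℕ.* n) (ℕ.n∣m*n i) ⟩
      ∑< n (λ _ → g (i ℕ.* n))         ≡⟨ ≡.cong (λ s → ∑< n (λ _ → g s)) (ℕ.*-comm i n) ⟩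
      ∑< n (λ _ → g′ i)                ∎

module TwistedSums (K : CommutativeRing c ℓ) (n : ℕ) .{{n≢0 : NonZero n}} {N : ℕ} (n∣N : n ∣ N) (N-even : 2 ∣ N) (m : ℕ) where
  open CommutativeRing K
  open Exp semiring using (_^_; ^-homo-*; ^-congʳ; ^-congˡ; ^-assocʳ)
  open RingProperties ring using (-‿distribˡ-*; -‿involutive)
  open FiniteSums +-commutativeMonoid
  open PeriodicSums +-commutativeMonoid
  open NaturalCoefficients commutativeSemiring using (solve; _:=_; _:*_)
  open SetoidReasoning setoid

  private
    scale-∑ : ∀ k x (f : ℕ → Carrier) → x * ∑< k f ≈ ∑< k (λ i → x * f i)
    scale-∑ zero    x f = zeroʳ x
    scale-∑ (suc k) x f = trans (distribˡ x (f 0) _) (+-congˡ (scale-∑ k x (f ∘ suc)))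

    1^≈1 : ∀ k → 1# ^ k ≈ 1#
    1^≈1 zero    = refl
    1^≈1 (suc k) = trans (*-identityˡ _) (1^≈1 k)

    -- This is where `q` odd enters: `N` is even, so the sign has period `N` whatever the parity of
    -- `m`.
    sign-periodic : ∀ j → (- 1#) ^ ((N ℕ.+ j) ℕ.* m) ≈ (- 1#) ^ (j ℕ.* m)
    sign-periodic j = begin
      (- 1#) ^ ((N ℕ.+ j) ℕ.* m)                  ≈⟨ ^-congʳ (- 1#) (ℕ.*-distribʳ-+ m N j) ⟩
      (- 1#) ^ (N ℕ.* m ℕ.+ j ℕ.* m)              ≈⟨ ^-homo-* (- 1#) (N ℕ.* m) (j ℕ.* m) ⟩
      (- 1#) ^ (N ℕ.* m) * (- 1#) ^ (j ℕ.* m)     ≈⟨ *-congʳ even ⟩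
      1# * (- 1#) ^ (j ℕ.* m)                     ≈⟨ *-identityˡ _ ⟩
      (- 1#) ^ (j ℕ.* m)                          ∎
      where
      k = ℕ.quotient N-even
      N≡2k : N ≡ 2 ℕ.* k
      N≡2k = ≡.trans (ℕ.m∣n⇒n≡quotient*m N-even) (ℕ.*-comm k 2)
      square : (- 1#) ^ 2 ≈ 1#
      square = trans (*-congˡ (*-identityʳ (- 1#))) (trans (sym (-‿distribˡ-* 1# (- 1#))) (trans (-‿cong (*-identityˡ (- 1#))) (-‿involutive 1#)))
      even : (- 1#) ^ (N ℕ.* m) ≈ 1#
      even = trans (^-congʳ (- 1#) (≡.trans (≡.cong (ℕ._* m) N≡2k) (ℕ.*-assoc 2 k m)))
        (trans (sym (^-assocʳ (- 1#) 2 (k ℕ.* m))) (trans (^-congˡ (k ℕ.* m) square) (1^≈1 (k ℕ.* m))))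

  -- χ j, χₗ l j and χ₁ j are the values of ω̄ʲ at x, ζˡ x and xⁿ.
  module _ (χ χ₁ : ℕ → Carrier) (χₗ : ℕ → ℕ → Carrier)
    (χ-periodic : ∀ j → χ (N ℕ.+ j) ≈ χ j) (χ₁≈χ : ∀ j → χ₁ j ≈ χ (n ℕ.* j))
    (χₗ-∣ : ∀ l j → n ∣ j → χₗ l j ≈ χ j) (χₗ-∤ : ∀ j → ¬ n ∣ j → ∑< n (λ l → χₗ l j) ≈ 0#)
    (f f′ : ℕ → Carrier) (f-periodic : ∀ j → f (N ℕ.+ j) ≈ f j) (f′≈f : ∀ j → f′ j ≈ f (n ℕ.* j)) (c₀ : Carrier) where

    private
      summand : (ℕ → Carrier) → ℕ → Carrier
      summand χ j = (- 1#) ^ (j ℕ.* m) * χ j * f j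

      g h : ℕ → Carrier
      g = summand χ
      h j = ∑< n (λ l → summand (χₗ l) j)

      g-periodic : ∀ j → g (N ℕ.+ j) ≈ g j
      g-periodic j = *-cong (*-cong (sign-periodic j) (χ-periodic j)) (f-periodic j)

      h-∣ : ∀ j → n ∣ j → h j ≈ ∑< n (λ _ → g j)
      h-∣ j n∣j = ∑<-cong n {λ l → summand (χₗ l) j} {λ _ → g j} (λ l _ → *-congʳ (*-congˡ (χₗ-∣ l j n∣j)))

      h-∤ : ∀ j → ¬ n ∣ j → h j ≈ 0#
      h-∤ j n∤j = begin
        h j
          ≈⟨ ∑<-cong n {λ l → summand (χₗ l) j} {λ l → s * f j * χₗ l j}
               (λ l _ → solve 3 (λ s e f → (s :* e :* f) := (s :* f :* e)) refl s (χₗ l j) (f j)) ⟩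
        ∑< n (λ l → s * f j * χₗ l j)        ≈⟨ scale-∑ n (s * f j) (λ l → χₗ l j) ⟨
        s * f j * ∑< n (λ l → χₗ l j)        ≈⟨ *-congˡ (χₗ-∤ j n∤j) ⟩
        s * f j * 0#                         ≈⟨ zeroʳ _ ⟩
        0#                                   ∎
        where s = (- 1#) ^ (j ℕ.* m)

      summand′ : ℕ → Carrier
      summand′ j = (- 1#) ^ (j ℕ.* (n ℕ.* m)) * χ₁ j * f′ j

      g-n* : ∀ j → g (n ℕ.* j) ≈ summand′ j
      g-n* j = *-cong (*-cong (^-congʳ (- 1#) (≡.trans (≡.cong (ℕ._* m) (ℕ.*-comm n j)) (ℕ.*-assoc j n m))) (sym (χ₁≈χ j)))
        (sym (f′≈f j))

    twisted-sum : ∑< n (λ l → c₀ * ∑< N (λ j → (- 1#) ^ (j ℕ.* m) * χₗ l j * f j)) ≈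
                  c₀ * ∑< N (λ j → (- 1#) ^ (j ℕ.* (n ℕ.* m)) * χ₁ j * f′ j)
    twisted-sum = begin
      ∑< n (λ l → c₀ * ∑< N (summand (χₗ l)))
        ≈⟨ scale-∑ n c₀ (λ l → ∑< N (summand (χₗ l))) ⟨
      c₀ * ∑< n (λ l → ∑< N (summand (χₗ l)))
        ≈⟨ *-congˡ (∑-comm {n} {N} (λ l j → summand (χₗ (toℕ l)) (toℕ j))) ⟩
      c₀ * ∑< N h
        ≈⟨ *-congˡ (∑<-multiples n (ℕ.quotient n∣N) (ℕ.m∣n⇒n≡quotient*m n∣N) g h g-periodic h-∣ h-∤) ⟩
      c₀ * ∑< N (λ j → g (n ℕ.* j))
        ≈⟨ *-congˡ (∑<-cong N {λ j → g (n ℕ.* j)} {summand′} (λ j _ → g-n* j)) ⟩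
      c₀ * ∑< N summand′ ∎

-- The multiplication formula over a common denominator

module MultiplicationFormula {c₁ ℓ₁ c₂ ℓ₂ c₃ ℓ₃ ℓ₃′ : Level}
  (n : ℕ) .{{n≢0 : NonZero n}} {p : ℕ} (p-prime : Prime p) (p≢2 : p ≢ 2)
  {r : ℕ} .{{r≢0 : NonZero r}} (n∣q-1 : n ∣ (p ℕ.^ r ℕ.∸ 1))
  {F : FiniteField (p ℕ.^ r) c₁ ℓ₁} (Z : UnramifiedIntegers p F c₂ ℓ₂)
  (ω : TeichmüllerCharacter Z) (Γₚ : MoritaGamma p-prime) (E : ComplexExponential c₃ ℓ₃ ℓ₃′) where

  private
    q = p ℕ.^ r
    N = q ℕ.∸ 1
    instance
      N≢0 : NonZero N
      N≢0 = prime-power-pred-nonZero p-prime r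
    module F = FiniteField F
    module Z = UnramifiedIntegers Z
    module Zᵣ = CommutativeRing Z.commutativeRing
    module ∑Z = FiniteSums Zᵣ.+-commutativeMonoid

  open FactorProduct p-prime Z ω Γₚ using (factorProduct; hypergeometric; hypergeometric-value; hypergeometric-formula; sum-hypergeometric)
  open TeichmüllerCharacter ω using (ω̄^)
  open DefinedOverℚ E using (IsRepresentation)
  open Characters p-prime Z ω using (ω̄-power; ω̄-periodic; ω̄-twist-∣; ω̄-twist-∤)
  open Z.Fractions using (embed; cross)
  open CommutativeRing Z.fractionField
  open RawSemiringDefs (Semiring.rawSemiring semiring) using (_^_) renaming (sum to sumK)
  open FiniteSums +-commutativeMonoid

  private
    embed-cong : ∀ {x y} → x Zᵣ.≈ y → embed x ≈ embed y
    embed-cong eq = cross (Zᵣ.*-congˡ eq)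

    embed-∑ : ∀ k (f : ℕ → Zᵣ.Carrier) → embed (∑Z.∑< k f) ≈ ∑< k (embed ∘ f)
    embed-∑ zero    f = refl
    embed-∑ (suc k) f = trans (embed-cong (Zᵣ.sym (Zᵣ.+-cong (Zᵣ.*-identityˡ (f 0)) (Zᵣ.*-identityˡ (∑Z.∑< k (f ∘ suc))))))
      (+-congˡ (embed-∑ k (f ∘ suc)))

    N-even : 2 ∣ N
    N-even = ℕ.divides k (≡.trans (≡.cong ℕ.pred (proj₂ (odd-prime-power p-prime p≢2 r))) (ℕ.*-comm 2 k))
      where k = proj₁ (odd-prime-power p-prime p≢2 r)

  module CommonDenominator (d : ℕ) .{{d≢0 : NonZero d}} .{{L≢0 : NonZero (n ℕ.* d)}} (p∤L : ¬ p ∣ n ℕ.* d)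
    (W : ℕ) (WN≡L : W ℕ.* N ≡ n ℕ.* d) {m : ℕ} (a b : Vector ℚ m) (A B : Fin m → ℤ)
    (a≡ : ∀ i → a i ≡ A i ℚ./ (n ℕ.* d)) (b≡ : ∀ i → b i ≡ B i ℚ./ (n ℕ.* d))
    {ps qs : List ℕ} (representation : IsRepresentation (multiples n a) (multiples n b) ps qs) where

    private L = n ℕ.* d

    open FactorMultiplication p-prime {r = r} Z ω Γₚ n d p∤L W WN≡L
    open FactorProducts p-prime {r = r} Z ω Γₚ L p∤L W WN≡L using (factors-periodic)

    private
      invariance : ∀ w t →
        ∑ℤ (λ i → ρ L (w ℤ.* (+ n ℤ.* A i) ℤ.+ t)) ℤ.+ ∑ℤ (λ i → ρ L (w ℤ.* (+ p ℤ.* (+ n ℤ.* B i)) ℤ.+ t)) ≡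
        ∑ℤ (λ i → ρ L (w ℤ.* (+ n ℤ.* B i) ℤ.+ t)) ℤ.+ ∑ℤ (λ i → ρ L (w ℤ.* (+ p ℤ.* (+ n ℤ.* A i)) ℤ.+ t))
      invariance = ParameterInvariance.invariance E L (λ i → + n ℤ.* A i) (λ i → + n ℤ.* B i)
        (multiples≡ a A a≡) (multiples≡ b B b≡) representation p-prime p∤L

      f f′ : ℕ → Carrier
      f  = factorProduct (multiples n a) (multiples n b)
      f′ = factorProduct (translates n a) (translates n b)

      f′≈f : ∀ j → f′ j ≈ f (n ℕ.* j)
      f′≈f = factors-multiplication a b A B a≡ b≡ invariance

      f-periodic : ∀ j → f (N ℕ.+ j) ≈ f j
      f-periodic = factors-periodic (λ i → + n ℤ.* A i) (λ i → + n ℤ.* B i) {multiples n a} {multiples n b}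
        (multiples≡ a A a≡) (multiples≡ b B b≡)

    common-denominator-formula : (ζ : F.Carrier) → F.IsPrimitiveRoot n ζ → ∀ x →
      ∑< n (λ l → hypergeometric m (multiples n a) (multiples n b) (ζ F.^ l F.* x)) ≈
      hypergeometric (n ℕ.* m) (translates n a) (translates n b) (x F.^ n)
    common-denominator-formula ζ isPrimitive x =
      trans (∑<-cong n {λ l → hypergeometric m (multiples n a) (multiples n b) (ζ F.^ l F.* x)}
              {λ l → c₀ * ∑< N (λ j → (- 1#) ^ (j ℕ.* m) * embed (ω̄^ j (ζ F.^ l F.* x)) * f j)}
              (λ l _ → reflexive (hypergeometric-formula m (multiples n a) (multiples n b) (ζ F.^ l F.* x))))
        (trans
          (TwistedSums.twisted-sum Z.fractionField n n∣q-1 N-even m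
            (λ j → embed (ω̄^ j x)) (λ j → embed (ω̄^ j (x F.^ n))) (λ l j → embed (ω̄^ j (ζ F.^ l F.* x)))
            (λ j → embed-cong (ω̄-periodic j x)) (λ j → embed-cong (ω̄-power n j x))
            (λ l j n∣j → embed-cong (ω̄-twist-∣ n ζ isPrimitive j l x n∣j))
            (λ j n∤j → trans (sym (embed-∑ n (λ l → ω̄^ j (ζ F.^ l F.* x)))) (embed-cong (ω̄-twist-∤ n ζ isPrimitive j x n∤j)))
            f f′ f-periodic f′≈f c₀)
          (reflexive (≡.sym (hypergeometric-formula (n ℕ.* m) (translates n a) (translates n b) (x F.^ n)))))
      where c₀ = - embed (Z.unitInverse (Z.fromℕ N))

  hypergeometric-multiplication : ∀ {m : ℕ} (a b : Vector ℚ m) →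
    (∀ i → pIntegral p (a i)) → (∀ i → pIntegral p (b i)) →
    ∀ {ps qs : List ℕ} → IsRepresentation (multiples n a) (multiples n b) ps qs →
    (ζ : F.Carrier) → F.IsPrimitiveRoot n ζ → ∀ x →
    ∑< n (λ l → hypergeometric m (multiples n a) (multiples n b) (ζ F.^ l F.* x)) ≈
    hypergeometric (n ℕ.* m) (translates n a) (translates n b) (x F.^ n)
  hypergeometric-multiplication a b a-integral b-integral representation =
    CommonDenominator.common-denominator-formula d p∤L W WN≡L a b
      (proj₁ ∘ numeratorsA) (proj₁ ∘ numeratorsB) (proj₂ ∘ numeratorsA) (proj₂ ∘ numeratorsB) representation
    where
    -- `D` clears the denominators of the parameters, the factor `N` those of `j / (q - 1)`, and the
    -- factor `n` those of `l / n`. None of the three is divisible by `p`; for `n` this follows from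
    -- `n` dividing `q - 1`.
    D = denominator a ℕ.* denominator b
    d = N ℕ.* D
    L = n ℕ.* d
    W = n ℕ.* D

    instance
      D≢0 : NonZero D
      D≢0 = ℕ.m*n≢0 (denominator a) (denominator b) {{denominator≢0 a}} {{denominator≢0 b}}
      d≢0 : NonZero d
      d≢0 = ℕ.m*n≢0 N D
      L≢0 : NonZero L
      L≢0 = ℕ.m*n≢0 n d

    p∤N : ¬ p ∣ N
    p∤N = p∤p^r∸1 p-prime r

    p∤L : ¬ p ∣ L
    p∤L = ∤-* p-prime (λ p∣n → p∤N (ℕ.∣-trans p∣n n∣q-1))
      (∤-* p-prime p∤N (∤-* p-prime (∤denominator p-prime a a-integral) (∤denominator p-prime b b-integral)))

    WN≡L : W ℕ.* N ≡ L
    WN≡L = ≡.trans (ℕ.*-assoc n D N) (≡.cong (n ℕ.*_) (ℕ.*-comm D N))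

    D∣L : D ∣ L
    D∣L = ℕ.∣n⇒∣m*n n (ℕ.n∣m*n N)

    numeratorsA : ∀ i → ∃ λ A → a i ≡ A ℚ./ L
    numeratorsA i = numeratorOver L (a i) (ℕ.∣-trans (ℕ.∣-trans (↧∣denominator a i) (ℕ.m∣m*n (denominator b))) D∣L)

    numeratorsB : ∀ i → ∃ λ B → b i ≡ B ℚ./ L
    numeratorsB i = numeratorOver L (b i) (ℕ.∣-trans (ℕ.∣-trans (↧∣denominator b i) (ℕ.n∣m*n (denominator a))) D∣L)

  multiplication-formula : ∀ {m : ℕ} (a b : Vector ℚ m) →
    (∀ i → pIntegral p (a i)) → (∀ i → pIntegral p (b i)) →
    ∀ {ps qs : List ℕ} → IsRepresentation (multiples n a) (multiples n b) ps qs →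
    (ζ : F.Carrier) → F.IsPrimitiveRoot n ζ → ∀ x →
    sumK (λ (l : Fin n) → Hypergeometric.G p-prime {r} Z ω Γₚ m (multiples n a) (multiples n b) (ζ F.^ toℕ l F.* x)) ≈
    Hypergeometric.G p-prime {r} Z ω Γₚ (n ℕ.* m) (translates n a) (translates n b) (x F.^ n)
  multiplication-formula {m} a b a-integral b-integral representation ζ isPrimitive x =
    trans (reflexive (≡.sym (sum-hypergeometric n m (multiples n a) (multiples n b) (λ l → ζ F.^ toℕ l F.* x))))
      (trans (hypergeometric-multiplication a b a-integral b-integral representation ζ isPrimitive x)
        (reflexive (hypergeometric-value (n ℕ.* m) (translates n {{n≢0}} a) (translates n {{n≢0}} b) (x F.^ n))))

theorem2p8 :
  ∀ {c₁ ℓ₁ c₂ ℓ₂ c₃ ℓ₃ ℓ₃′ : Level}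
    (n : ℕ) .{{_ : NonZero n}}
    (p : ℕ) (p-prime : Prime p) → p ≢ 2 →
    (r : ℕ) .{{_ : NonZero r}} → n ∣ (p ℕ.^ r ℕ.∸ 1) →
    (F : FiniteField (p ℕ.^ r) c₁ ℓ₁)
    (Z : UnramifiedIntegers p F c₂ ℓ₂)
    (ω : TeichmüllerCharacter Z)
    (Γₚ : MoritaGamma p-prime)
    (E : ComplexExponential c₃ ℓ₃ ℓ₃′) →
  let
    module F = FiniteField F
    module K = CommutativeRing (UnramifiedIntegers.fractionField Z)
    open RawSemiringDefs (Semiring.rawSemiring K.semiring) using (sum)
    open Hypergeometric p-prime Z ω Γₚ using (G)
    open DefinedOverℚ E using (AreDefinedOverℚ)
    open DefinedOverℚ E using (HasExponents)
  in
    (ζ : F.Carrier) → F.IsPrimitiveRoot n ζ →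
    (x : F.Carrier)
    (m : ℕ) .{{_ : NonZero m}} (a b : Vector ℚ m) →
    (∀ i → pIntegral p (a i)) → (∀ i → pIntegral p (b i)) →
    (AreDefinedOverℚ (multiples n a) (multiples n b) →
      sum (λ (l : Fin n) → G m (multiples n a) (multiples n b) (ζ F.^ toℕ l F.* x))
        K.≈ G (n ℕ.* m) (translates n a) (translates n b) (x F.^ n))
    ×
    (∀ (ps qs : List ℕ) →
      HasExponents (multiples n a) (multiples n b) ps qs →
      HasExponents (translates n a) (translates n b)
        (List.map (n ℕ.*_) ps) (List.map (n ℕ.*_) qs))
theorem2p8 n {{n≢0}} p p-prime p≢2 r {{r≢0}} n∣q-1 F Z ω Γₚ E ζ isPrimitive x m a b a-integral b-integral =
  (λ (ps , qs , representation , _) →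
    MultiplicationFormula.multiplication-formula n {{n≢0}} p-prime p≢2 {r} {{r≢0}} n∣q-1 Z ω Γₚ E a b a-integral b-integral representation ζ isPrimitive x) ,
  RationalParameters.translates-hasExponents E n a b
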